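{- Let $$\varphi_{10}^{\pm}(x,y)=x^{10}-(45\pm18\sqrt5)x^8y^2+(378\pm168\sqrt5)x^6y^4-\left(714\pm\tfrac{1596}{5}\sqrt5\right)x^4y^6+\left(\tfrac{1449}{5}\pm\tfrac{648}{5}\sqrt5\right)x^2y^8-\left(\tfrac{61}{5}\pm\tfrac{682}{125}\sqrt5\right)y^{10},$$ regarded as formal weight enumerators for $q=2\pm\frac{2\sqrt5}{5}$ (corresponding signs). Then: (i) The extremal formal weight enumerator $\varphi_{10}^{+}(x,y)$ (with $q=2+\frac{2\sqrt5}{5}$) does not satisfy the Riemann hypothesis. (ii) The extremal formal weight enumerator $\varphi_{10}^{ - }(x,y)$ (with $q=2-\frac{2\sqrt5}{5}$) satisfies the Riemann hypothesis.
   Context: For a matrix $\sigma=\begin{pmatrix} a&b\\ c&e\end{pmatrix}$ and $f\in\mathbf{C}[x,y]$ put $f^\sigma(x,y)=f(ax+by,cx+ey)$; for real $q>0$, $q\ne1$, let $\sigma_q=\frac{1}{\sqrt q}\begin{pmatrix}1&q-1\\1&-1\end{pmatrix}$. A formal weight enumerator for $q$ is a homogeneous polynomial $W(x,y)=x^n+\sum_{i=d}^nA_ix^{n-i}y^i\in\mathbf{C}[x,y]$ with $A_d\ne0$ and $W^{\sigma_q}=-W$. It is divisible by $c\in\mathbf{N}$ if $A_i\neq0$ implies $c\mid i$. For fixed $q,c,n$, a formal weight enumerator for $q$ of degree $n$ divisible by $c$ is called extremal if its $d$ is maximal among all formal weight enumerators for $q$ of degree $n$ divisible by $c$. Here $c=2$,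 $n=10$, and $\varphi_{10}^\pm$ (which have $d=2$) are extremal formal weight enumerators for $q=2\pm\frac{2\sqrt5}{5}$. Zeta polynomial: for $W(x,y)=x^n+\sum_{i=d}^nA_ix^{n-i}y^i$ with $A_d\ne0$ (here $d\ge2$) and real $q>0$, $q\neq1$, the zeta polynomial of $W$ is the unique $P(T)\in\mathbf{C}[T]$ of degree at most $n-d$ such that, expanding in powers of $T$, the coefficient of $T^{n-d}$ in $$\frac{P(T)}{(1-T)(1-qT)}\,(y(1-T)+xT)^n$$ equals $\dfrac{W(x,y)-x^n}{q-1}$. Riemann hypothesis: $W$ with $W^{\sigma_q}=\pm W$ satisfies the Riemann hypothesis if all zeros of its zeta polynomial $P(T)$ in $\mathbf{C}$ have absolute value $1/\sqrt q$. -}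

module Defs where

open import Algebra.Bundles.Raw using (RawRing)
import Algebra.Definitions.RawSemiring as RawSemiringOps
open import Data.Fin.Base as Fin using (Fin; toℕ)
open import Data.Integer.Base as ℤ using (ℤ; +_; -[1+_]; +[1+_])
import Data.Integer.Properties as ℤ
open import Data.Nat.Base as ℕ using (ℕ; zero; suc; _∸_)
open import Data.Nat.Divisibility using (_∣_)
open import Data.Nat.DivMod using (m≡m%n+[m/n]*n; m%n<n; m/n*n≤m)
import Data.Nat.Properties as ℕ
open import Data.Product.Base using (Σ-syntax; ∃-syntax; _×_; _,_; proj₁; proj₂)
open import Data.Rational.Base as ℚ using (ℚ; mkℚ; 0ℚ; 1ℚ; ½; ↥_; ↧ₙ_)
import Data.Rational.Properties as ℚ
import Data.Rational.Solver as ℚ-Solver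
open import Data.Rational.Unnormalised.Base as ℚᵘ using (mkℚᵘ)
import Data.Rational.Unnormalised.Properties as ℚᵘ
open import Data.Sum.Base using (inj₁; inj₂)
open import Level using (Level; 0ℓ)
open import Relation.Nullary using (¬_; yes; no; contradiction)
open import Relation.Binary.PropositionalEquality

module ℚ-Lemmas where
  open import Data.Rational.Base using (_+_; _*_; _-_; -_; _≤_; _<_; ∣_∣; 1/_; >-nonZero; positive; nonNegative)
  open ℚ-Solver.+-*-Solver using (solve; _:=_; _:+_; _:*_; _:-_; :-_; con)

  ∣-∣-sym : ∀ p q → ∣ p - q ∣ ≡ ∣ q - p ∣
  ∣-∣-sym p q = trans (sym (ℚ.∣-p∣≡∣p∣ (p - q)))
    (cong ∣_∣ (solve 2 (λ p q → :- (p :- q) := q :- p) refl p q))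

  ∣∣-triangle : ∀ p q → ∣ p ∣ ≤ ∣ p - q ∣ + ∣ q ∣
  ∣∣-triangle p q = subst (λ r → ∣ r ∣ ≤ ∣ p - q ∣ + ∣ q ∣)
    (solve 2 (λ p q → (p :- q) :+ q := p) refl p q) (ℚ.∣p+q∣≤∣p∣+∣q∣ (p - q) q)

  half+half : ∀ ε → ½ * ε + ½ * ε ≡ ε
  half+half ε = solve 1 (λ ε → con ½ :* ε :+ con ½ :* ε := ε) refl ε

  0<* : ∀ {p q} → 0ℚ < p → 0ℚ < q → 0ℚ < p * q
  0<* {p} {q} 0<p 0<q =
    ℚ.positive⁻¹ (p * q) {{ℚ.pos*pos⇒pos p {{positive 0<p}} q {{positive 0<q}}}}

  0<+ : ∀ {p q} → 0ℚ < p → 0ℚ < q → 0ℚ < p + q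
  0<+ {p} {q} 0<p 0<q =
    ℚ.positive⁻¹ (p + q) {{ℚ.pos+pos⇒pos p {{positive 0<p}} q {{positive 0<q}}}}

  0<½* : ∀ {ε} → 0ℚ < ε → 0ℚ < ½ * ε
  0<½* 0<ε = 0<* (ℚ.positive⁻¹ ½) 0<ε

  *-mono-≤ : ∀ {p q r s} → 0ℚ ≤ p → 0ℚ ≤ s → p ≤ q → r ≤ s → p * r ≤ q * s
  *-mono-≤ {p} {q} {r} {s} 0≤p 0≤s p≤q r≤s = ℚ.≤-trans
    (ℚ.*-monoˡ-≤-nonNeg p {{nonNegative 0≤p}} r≤s)
    (ℚ.*-monoʳ-≤-nonNeg s {{nonNegative 0≤s}} p≤q)

  divide : ∀ {ε K} → 0ℚ < ε → 0ℚ < K → ∃[ δ ] 0ℚ < δ × δ * K ≡ ε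
  divide {ε} {K} 0<ε 0<K = ε * 1/K , 0<* 0<ε (ℚ.positive⁻¹ 1/K {{ℚ.1/pos⇒pos K {{positive 0<K}}}}) ,
    (begin
      ε * 1/K * K   ≡⟨ ℚ.*-assoc ε 1/K K ⟩
      ε * (1/K * K) ≡⟨ cong (ε *_) (ℚ.*-inverseˡ K {{>-nonZero 0<K}}) ⟩
      ε * 1ℚ        ≡⟨ ℚ.*-identityʳ ε ⟩
      ε             ∎)
    where
    open ≡-Reasoning
    1/K = (1/ K) {{>-nonZero 0<K}}

  +-swap-≤ : ∀ {p q r} → p - q ≤ r → p ≤ r + q
  +-swap-≤ {p} {q} {r} h = subst (_≤ r + q)
    (solve 2 (λ p q → (p :- q) :+ q := p) refl p q) (ℚ.+-monoˡ-≤ q h)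

  p≤∣p∣ : ∀ p → p ≤ ∣ p ∣
  p≤∣p∣ p with ℚ.≤-total 0ℚ p
  ... | inj₁ 0≤p = ℚ.≤-reflexive (sym (ℚ.0≤p⇒∣p∣≡p 0≤p))
  ... | inj₂ p≤0 = ℚ.≤-trans p≤0 (ℚ.0≤∣p∣ p)

  ∣∣-≤ : ∀ {p q ε} → p ≤ q + ε → q ≤ p + ε → ∣ p - q ∣ ≤ ε
  ∣∣-≤ {p} {q} {ε} p≤ q≤ with ℚ.∣p∣≡p∨∣p∣≡-p (p - q)
  ... | inj₁ eq = subst₂ _≤_ (sym eq)
          (solve 2 (λ q ε → (q :+ ε) :- q := ε) refl q ε) (ℚ.+-monoˡ-≤ (- q) p≤)
  ... | inj₂ eq = subst₂ _≤_
          (trans (solve 2 (λ p q → q :- p := :- (p :- q)) refl p q) (sym eq))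
          (solve 2 (λ q ε → (q :+ ε) :- q := ε) refl p ε) (ℚ.+-monoˡ-≤ (- p) q≤)

  *-diff-≤ : ∀ a b a′ b′ → ∣ a * b - a′ * b′ ∣ ≤ ∣ a - a′ ∣ * ∣ b′ ∣ + ∣ a ∣ * ∣ b - b′ ∣
  *-diff-≤ a b a′ b′ = begin
    ∣ a * b - a′ * b′ ∣                         ≡⟨ cong ∣_∣ (solve 4 (λ a b a′ b′ →
                                                     a :* b :- a′ :* b′ := (a :- a′) :* b′ :+ a :* (b :- b′))
                                                     refl a b a′ b′) ⟩
    ∣ (a - a′) * b′ + a * (b - b′) ∣            ≤⟨ ℚ.∣p+q∣≤∣p∣+∣q∣ ((a - a′) * b′) (a * (b - b′)) ⟩
    ∣ (a - a′) * b′ ∣ + ∣ a * (b - b′) ∣        ≡⟨ cong₂ _+_ (ℚ.∣p*q∣≡∣p∣*∣q∣ (a - a′) b′)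
                                                              (ℚ.∣p*q∣≡∣p∣*∣q∣ a (b - b′)) ⟩
    ∣ a - a′ ∣ * ∣ b′ ∣ + ∣ a ∣ * ∣ b - b′ ∣    ∎
    where open ℚ.≤-Reasoning

open ℚ-Lemmas

-- Cauchy sequences of rationals; the proof carries a modulus.
record ℝ : Set where
  field
    seq    : ℕ → ℚ
    cauchy : ∀ ε → 0ℚ ℚ.< ε →
             ∃[ N ] (∀ m n → N ℕ.≤ m → N ℕ.≤ n → ℚ.∣ seq m ℚ.- seq n ∣ ℚ.≤ ε)

open ℝ public

infix 4 _≃_ _<_ _#_

_≃_ : ℝ → ℝ → Set
x ≃ y = ∀ ε → 0ℚ ℚ.< ε → ∃[ N ] (∀ n → N ℕ.≤ n → ℚ.∣ seq x n ℚ.- seq y n ∣ ℚ.≤ ε)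

_<_ : ℝ → ℝ → Set
x < y = ∃[ ε ] 0ℚ ℚ.< ε × ∃[ N ] (∀ n → N ℕ.≤ n → seq x n ℚ.+ ε ℚ.≤ seq y n)

-- Apartness, the constructive form of ≠ that permits division.
_#_ : ℝ → ℝ → Set
x # y = ∃[ ε ] 0ℚ ℚ.< ε × ∃[ N ] (∀ n → N ℕ.≤ n → ε ℚ.≤ ℚ.∣ seq x n ℚ.- seq y n ∣)

fromℚ : ℚ → ℝ
fromℚ p = record
  { seq    = λ _ → p
  ; cauchy = λ ε 0<ε → 0 , λ _ _ _ _ →
      subst (ℚ._≤ ε) (cong ℚ.∣_∣ (sym (ℚ.+-inverseʳ p))) (ℚ.<⇒≤ 0<ε)
  }

0ℝ 1ℝ : ℝ
0ℝ = fromℚ 0ℚ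
1ℝ = fromℚ 1ℚ

infixl 6 _+ᵣ_ _-ᵣ_
infixl 7 _*ᵣ_
infix  8 -ᵣ_

_+ᵣ_ : ℝ → ℝ → ℝ
seq    (x +ᵣ y) n = seq x n ℚ.+ seq y n
cauchy (x +ᵣ y) ε 0<ε =
  let M , hx = cauchy x (½ ℚ.* ε) (0<½* 0<ε)
      N , hy = cauchy y (½ ℚ.* ε) (0<½* 0<ε)
  in M ℕ.⊔ N , λ m n p q → begin
    ℚ.∣ (seq x m ℚ.+ seq y m) ℚ.- (seq x n ℚ.+ seq y n) ∣
      ≡⟨ cong ℚ.∣_∣ (solve 4 (λ a b c d → (a :+ b) :- (c :+ d) := (a :- c) :+ (b :- d)) refl
           (seq x m) (seq y m) (seq x n) (seq y n)) ⟩
    ℚ.∣ (seq x m ℚ.- seq x n) ℚ.+ (seq y m ℚ.- seq y n) ∣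
      ≤⟨ ℚ.∣p+q∣≤∣p∣+∣q∣ (seq x m ℚ.- seq x n) (seq y m ℚ.- seq y n) ⟩
    ℚ.∣ seq x m ℚ.- seq x n ∣ ℚ.+ ℚ.∣ seq y m ℚ.- seq y n ∣
      ≤⟨ ℚ.+-mono-≤ (hx m n (ℕ.m⊔n≤o⇒m≤o M N p) (ℕ.m⊔n≤o⇒m≤o M N q))
                    (hy m n (ℕ.m⊔n≤o⇒n≤o M N p) (ℕ.m⊔n≤o⇒n≤o M N q)) ⟩
    ½ ℚ.* ε ℚ.+ ½ ℚ.* ε
      ≡⟨ half+half ε ⟩
    ε ∎
  where
  open ℚ.≤-Reasoning
  open ℚ-Solver.+-*-Solver using (solve; _:=_; _:+_; _:-_)

-ᵣ_ : ℝ → ℝ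
seq    (-ᵣ x) n = ℚ.- seq x n
cauchy (-ᵣ x) ε 0<ε =
  let N , h = cauchy x ε 0<ε
  in N , λ m n p q → subst (ℚ._≤ ε)
       (cong ℚ.∣_∣ (solve 2 (λ a b → b :- a := (:- a) :- (:- b)) refl (seq x m) (seq x n)))
       (h n m q p)
  where
  open ℚ-Solver.+-*-Solver using (solve; _:=_; _:-_; :-_)

_-ᵣ_ : ℝ → ℝ → ℝ
x -ᵣ y = x +ᵣ (-ᵣ y)

eventually-bounded : ∀ x → ∃[ B ] 0ℚ ℚ.< B × ∃[ N ] (∀ n → N ℕ.≤ n → ℚ.∣ seq x n ∣ ℚ.≤ B)
eventually-bounded x =
  let N , h = cauchy x 1ℚ (ℚ.positive⁻¹ 1ℚ)
  in 1ℚ ℚ.+ ℚ.∣ seq x N ∣ ,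
     ℚ.+-mono-<-≤ (ℚ.positive⁻¹ 1ℚ) (ℚ.0≤∣p∣ (seq x N)) ,
     N , λ n N≤n → ℚ.≤-trans (∣∣-triangle (seq x n) (seq x N))
                     (ℚ.+-monoˡ-≤ ℚ.∣ seq x N ∣ (h n N N≤n ℕ.≤-refl))

_*ᵣ_ : ℝ → ℝ → ℝ
seq    (x *ᵣ y) n = seq x n ℚ.* seq y n
cauchy (x *ᵣ y) ε 0<ε =
  let A , 0<A , K , hA = eventually-bounded x
      B , 0<B , L , hB = eventually-bounded y
      δ , 0<δ , δ[B+A]≡ε = divide 0<ε (0<+ 0<B 0<A)
      M , hx = cauchy x δ 0<δ
      N , hy = cauchy y δ 0<δ
      KL = K ℕ.⊔ L
      MN = M ℕ.⊔ N
  in KL ℕ.⊔ MN , λ m n p q →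
    let p₁ = ℕ.m⊔n≤o⇒m≤o KL MN p; p₂ = ℕ.m⊔n≤o⇒n≤o KL MN p
        q₁ = ℕ.m⊔n≤o⇒m≤o KL MN q; q₂ = ℕ.m⊔n≤o⇒n≤o KL MN q
    in begin
    ℚ.∣ seq x m ℚ.* seq y m ℚ.- seq x n ℚ.* seq y n ∣
      ≤⟨ *-diff-≤ (seq x m) (seq y m) (seq x n) (seq y n) ⟩
    ℚ.∣ seq x m ℚ.- seq x n ∣ ℚ.* ℚ.∣ seq y n ∣ ℚ.+ ℚ.∣ seq x m ∣ ℚ.* ℚ.∣ seq y m ℚ.- seq y n ∣
      ≤⟨ ℚ.+-mono-≤
           (*-mono-≤ (ℚ.0≤∣p∣ (seq x m ℚ.- seq x n)) (ℚ.<⇒≤ 0<B)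
              (hx m n (ℕ.m⊔n≤o⇒m≤o M N p₂) (ℕ.m⊔n≤o⇒m≤o M N q₂)) (hB n (ℕ.m⊔n≤o⇒n≤o K L q₁)))
           (*-mono-≤ (ℚ.0≤∣p∣ (seq x m)) (ℚ.<⇒≤ 0<δ)
              (hA m (ℕ.m⊔n≤o⇒m≤o K L p₁)) (hy m n (ℕ.m⊔n≤o⇒n≤o M N p₂) (ℕ.m⊔n≤o⇒n≤o M N q₂))) ⟩
    δ ℚ.* B ℚ.+ A ℚ.* δ
      ≡⟨ solve 3 (λ δ A B → δ :* B :+ A :* δ := δ :* (B :+ A)) refl δ A B ⟩
    δ ℚ.* (B ℚ.+ A)
      ≡⟨ δ[B+A]≡ε ⟩
    ε ∎
  where
  open ℚ.≤-Reasoning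
  open ℚ-Solver.+-*-Solver using (solve; _:=_; _:+_; _:*_)

ℝ-rawRing : RawRing 0ℓ 0ℓ
ℝ-rawRing = record
  { Carrier = ℝ ; _≈_ = _≃_ ; _+_ = _+ᵣ_ ; _*_ = _*ᵣ_ ; -_ = -ᵣ_ ; 0# = 0ℝ ; 1# = 1ℝ }

reciprocal : ℚ → ℚ
reciprocal p with p ℚ.≟ 0ℚ
... | yes _  = 0ℚ
... | no p≢0 = (ℚ.1/ p) {{ℚ.≢-nonZero p≢0}}

reciprocal-inverseʳ : ∀ p → p ≢ 0ℚ → p ℚ.* reciprocal p ≡ 1ℚ
reciprocal-inverseʳ p p≢0 with p ℚ.≟ 0ℚ
... | yes p≡0 = contradiction p≡0 p≢0
... | no  p≢0 = ℚ.*-inverseʳ p {{ℚ.≢-nonZero p≢0}}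

bounded⇒≢0 : ∀ {ε p} → 0ℚ ℚ.< ε → ε ℚ.≤ ℚ.∣ p ∣ → p ≢ 0ℚ
bounded⇒≢0 0<ε ε≤∣p∣ refl = ℚ.<-irrefl refl (ℚ.<-≤-trans 0<ε ε≤∣p∣)

reciprocal-lipschitz : ∀ {e δ a b} → 0ℚ ℚ.< e → e ℚ.≤ ℚ.∣ a ∣ → e ℚ.≤ ℚ.∣ b ∣ →
  ℚ.∣ b ℚ.- a ∣ ℚ.≤ δ ℚ.* (e ℚ.* e) → ℚ.∣ reciprocal a ℚ.- reciprocal b ∣ ℚ.≤ δ
reciprocal-lipschitz {e} {δ} {a} {b} 0<e e≤a e≤b h =
  ℚ.*-cancelʳ-≤-pos (e ℚ.* e) {{ℚ.positive (0<* 0<e 0<e)}} (begin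
    ℚ.∣ u ℚ.- v ∣ ℚ.* (e ℚ.* e)
      ≤⟨ ℚ.*-monoˡ-≤-nonNeg ℚ.∣ u ℚ.- v ∣ {{ℚ.∣-∣-nonNeg (u ℚ.- v)}}
           (*-mono-≤ (ℚ.<⇒≤ 0<e) (ℚ.0≤∣p∣ b) e≤a e≤b) ⟩
    ℚ.∣ u ℚ.- v ∣ ℚ.* (ℚ.∣ a ∣ ℚ.* ℚ.∣ b ∣)
      ≡⟨ cong (ℚ.∣ u ℚ.- v ∣ ℚ.*_) (sym (ℚ.∣p*q∣≡∣p∣*∣q∣ a b)) ⟩
    ℚ.∣ u ℚ.- v ∣ ℚ.* ℚ.∣ a ℚ.* b ∣
      ≡⟨ sym (ℚ.∣p*q∣≡∣p∣*∣q∣ (u ℚ.- v) (a ℚ.* b)) ⟩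
    ℚ.∣ (u ℚ.- v) ℚ.* (a ℚ.* b) ∣
      ≡⟨ cong ℚ.∣_∣ (solve 4 (λ a b u v → (u :- v) :* (a :* b) := (a :* u) :* b :- (b :* v) :* a)
           refl a b u v) ⟩
    ℚ.∣ (a ℚ.* u) ℚ.* b ℚ.- (b ℚ.* v) ℚ.* a ∣
      ≡⟨ cong₂ (λ s t → ℚ.∣ s ℚ.* b ℚ.- t ℚ.* a ∣)
           (reciprocal-inverseʳ a (bounded⇒≢0 0<e e≤a)) (reciprocal-inverseʳ b (bounded⇒≢0 0<e e≤b)) ⟩
    ℚ.∣ 1ℚ ℚ.* b ℚ.- 1ℚ ℚ.* a ∣
      ≡⟨ cong₂ (λ s t → ℚ.∣ s ℚ.- t ∣) (ℚ.*-identityˡ b) (ℚ.*-identityˡ a) ⟩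
    ℚ.∣ b ℚ.- a ∣
      ≤⟨ h ⟩
    δ ℚ.* (e ℚ.* e) ∎)
  where
  u = reciprocal a
  v = reciprocal b
  open ℚ.≤-Reasoning
  open ℚ-Solver.+-*-Solver using (solve; _:=_; _:*_; _:-_)

1/ℝ : (x : ℝ) → x # 0ℝ → ℝ
seq    (1/ℝ x _) n = reciprocal (seq x n)
cauchy (1/ℝ x (e , 0<e , M , x#0)) ε 0<ε =
  let N , h = cauchy x (ε ℚ.* (e ℚ.* e)) (0<* 0<ε (0<* 0<e 0<e))
  in M ℕ.⊔ N , λ m n p q → reciprocal-lipschitz 0<e
       (away m (ℕ.m⊔n≤o⇒m≤o M N p)) (away n (ℕ.m⊔n≤o⇒m≤o M N q))
       (h n m (ℕ.m⊔n≤o⇒n≤o M N q) (ℕ.m⊔n≤o⇒n≤o M N p))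
  where
  away : ∀ n → M ℕ.≤ n → e ℚ.≤ ℚ.∣ seq x n ∣
  away n M≤n = subst (λ p → e ℚ.≤ ℚ.∣ p ∣) (ℚ.+-identityʳ (seq x n)) (x#0 n M≤n)

isqrt : ℕ → ℕ
isqrt zero    = 0
isqrt (suc n) with suc (isqrt n) ℕ.* suc (isqrt n) ℕ.≤? suc n
... | yes _ = suc (isqrt n)
... | no  _ = isqrt n

isqrt-spec : ∀ n → isqrt n ℕ.* isqrt n ℕ.≤ n × n ℕ.< suc (isqrt n) ℕ.* suc (isqrt n)
isqrt-spec zero    = ℕ.z≤n , ℕ.s≤s ℕ.z≤n
isqrt-spec (suc n) with suc (isqrt n) ℕ.* suc (isqrt n) ℕ.≤? suc n | isqrt-spec n
... | yes h | _ , n< = h , ℕ.≤-<-trans n< (ℕ.*-mono-< (ℕ.n<1+n (suc (isqrt n))) (ℕ.n<1+n (suc (isqrt n))))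
... | no ¬h | ≤n , _ = ℕ.m≤n⇒m≤1+n ≤n , ℕ.≰⇒> ¬h

unit : ℕ → ℚ
unit n = + 1 ℚ./ suc n

-- The largest multiple of 1/(n+1) whose square is at most ∣p∣.
rootBelow : ℕ → ℚ → ℚ
rootBelow n p = + isqrt (ℤ.∣ ↥ p ∣ ℕ.* (suc n ℕ.* suc n) ℕ./ ↧ₙ p) ℚ./ suc n

toℚᵘ-/ : ∀ k n → ℚ.toℚᵘ (+ k ℚ./ suc n) ℚᵘ.≃ mkℚᵘ (+ k) n
toℚᵘ-/ k n = ℚ.toℚᵘ-fromℚᵘ (mkℚᵘ (+ k) n)

toℚᵘ-square : ∀ k n → ℚ.toℚᵘ ((+ k ℚ./ suc n) ℚ.* (+ k ℚ./ suc n)) ℚᵘ.≃ mkℚᵘ (+ k) n ℚᵘ.* mkℚᵘ (+ k) n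
toℚᵘ-square k n = ℚᵘ.≃-trans (ℚ.toℚᵘ-homo-* (+ k ℚ./ suc n) (+ k ℚ./ suc n))
  (ℚᵘ.*-cong (toℚᵘ-/ k n) (toℚᵘ-/ k n))

rootBelow-lower : ∀ n p → rootBelow n p ℚ.* rootBelow n p ℚ.≤ ℚ.∣ p ∣
rootBelow-lower n p@(mkℚ z d-1 _) = ℚ.toℚᵘ-cancel-≤
  (ℚᵘ.≤-respˡ-≃ (ℚᵘ.≃-sym (toℚᵘ-square k n)) (ℚᵘ.*≤* (subst₂ ℤ._≤_
    (trans (ℤ.pos-* (k ℕ.* k) (suc d-1)) (cong (ℤ._* + suc d-1) (ℤ.pos-* k k)))
    (ℤ.pos-* a NN) (ℤ.+≤+ bound))))
  where
  a  = ℤ.∣ z ∣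
  NN = suc n ℕ.* suc n
  m  = a ℕ.* NN ℕ./ suc d-1
  k  = isqrt m
  bound : k ℕ.* k ℕ.* suc d-1 ℕ.≤ a ℕ.* NN
  bound = ℕ.≤-trans (ℕ.*-monoˡ-≤ (suc d-1) (proj₁ (isqrt-spec m))) (m/n*n≤m (a ℕ.* NN) (suc d-1))

/-suc : ∀ k n → (+ k ℚ./ suc n) ℚ.+ unit n ≡ + suc k ℚ./ suc n
/-suc k n = ℚ.toℚᵘ-injective (ℚᵘ.≃-trans (ℚ.toℚᵘ-homo-+ (+ k ℚ./ suc n) (unit n))
  (ℚᵘ.≃-trans (ℚᵘ.+-cong (toℚᵘ-/ k n) (toℚᵘ-/ 1 n))
  (ℚᵘ.≃-trans (ℚᵘ.*≡* (begin
    (+ k ℤ.* N ℤ.+ + 1 ℤ.* N) ℤ.* N ≡⟨ cong (ℤ._* N) (sym (ℤ.*-distribʳ-+ N (+ k) (+ 1))) ⟩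
    ((+ k ℤ.+ + 1) ℤ.* N) ℤ.* N     ≡⟨ cong (λ j → (+ j ℤ.* N) ℤ.* N) (ℕ.+-comm k 1) ⟩
    (+ suc k ℤ.* N) ℤ.* N           ≡⟨ ℤ.*-assoc (+ suc k) N N ⟩
    + suc k ℤ.* (N ℤ.* N)           ∎))
  (ℚᵘ.≃-sym (toℚᵘ-/ (suc k) n)))))
  where
  open ≡-Reasoning
  N = + suc n

rootBelow-upper : ∀ n p →
  ℚ.∣ p ∣ ℚ.< (rootBelow n p ℚ.+ unit n) ℚ.* (rootBelow n p ℚ.+ unit n)
rootBelow-upper n p@(mkℚ z d-1 _) = subst (λ r → ℚ.∣ p ∣ ℚ.< r ℚ.* r) (sym (/-suc k n))
  (ℚ.toℚᵘ-cancel-< (ℚᵘ.<-respʳ-≃ (ℚᵘ.≃-sym (toℚᵘ-square (suc k) n)) (ℚᵘ.*<* (subst₂ ℤ._<_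
    (ℤ.pos-* a NN)
    (trans (ℤ.pos-* (suc k ℕ.* suc k) (suc d-1)) (cong (ℤ._* + suc d-1) (ℤ.pos-* (suc k) (suc k))))
    (ℤ.+<+ bound)))))
  where
  a  = ℤ.∣ z ∣
  NN = suc n ℕ.* suc n
  m  = a ℕ.* NN ℕ./ suc d-1
  k  = isqrt m
  bound : a ℕ.* NN ℕ.< suc k ℕ.* suc k ℕ.* suc d-1
  bound = begin-strict
    a ℕ.* NN                                        ≡⟨ m≡m%n+[m/n]*n (a ℕ.* NN) (suc d-1) ⟩
    (a ℕ.* NN) ℕ.% suc d-1 ℕ.+ m ℕ.* suc d-1        <⟨ ℕ.+-monoˡ-< (m ℕ.* suc d-1) (m%n<n (a ℕ.* NN) (suc d-1)) ⟩
    suc m ℕ.* suc d-1                               ≤⟨ ℕ.*-monoˡ-≤ (suc d-1) (proj₂ (isqrt-spec m)) ⟩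
    suc k ℕ.* suc k ℕ.* suc d-1                     ∎
    where open ℕ.≤-Reasoning

0≤rootBelow : ∀ n p → 0ℚ ℚ.≤ rootBelow n p
0≤rootBelow n p = ℚ.nonNegative⁻¹ (rootBelow n p)
  {{ℚ.normalize-nonNeg (isqrt (ℤ.∣ ↥ p ∣ ℕ.* (suc n ℕ.* suc n) ℕ./ ↧ₙ p)) (suc n)}}

0≤unit : ∀ n → 0ℚ ℚ.≤ unit n
0≤unit n = ℚ.nonNegative⁻¹ (unit n) {{ℚ.normalize-nonNeg 1 (suc n)}}

archimedean : ∀ δ → 0ℚ ℚ.< δ → ∃[ N ] (∀ n → N ℕ.≤ n → unit n ℚ.≤ δ)
archimedean δ@(mkℚ +[1+ a ] b _) _ = b , λ n b≤n → ℚ.toℚᵘ-cancel-≤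
  (ℚᵘ.≤-respˡ-≃ (ℚᵘ.≃-sym (toℚᵘ-/ 1 n)) (ℚᵘ.*≤* (subst₂ ℤ._≤_
    (ℤ.pos-* 1 (suc b)) (ℤ.pos-* (suc a) (suc n))
    (ℤ.+≤+ (ℕ.*-mono-≤ (ℕ.s≤s (ℕ.z≤n {a})) (ℕ.s≤s b≤n))))))
archimedean (mkℚ (+ 0) b _) (ℚ.*<* (ℤ.+<+ ()))
archimedean (mkℚ -[1+ a ] b _) (ℚ.*<* ())

rootBelow-close : ∀ {ε} m n p q → 0ℚ ℚ.< ε → unit n ℚ.≤ ½ ℚ.* ε →
  ℚ.∣ p ℚ.- q ∣ ℚ.≤ (½ ℚ.* ε) ℚ.* (½ ℚ.* ε) → rootBelow m p ℚ.≤ rootBelow n q ℚ.+ ε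
rootBelow-close {ε} m n p q 0<ε unit≤ near with rootBelow m p ℚ.≤? (rootBelow n q ℚ.+ ε)
... | yes h = h
... | no ¬h = contradiction (begin-strict
    u ℚ.* u                                       ≤⟨ rootBelow-lower m p ⟩
    ℚ.∣ p ∣                                       ≤⟨ ∣∣-triangle p q ⟩
    ℚ.∣ p ℚ.- q ∣ ℚ.+ ℚ.∣ q ∣                     ≤⟨ ℚ.+-monoˡ-≤ ℚ.∣ q ∣ near ⟩
    h½ ℚ.* h½ ℚ.+ ℚ.∣ q ∣                         <⟨ ℚ.+-monoʳ-< (h½ ℚ.* h½) (rootBelow-upper n q) ⟩
    h½ ℚ.* h½ ℚ.+ (v ℚ.+ unit n) ℚ.* (v ℚ.+ unit n)
      ≤⟨ ℚ.+-monoʳ-≤ (h½ ℚ.* h½) (*-mono-≤ (ℚ.+-mono-≤ 0≤v (0≤unit n)) 0≤v+h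
           (ℚ.+-monoʳ-≤ v unit≤) (ℚ.+-monoʳ-≤ v unit≤)) ⟩
    h½ ℚ.* h½ ℚ.+ (v ℚ.+ h½) ℚ.* (v ℚ.+ h½)
      ≡⟨ solve 2 (λ v h → h :* h :+ (v :+ h) :* (v :+ h) := v :* v :+ v :* (h :+ h) :+ (h :* h :+ h :* h)) refl v h½ ⟩
    v ℚ.* v ℚ.+ v ℚ.* (h½ ℚ.+ h½) ℚ.+ (h½ ℚ.* h½ ℚ.+ h½ ℚ.* h½)
      ≤⟨ p≤p+q (ℚ.+-mono-≤ (0≤* 0≤v (ℚ.+-mono-≤ 0≤h 0≤h)) (ℚ.+-mono-≤ (0≤* 0≤h 0≤h) (0≤* 0≤h 0≤h))) ⟩
    v ℚ.* v ℚ.+ v ℚ.* (h½ ℚ.+ h½) ℚ.+ (h½ ℚ.* h½ ℚ.+ h½ ℚ.* h½)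
      ℚ.+ (v ℚ.* (h½ ℚ.+ h½) ℚ.+ (h½ ℚ.* h½ ℚ.+ h½ ℚ.* h½))
      ≡⟨ solve 2 (λ v h → v :* v :+ v :* (h :+ h) :+ (h :* h :+ h :* h)
                            :+ (v :* (h :+ h) :+ (h :* h :+ h :* h))
                          := (v :+ (h :+ h)) :* (v :+ (h :+ h))) refl v h½ ⟩
    (v ℚ.+ (h½ ℚ.+ h½)) ℚ.* (v ℚ.+ (h½ ℚ.+ h½))
      ≡⟨ cong (λ e → (v ℚ.+ e) ℚ.* (v ℚ.+ e)) (half+half ε) ⟩
    (v ℚ.+ ε) ℚ.* (v ℚ.+ ε)
      ≤⟨ *-mono-≤ 0≤v+ε (ℚ.≤-trans 0≤v+ε (ℚ.<⇒≤ v+ε<u)) (ℚ.<⇒≤ v+ε<u) (ℚ.<⇒≤ v+ε<u) ⟩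
    u ℚ.* u ∎) (ℚ.<-irrefl refl)
  where
  open ℚ.≤-Reasoning
  open ℚ-Solver.+-*-Solver using (solve; _:=_; _:+_; _:*_)
  u = rootBelow m p
  v = rootBelow n q
  h½ = ½ ℚ.* ε
  0≤v = 0≤rootBelow n q
  0≤h = ℚ.<⇒≤ (0<½* 0<ε)
  0≤v+h = ℚ.+-mono-≤ 0≤v 0≤h
  0≤v+ε = ℚ.+-mono-≤ 0≤v (ℚ.<⇒≤ 0<ε)
  v+ε<u = ℚ.≰⇒> ¬h
  0≤* : ∀ {a b} → 0ℚ ℚ.≤ a → 0ℚ ℚ.≤ b → 0ℚ ℚ.≤ a ℚ.* b
  0≤* {a} {b} 0≤a 0≤b = ℚ.nonNegative⁻¹ (a ℚ.* b)
    {{ℚ.nonNeg*nonNeg⇒nonNeg a {{ℚ.nonNegative 0≤a}} b {{ℚ.nonNegative 0≤b}}}}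
  p≤p+q : ∀ {a b} → 0ℚ ℚ.≤ b → a ℚ.≤ a ℚ.+ b
  p≤p+q {a} {b} 0≤b = subst (λ r → r ℚ.≤ a ℚ.+ b) (ℚ.+-identityʳ a) (ℚ.+-monoʳ-≤ a 0≤b)

-- Total for convenience: for x < 0 this is √ (-ᵣ x), a value that is never used.
√ : ℝ → ℝ
seq    (√ x) n = rootBelow n (seq x n)
cauchy (√ x) ε 0<ε =
  let h = ½ ℚ.* ε
      0<h = 0<½* 0<ε
      M , near = cauchy x (h ℚ.* h) (0<* 0<h 0<h)
      N , fine = archimedean h 0<h
  in M ℕ.⊔ N , λ m n p q →
    let Mm = ℕ.m⊔n≤o⇒m≤o M N p; Nm = ℕ.m⊔n≤o⇒n≤o M N p
        Mn = ℕ.m⊔n≤o⇒m≤o M N q; Nn = ℕ.m⊔n≤o⇒n≤o M N q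
    in ∣∣-≤ (rootBelow-close m n (seq x m) (seq x n) 0<ε (fine n Nn) (near m n Mm Mn))
            (rootBelow-close n m (seq x n) (seq x m) 0<ε (fine m Nm) (near n m Mn Mm))

0<⇒#0 : ∀ {x} → 0ℝ < x → x # 0ℝ
0<⇒#0 {x} (ε , 0<ε , N , h) = ε , 0<ε , N , λ n N≤n → begin
  ε                       ≡⟨ ℚ.+-identityˡ ε ⟨
  0ℚ ℚ.+ ε                ≤⟨ h n N≤n ⟩
  seq x n                 ≤⟨ p≤∣p∣ (seq x n) ⟩
  ℚ.∣ seq x n ∣           ≡⟨ cong ℚ.∣_∣ (ℚ.+-identityʳ (seq x n)) ⟨
  ℚ.∣ seq x n ℚ.- 0ℚ ∣    ∎
  where open ℚ.≤-Reasoning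

#⇒-#0 : ∀ {x y} → x # y → (x -ᵣ y) # 0ℝ
#⇒-#0 {x} {y} (ε , 0<ε , N , h) = ε , 0<ε , N , λ n N≤n →
  subst (λ p → ε ℚ.≤ ℚ.∣ p ∣) (sym (ℚ.+-identityʳ (seq x n ℚ.- seq y n))) (h n N≤n)

√-pos : ∀ {x} → 0ℝ < x → 0ℝ < √ x
√-pos {x} (ε , 0<ε , M , h) =
  let N , fine = archimedean δ 0<δ
  in δ , 0<δ , M ℕ.⊔ N , λ n p → subst (ℚ._≤ rootBelow n (seq x n)) (sym (ℚ.+-identityˡ δ))
       (lower n (ℚ.≤-trans (ℚ.≤-reflexive (sym (ℚ.+-identityˡ ε))) (h n (ℕ.m⊔n≤o⇒m≤o M N p)))
                (fine n (ℕ.m⊔n≤o⇒n≤o M N p)))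
  where
  open ℚ.≤-Reasoning
  η δ : ℚ
  η = ε ℚ.⊓ 1ℚ
  δ = ½ ℚ.* η
  0<η : 0ℚ ℚ.< η
  0<η with ℚ.≤-total ε 1ℚ
  ... | inj₁ ε≤1 = subst (0ℚ ℚ.<_) (sym (ℚ.p≤q⇒p⊓q≡p ε≤1)) 0<ε
  ... | inj₂ 1≤ε = subst (0ℚ ℚ.<_) (sym (ℚ.p≥q⇒p⊓q≡q 1≤ε)) (ℚ.positive⁻¹ 1ℚ)
  0<δ : 0ℚ ℚ.< δ
  0<δ = 0<½* 0<η
  lower : ∀ n → ε ℚ.≤ seq x n → unit n ℚ.≤ δ → δ ℚ.≤ rootBelow n (seq x n)
  lower n ε≤ unit≤ with δ ℚ.≤? rootBelow n (seq x n)
  ... | yes d = d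
  ... | no ¬d = contradiction (begin-strict
      ℚ.∣ seq x n ∣                     <⟨ rootBelow-upper n (seq x n) ⟩
      (r ℚ.+ unit n) ℚ.* (r ℚ.+ unit n) ≤⟨ *-mono-≤ (ℚ.+-mono-≤ (0≤rootBelow n (seq x n)) (0≤unit n))
                                            (ℚ.<⇒≤ (0<+ 0<δ 0<δ)) r+≤ r+≤ ⟩
      (δ ℚ.+ δ) ℚ.* (δ ℚ.+ δ)           ≡⟨ cong (λ e → e ℚ.* e) (half+half η) ⟩
      η ℚ.* η                           ≤⟨ *-mono-≤ (ℚ.<⇒≤ 0<η) (ℚ.nonNegative⁻¹ 1ℚ) (ℚ.p⊓q≤p ε 1ℚ) (ℚ.p⊓q≤q ε 1ℚ) ⟩
      ε ℚ.* 1ℚ                          ≡⟨ ℚ.*-identityʳ ε ⟩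
      ε                                 ≤⟨ ε≤ ⟩
      seq x n                           ≤⟨ p≤∣p∣ (seq x n) ⟩
      ℚ.∣ seq x n ∣                     ∎) (ℚ.<-irrefl refl)
    where
    r = rootBelow n (seq x n)
    r+≤ : r ℚ.+ unit n ℚ.≤ δ ℚ.+ δ
    r+≤ = ℚ.+-mono-≤ (ℚ.<⇒≤ (ℚ.≰⇒> ¬d)) unit≤

record ℂ : Set where
  constructor _+i_
  field
    re im : ℝ

open ℂ public

infix 5 _+i_

fromℝ : ℝ → ℂ
fromℝ x = x +i 0ℝ

∣_∣ : ℂ → ℝ
∣ z ∣ = √ (re z *ᵣ re z +ᵣ im z *ᵣ im z)

ℂ-rawRing : RawRing 0ℓ 0ℓ
ℂ-rawRing = record
  { Carrier = ℂ
  ; _≈_     = λ z w → re z ≃ re w × im z ≃ im w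
  ; _+_     = λ z w → (re z +ᵣ re w) +i (im z +ᵣ im w)
  ; _*_     = λ z w → (re z *ᵣ re w -ᵣ im z *ᵣ im w) +i (re z *ᵣ im w +ᵣ im z *ᵣ re w)
  ; -_      = λ z → (-ᵣ re z) +i (-ᵣ im z)
  ; 0#      = fromℝ 0ℝ
  ; 1#      = fromℝ 1ℝ
  }

module _ {c ℓ : Level} (R : RawRing c ℓ) where
  open RawRing R
  open RawSemiringOps rawSemiring using (sum)

  constantSeries : Carrier → ℕ → Carrier
  constantSeries a zero    = a
  constantSeries a (suc _) = 0#

  variableSeries : ℕ → Carrier
  variableSeries 1 = 1#
  variableSeries _ = 0#

  seriesRing : RawRing c ℓ
  seriesRing = record
    { Carrier = ℕ → Carrier
    ; _≈_     = λ f g → ∀ n → f n ≈ g n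
    ; _+_     = λ f g n → f n + g n
    ; _*_     = λ f g n → sum {suc n} (λ k → f (toℕ k) * g (n ∸ toℕ k))
    ; -_      = λ f n → - f n
    ; 0#      = λ _ → 0#
    ; 1#      = constantSeries 1#
    }

-- Polynomials in x, y and polynomials over them in T are handled inside
-- ℂ[[y]][[x]] and ℂ[[y]][[x]][[T]]; equality there is equality of all coefficients.
ℂ⟦x,y⟧ ℂ⟦x,y⟧⟦T⟧ : RawRing 0ℓ 0ℓ
ℂ⟦x,y⟧    = seriesRing (seriesRing ℂ-rawRing)
ℂ⟦x,y⟧⟦T⟧ = seriesRing ℂ⟦x,y⟧

module ℂ-Ring where
  open RawRing ℂ-rawRing public
  open RawSemiringOps rawSemiring public using (_^_; sum)

module XY where
  open RawRing ℂ⟦x,y⟧ public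
  open RawSemiringOps rawSemiring public using (_^_; sum)

  x y : Carrier
  x = variableSeries (seriesRing ℂ-rawRing)
  y = constantSeries (seriesRing ℂ-rawRing) (variableSeries ℂ-rawRing)

  scalar : ℂ → Carrier
  scalar a = constantSeries (seriesRing ℂ-rawRing) (constantSeries ℂ-rawRing a)

module XYT where
  open RawRing ℂ⟦x,y⟧⟦T⟧ public
  open RawSemiringOps rawSemiring public using (_^_)

  T : Carrier
  T = variableSeries ℂ⟦x,y⟧

  coefficient : XY.Carrier → Carrier
  coefficient = constantSeries ℂ⟦x,y⟧

-- A i is the coefficient of x^(n-i) y^i.
Form : ℕ → Set
Form n = Fin (suc n) → ℂ

substitute : ∀ {n} → Form n → XY.Carrier → XY.Carrier → XY.Carrier
substitute {n} A u v = sum (λ i → scalar (A i) * u ^ (n ∸ toℕ i) * v ^ toℕ i)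
  where open XY

⟦_⟧ : ∀ {n} → Form n → XY.Carrier
⟦ A ⟧ = substitute A XY.x XY.y

record Matrix : Set where
  constructor matrix
  field
    a b c e : ℂ

_⟨_⟩ : ∀ {n} → Form n → Matrix → XY.Carrier
A ⟨ matrix a b c e ⟩ = substitute A (scalar a * x + scalar b * y) (scalar c * x + scalar e * y)
  where open XY

record Parameter : Set where
  field
    q   : ℝ
    0<q : 0ℝ < q
    q#1 : q # 1ℝ

  1/√q 1/[q-1] : ℝ
  1/√q     = 1/ℝ (√ q) (0<⇒#0 {√ q} (√-pos {q} 0<q))
  1/[q-1]  = 1/ℝ (q -ᵣ 1ℝ) (#⇒-#0 {q} {1ℝ} q#1)

  σ : Matrix
  σ = matrix (fromℝ 1/√q) (fromℝ (1/√q *ᵣ (q -ᵣ 1ℝ)))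
             (fromℝ 1/√q) (fromℝ (1/√q *ᵣ (-ᵣ 1ℝ)))

-- A represents x^n + ∑_{i=d}^n A_i x^(n-i) y^i with A_d ≠ 0.
record HasLeadingIndex {n} (A : Form n) (d : Fin (suc n)) : Set where
  open ℂ-Ring
  field
    0<d     : Fin.zero {n} Fin.< d
    monic   : A Fin.zero ≈ 1#
    gap     : ∀ i → Fin.zero {n} Fin.< i → i Fin.< d → A i ≈ 0#
    nonzero : ¬ (A d ≈ 0#)

IsFormalWeightEnumerator : Parameter → ∀ {n} → Form n → Fin (suc n) → Set
IsFormalWeightEnumerator Q A d = HasLeadingIndex A d × A ⟨ σ ⟩ ≈ - ⟦ A ⟧
  where
  open Parameter Q
  open XY

DivisibleBy : ℕ → ∀ {n} → Form n → Set
DivisibleBy c A = ∀ i → ¬ (A i ≈ 0#) → c ∣ toℕ i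
  where open ℂ-Ring

IsExtremal : Parameter → ℕ → ∀ {n} → Form n → Set
IsExtremal Q c {n} A = Σ[ d ∈ Fin (suc n) ]
  IsFormalWeightEnumerator Q A d × DivisibleBy c A ×
  (∀ (B : Form n) d′ → IsFormalWeightEnumerator Q B d′ → DivisibleBy c B → d′ Fin.≤ d)

-- Degree at most m; P i is the coefficient of T^i.
Polynomial≤ : ℕ → Set
Polynomial≤ m = Fin (suc m) → ℂ

evaluate : ∀ {m} → Polynomial≤ m → ℂ → ℂ
evaluate P z = sum (λ i → P i * z ^ toℕ i)
  where open ℂ-Ring

inT : ∀ {m} → Polynomial≤ m → XYT.Carrier
inT {zero}  P zero    = XY.scalar (P Fin.zero)
inT {zero}  P (suc k) = XY.0#
inT {suc m} P zero    = XY.scalar (P Fin.zero)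
inT {suc m} P (suc k) = inT (λ i → P (Fin.suc i)) k

-- The expansion of 1/(1 - aT).
geometric : ℂ → XYT.Carrier
geometric a k = XY.scalar (a ^ k)
  where open ℂ-Ring

module _ (Q : Parameter) {n} (A : Form n) where
  open Parameter Q

  generatingFunction : ∀ {m} → Polynomial≤ m → XYT.Carrier
  generatingFunction P =
    inT P * geometric ℂ-Ring.1# * geometric (fromℝ q)
      * (coefficient XY.y * (1# + - T) + coefficient XY.x * T) ^ n
    where open XYT

  IsZetaPolynomial : (d : Fin (suc n)) → Polynomial≤ (n ∸ toℕ d) → Set
  IsZetaPolynomial d P =
    generatingFunction P (n ∸ toℕ d) ≈ scalar (fromℝ 1/[q-1]) * (⟦ A ⟧ + - (x ^ n))
    where open XY

  ZetaPolynomial : Set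
  ZetaPolynomial = Σ[ d ∈ Fin (suc n) ] HasLeadingIndex A d × 2 ℕ.≤ toℕ d ×
    Σ[ P ∈ Polynomial≤ (n ∸ toℕ d) ]
      IsZetaPolynomial d P × (∀ P′ → IsZetaPolynomial d P′ → ∀ i → P′ i ℂ-Ring.≈ P i)

  SatisfiesRH : Set
  SatisfiesRH = Σ[ (_ , _ , _ , P , _) ∈ ZetaPolynomial ]
    (∀ z → evaluate P z ℂ-Ring.≈ ℂ-Ring.0# → ∣ z ∣ ≃ 1/√q)

√5 : ℝ
√5 = √ (fromℚ (+ 5 ℚ./ 1))

-- With s = √5 and s = -√5 the following give the two choices of sign.
qOf : ℝ → ℝ
qOf s = fromℚ (+ 2 ℚ./ 1) +ᵣ fromℚ (+ 2 ℚ./ 5) *ᵣ s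

φ₁₀ : ℝ → Form 10
φ₁₀ s i = fromℝ (coeff (toℕ i))
  where
  infix 9 _⊕_·s
  _⊕_·s : ℚ → ℚ → ℝ
  a ⊕ b ·s = fromℚ a +ᵣ fromℚ b *ᵣ s

  coeff : ℕ → ℝ
  coeff 0  = 1ℝ
  coeff 2  = -ᵣ ((+ 45 ℚ./ 1) ⊕ (+ 18 ℚ./ 1) ·s)
  coeff 4  = (+ 378 ℚ./ 1) ⊕ (+ 168 ℚ./ 1) ·s
  coeff 6  = -ᵣ ((+ 714 ℚ./ 1) ⊕ (+ 1596 ℚ./ 5) ·s)
  coeff 8  = (+ 1449 ℚ./ 5) ⊕ (+ 648 ℚ./ 5) ·s
  coeff 10 = -ᵣ ((+ 61 ℚ./ 5) ⊕ (+ 682 ℚ./ 125) ·s)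
  coeff _  = 0ℝ

-- Every term of the sequences for √5 lies in [0, 9/4], so those for 2 ± 2√5/5
-- stay above 11/10.
module _ (s : ℝ) (bound : ∀ n → ℚ.- (+ 9 ℚ./ 4) ℚ.≤ seq s n) where

  11/10≤q : ∀ n → + 11 ℚ./ 10 ℚ.≤ seq (qOf s) n
  11/10≤q n = ℚ.+-monoʳ-≤ (+ 2 ℚ./ 1) (ℚ.*-monoˡ-≤-nonNeg (+ 2 ℚ./ 5) (bound n))

  parameterOf : Parameter
  parameterOf = record
    { q   = qOf s
    ; 0<q = 1ℚ , ℚ.positive⁻¹ 1ℚ , 0 , λ n _ →
        ℚ.≤-trans (ℚ.≤ᵇ⇒≤ _) (11/10≤q n)
    ; q#1 = + 1 ℚ./ 10 , ℚ.positive⁻¹ (+ 1 ℚ./ 10) , 0 , λ n _ →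
        ℚ.≤-trans (ℚ.+-monoˡ-≤ (ℚ.- 1ℚ) (11/10≤q n)) (p≤∣p∣ (seq (qOf s) n ℚ.- 1ℚ))
    }

r*r≤5⇒r≤9/4 : ∀ r → 0ℚ ℚ.≤ r → r ℚ.* r ℚ.≤ + 5 ℚ./ 1 → r ℚ.≤ + 9 ℚ./ 4
r*r≤5⇒r≤9/4 r 0≤r r*r≤5 with r ℚ.≤? + 9 ℚ./ 4
... | yes h = h
... | no ¬h = contradiction
  (ℚ.≤-trans (*-mono-≤ (ℚ.nonNegative⁻¹ (+ 9 ℚ./ 4)) 0≤r 9/4≤r 9/4≤r) r*r≤5)
  (λ { (ℚ.*≤* (ℤ.+≤+ h)) → ℕ.<⇒≱ (ℕ.<ᵇ⇒< 80 81 _) h })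
  where 9/4≤r = ℚ.<⇒≤ (ℚ.≰⇒> ¬h)

q⁺ q⁻ : Parameter
q⁺ = parameterOf √5 λ n → ℚ.≤-trans (ℚ.≤ᵇ⇒≤ _) (0≤rootBelow n (+ 5 ℚ./ 1))
q⁻ = parameterOf (-ᵣ √5) λ n → ℚ.neg-antimono-≤
  (r*r≤5⇒r≤9/4 (seq √5 n) (0≤rootBelow n (+ 5 ℚ./ 1)) (rootBelow-lower n (+ 5 ℚ./ 1)))

φ₁₀⁺ φ₁₀⁻ : Form 10
φ₁₀⁺ = φ₁₀ √5
φ₁₀⁻ = φ₁₀ (-ᵣ √5)

{-# OPTIONS --safe #-}
module Submission where

-- Everything takes place over ℚ(√5), embedded in ℝ by a choice of the square root s = ±√5 of 5, so
-- that both signs are treated at once and every identity needed is decided by exact computation.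
--
-- Extremality: a linear combination of the equations W^σ = -W eliminates the coefficients at y⁴, y⁶,
-- y⁸ and y¹⁰; if A₂ vanished too, it would read 294912 = 0.
--
-- Zeta polynomial: its defining equation is a triangular linear system with binomial coefficients on
-- the diagonal. The solution is P(T) = c (1 - qT²) C(qT² + 1, qT) with a binary cubic C.
--
-- The Bezoutian of C and its derivative is positive definite, so C(qz² + 1, qz) = 0 forces
-- Im (z + 1/(qz)) = 0: z is real or q|z|² = 1. For q⁻ the sextic C(qT² + 1, qT) has no real zeros.
--
-- For q⁺, the product of the sextic and its conjugate under √5 ↦ -√5 is rational and changes sign on
-- [1/4, 1/2]. Bisection yields a zero there; it is not a zero of the conjugate factor, by the case of
-- q⁻, hence it is a zero of P, and it is too small to have absolute value 1/√q.

open import Algebra.Bundles using (CommutativeRing; RawRing)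
import Algebra.Definitions.RawSemiring as RawSemiringOps
import Algebra.Properties.CommutativeSemigroup as CommutativeSemigroupProperties
import Algebra.Properties.CommutativeSemiring.Exp as ExpProperties
import Algebra.Properties.Ring as RingProperties
import Algebra.Properties.Semiring.Exp as SemiringExpProperties
import Algebra.Properties.Semiring.Sum as SumProperties
open import Data.Bool.Base using (Bool; true; false; _∧_)
open import Data.Fin.Base as Fin using (Fin; toℕ)
open import Data.Fin.Patterns
import Data.Fin.Properties as Fin
open import Data.Integer.Base as ℤ using (ℤ; +_)
import Data.Integer.Properties as ℤ
open import Data.List.Base using (List; []; _∷_; map)
open import Data.Nat.Base as ℕ using (ℕ; zero; suc; _∸_)
open import Data.Nat.Divisibility using (_∣_; _∣?_; divides)
import Data.Nat.Properties as ℕ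
open import Data.Product.Base using (Σ-syntax; ∃-syntax; _×_; _,_; proj₁; proj₂)
open import Data.Rational.Base as ℚ using (ℚ; 0ℚ; 1ℚ; ½)
import Data.Rational.Properties as ℚ
import Data.Rational.Solver as ℚ-Solver
import Data.Rational.Unnormalised.Base as ℚᵘ
import Data.Rational.Unnormalised.Properties as ℚᵘ
open import Data.Sum.Base using (_⊎_; inj₁; inj₂; [_,_]′)
open import Data.Vec.Base as Vec using (Vec; []; _∷_)
open import Function.Base using (id)
open import Level using (Level; 0ℓ; _⊔_)
open import Relation.Binary.PropositionalEquality as ≡
  using (_≡_; _≢_; cong; cong₂; subst; subst₂; module ≡-Reasoning)
import Relation.Binary.Reasoning.Setoid as SetoidReasoning
open import Relation.Nullary using (¬_; yes; no; contradiction)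
open import Relation.Nullary.Decidable using (False; toWitnessFalse; decidable-stable)
open import Defs

open ℚ-Lemmas
open ℚ-Solver.+-*-Solver using (solve; _:=_; _:+_; _:*_; _:-_; :-_)

-- Real numbers

-- For t = z + 1/(qz), a zero z of the sextic gives a root t of C(t, 1), and for real t the zero
-- lies on q|z|² = 1 exactly if |t| ≤ 2/√q. Both cubics have only real roots; for q⁺ one of them
-- exceeds 2/√q, and this is the whole difference between the two signs. Two constructive obstacles
-- shape the argument. First, a vanishing product does not reveal which factor vanishes. Equality of
-- reals is however the negation of apartness, hence stable under double negation; so an alternative
-- such as "z is real or lies on the circle" is never produced as a disjunction, but used by
-- assuming z off the circle and deriving a contradiction. Second, the sign of a real number cannot
-- be decided, which would stop a bisection of the sextic itself. Its norm takes rational values at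
-- rational points, where signs are decidable. Inequalities enter only through sums of squares whose
-- weights lie in ℚ(√5) and are bounded below by rational arithmetic.

0<1 : 0ℚ ℚ.< 1ℚ
0<1 = ℚ.positive⁻¹ 1ℚ

≃-pointwise : ∀ x y → (∀ n → seq x n ≡ seq y n) → x ≃ y
≃-pointwise x y eq ε 0<ε = 0 , λ n _ → begin
  ℚ.∣ seq x n ℚ.- seq y n ∣  ≡⟨ cong (λ p → ℚ.∣ p ℚ.- seq y n ∣) (eq n) ⟩
  ℚ.∣ seq y n ℚ.- seq y n ∣  ≡⟨ cong ℚ.∣_∣ (ℚ.+-inverseʳ (seq y n)) ⟩
  0ℚ                         ≤⟨ ℚ.<⇒≤ 0<ε ⟩
  ε                          ∎
  where open ℚ.≤-Reasoning

≃-sym : ∀ x y → x ≃ y → y ≃ x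
≃-sym x y x≃y ε 0<ε = let N , h = x≃y ε 0<ε in
  N , λ n N≤n → subst (ℚ._≤ ε) (∣-∣-sym (seq x n) (seq y n)) (h n N≤n)

∣-∣-triangle : ∀ a b c → ℚ.∣ a ℚ.- c ∣ ℚ.≤ ℚ.∣ a ℚ.- b ∣ ℚ.+ ℚ.∣ b ℚ.- c ∣
∣-∣-triangle a b c = subst (λ t → ℚ.∣ t ∣ ℚ.≤ ℚ.∣ a ℚ.- b ∣ ℚ.+ ℚ.∣ b ℚ.- c ∣)
  (solve 3 (λ a b c → (a :- b) :+ (b :- c) := a :- c) ≡.refl a b c)
  (ℚ.∣p+q∣≤∣p∣+∣q∣ (a ℚ.- b) (b ℚ.- c))

≃-trans : ∀ x y z → x ≃ y → y ≃ z → x ≃ z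
≃-trans x y z x≃y y≃z ε 0<ε =
  let M , h = x≃y (½ ℚ.* ε) (0<½* 0<ε)
      N , k = y≃z (½ ℚ.* ε) (0<½* 0<ε)
  in M ℕ.⊔ N , λ n p → begin
    ℚ.∣ seq x n ℚ.- seq z n ∣
      ≤⟨ ∣-∣-triangle (seq x n) (seq y n) (seq z n) ⟩
    ℚ.∣ seq x n ℚ.- seq y n ∣ ℚ.+ ℚ.∣ seq y n ℚ.- seq z n ∣
      ≤⟨ ℚ.+-mono-≤ (h n (ℕ.m⊔n≤o⇒m≤o M N p)) (k n (ℕ.m⊔n≤o⇒n≤o M N p)) ⟩
    ½ ℚ.* ε ℚ.+ ½ ℚ.* ε
      ≡⟨ half+half ε ⟩
    ε ∎
  where open ℚ.≤-Reasoning

+ᵣ-cong : ∀ x y u v → x ≃ y → u ≃ v → x +ᵣ u ≃ y +ᵣ v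
+ᵣ-cong x y u v x≃y u≃v ε 0<ε =
  let M , h = x≃y (½ ℚ.* ε) (0<½* 0<ε)
      N , k = u≃v (½ ℚ.* ε) (0<½* 0<ε)
  in M ℕ.⊔ N , λ n p → begin
    ℚ.∣ (seq x n ℚ.+ seq u n) ℚ.- (seq y n ℚ.+ seq v n) ∣
      ≡⟨ cong ℚ.∣_∣ (solve 4 (λ a b c d → (a :+ b) :- (c :+ d) := (a :- c) :+ (b :- d)) ≡.refl
           (seq x n) (seq u n) (seq y n) (seq v n)) ⟩
    ℚ.∣ (seq x n ℚ.- seq y n) ℚ.+ (seq u n ℚ.- seq v n) ∣
      ≤⟨ ℚ.∣p+q∣≤∣p∣+∣q∣ (seq x n ℚ.- seq y n) (seq u n ℚ.- seq v n) ⟩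
    ℚ.∣ seq x n ℚ.- seq y n ∣ ℚ.+ ℚ.∣ seq u n ℚ.- seq v n ∣
      ≤⟨ ℚ.+-mono-≤ (h n (ℕ.m⊔n≤o⇒m≤o M N p)) (k n (ℕ.m⊔n≤o⇒n≤o M N p)) ⟩
    ½ ℚ.* ε ℚ.+ ½ ℚ.* ε
      ≡⟨ half+half ε ⟩
    ε ∎
  where open ℚ.≤-Reasoning

-ᵣ-cong : ∀ x y → x ≃ y → -ᵣ x ≃ -ᵣ y
-ᵣ-cong x y x≃y ε 0<ε = let N , h = x≃y ε 0<ε in
  N , λ n N≤n → subst (ℚ._≤ ε)
    (≡.trans (∣-∣-sym (seq x n) (seq y n))
           (cong ℚ.∣_∣ (solve 2 (λ a b → b :- a := (:- a) :- (:- b)) ≡.refl (seq x n) (seq y n))))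
    (h n N≤n)

*ᵣ-cong : ∀ x y u v → x ≃ y → u ≃ v → x *ᵣ u ≃ y *ᵣ v
*ᵣ-cong x y u v x≃y u≃v ε 0<ε =
  let A , 0<A , K , hA = eventually-bounded x
      B , 0<B , L , hB = eventually-bounded v
      δ , 0<δ , δ[B+A]≡ε = divide 0<ε (0<+ 0<B 0<A)
      M , h = x≃y δ 0<δ
      N , k = u≃v δ 0<δ
      KL = K ℕ.⊔ L
      MN = M ℕ.⊔ N
  in KL ℕ.⊔ MN , λ n p →
    let p₁ = ℕ.m⊔n≤o⇒m≤o KL MN p; p₂ = ℕ.m⊔n≤o⇒n≤o KL MN p
    in begin
    ℚ.∣ seq x n ℚ.* seq u n ℚ.- seq y n ℚ.* seq v n ∣
      ≤⟨ *-diff-≤ (seq x n) (seq u n) (seq y n) (seq v n) ⟩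
    ℚ.∣ seq x n ℚ.- seq y n ∣ ℚ.* ℚ.∣ seq v n ∣ ℚ.+ ℚ.∣ seq x n ∣ ℚ.* ℚ.∣ seq u n ℚ.- seq v n ∣
      ≤⟨ ℚ.+-mono-≤
           (*-mono-≤ (ℚ.0≤∣p∣ (seq x n ℚ.- seq y n)) (ℚ.<⇒≤ 0<B)
              (h n (ℕ.m⊔n≤o⇒m≤o M N p₂)) (hB n (ℕ.m⊔n≤o⇒n≤o K L p₁)))
           (*-mono-≤ (ℚ.0≤∣p∣ (seq x n)) (ℚ.<⇒≤ 0<δ)
              (hA n (ℕ.m⊔n≤o⇒m≤o K L p₁)) (k n (ℕ.m⊔n≤o⇒n≤o M N p₂))) ⟩
    δ ℚ.* B ℚ.+ A ℚ.* δ
      ≡⟨ solve 3 (λ δ A B → δ :* B :+ A :* δ := δ :* (B :+ A)) ≡.refl δ A B ⟩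
    δ ℚ.* (B ℚ.+ A)
      ≡⟨ δ[B+A]≡ε ⟩
    ε ∎
  where open ℚ.≤-Reasoning

ℝ-commutativeRing : CommutativeRing 0ℓ 0ℓ
ℝ-commutativeRing = record
  { Carrier = ℝ ; _≈_ = _≃_ ; _+_ = _+ᵣ_ ; _*_ = _*ᵣ_ ; -_ = -ᵣ_ ; 0# = 0ℝ ; 1# = 1ℝ
  ; isCommutativeRing = record
    { isRing = record
      { +-isAbelianGroup = record
        { isGroup = record
          { isMonoid = record
            { isSemigroup = record
              { isMagma = record
                { isEquivalence = record
                  { refl  = λ {x} → ≃-pointwise x x λ _ → ≡.refl
                  ; sym   = λ {x y} → ≃-sym x y
                  ; trans = λ {x y z} → ≃-trans x y z
                  }
                ; ∙-cong = λ {x y u v} → +ᵣ-cong x y u v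
                }
              ; assoc = λ x y z → ≃-pointwise (x +ᵣ y +ᵣ z) (x +ᵣ (y +ᵣ z))
                  λ n → ℚ.+-assoc (seq x n) (seq y n) (seq z n)
              }
            ; identity = (λ x → ≃-pointwise (0ℝ +ᵣ x) x λ n → ℚ.+-identityˡ (seq x n))
                       , (λ x → ≃-pointwise (x +ᵣ 0ℝ) x λ n → ℚ.+-identityʳ (seq x n))
            }
          ; inverse = (λ x → ≃-pointwise (-ᵣ x +ᵣ x) 0ℝ λ n → ℚ.+-inverseˡ (seq x n))
                    , (λ x → ≃-pointwise (x -ᵣ x) 0ℝ λ n → ℚ.+-inverseʳ (seq x n))
          ; ⁻¹-cong = λ {x y} → -ᵣ-cong x y
          }
        ; comm = λ x y → ≃-pointwise (x +ᵣ y) (y +ᵣ x) λ n → ℚ.+-comm (seq x n) (seq y n)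
        }
      ; *-cong = λ {x y u v} → *ᵣ-cong x y u v
      ; *-assoc = λ x y z → ≃-pointwise (x *ᵣ y *ᵣ z) (x *ᵣ (y *ᵣ z))
          λ n → ℚ.*-assoc (seq x n) (seq y n) (seq z n)
      ; *-identity = (λ x → ≃-pointwise (1ℝ *ᵣ x) x λ n → ℚ.*-identityˡ (seq x n))
                   , (λ x → ≃-pointwise (x *ᵣ 1ℝ) x λ n → ℚ.*-identityʳ (seq x n))
      ; distrib = (λ x y z → ≃-pointwise (x *ᵣ (y +ᵣ z)) (x *ᵣ y +ᵣ x *ᵣ z)
                      λ n → ℚ.*-distribˡ-+ (seq x n) (seq y n) (seq z n))
                , (λ x y z → ≃-pointwise ((y +ᵣ z) *ᵣ x) (y *ᵣ x +ᵣ z *ᵣ x)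
                      λ n → ℚ.*-distribʳ-+ (seq x n) (seq y n) (seq z n))
      }
    ; *-comm = λ x y → ≃-pointwise (x *ᵣ y) (y *ᵣ x) λ n → ℚ.*-comm (seq x n) (seq y n)
    }
  }

-- Comparing one late term with ε/2 decides whether x − y is small or bounded away from 0.
small-or-apart : ∀ x y ε → 0ℚ ℚ.< ε →
  (∃[ N ] (∀ n → N ℕ.≤ n → ℚ.∣ seq x n ℚ.- seq y n ∣ ℚ.≤ ε)) ⊎ x # y
small-or-apart x y ε 0<ε = let N , h = cauchy (x -ᵣ y) e/4 0<e/4 in decide N h
  where
  open ℚ.≤-Reasoning
  e/4 : ℚ
  e/4 = ½ ℚ.* (½ ℚ.* ε)
  0<e/4 : 0ℚ ℚ.< e/4
  0<e/4 = 0<½* (0<½* 0<ε)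
  d : ℕ → ℚ
  d n = seq x n ℚ.- seq y n
  half≤ : ∀ {p} → 0ℚ ℚ.≤ p → ½ ℚ.* p ℚ.≤ p
  half≤ {p} 0≤p = subst (½ ℚ.* p ℚ.≤_) (ℚ.*-identityˡ p)
    (ℚ.*-monoʳ-≤-nonNeg p {{ℚ.nonNegative 0≤p}} (ℚ.≤ᵇ⇒≤ {½} {1ℚ} _))
  decide : ∀ N → (∀ m n → N ℕ.≤ m → N ℕ.≤ n → ℚ.∣ d m ℚ.- d n ∣ ℚ.≤ e/4) →
    (∃[ N ] (∀ n → N ℕ.≤ n → ℚ.∣ d n ∣ ℚ.≤ ε)) ⊎ x # y
  decide N h with ℚ.∣ d N ∣ ℚ.≤? ½ ℚ.* ε
  ... | yes d≤ = inj₁ (N , λ n N≤n → begin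
          ℚ.∣ d n ∣                          ≤⟨ ∣∣-triangle (d n) (d N) ⟩
          ℚ.∣ d n ℚ.- d N ∣ ℚ.+ ℚ.∣ d N ∣    ≤⟨ ℚ.+-mono-≤ (h n N N≤n ℕ.≤-refl) d≤ ⟩
          e/4 ℚ.+ ½ ℚ.* ε                    ≤⟨ ℚ.+-monoˡ-≤ (½ ℚ.* ε) (half≤ (ℚ.<⇒≤ (0<½* 0<ε))) ⟩
          ½ ℚ.* ε ℚ.+ ½ ℚ.* ε                ≡⟨ half+half ε ⟩
          ε                                  ∎)
  ... | no d≰ = inj₂ (e/4 , 0<e/4 , N , λ n N≤n →
          ℚ.≮⇒≥ λ d< → ℚ.<-irrefl ≡.refl (begin-strict
            ½ ℚ.* ε                          <⟨ ℚ.≰⇒> d≰ ⟩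
            ℚ.∣ d N ∣                        ≤⟨ ∣∣-triangle (d N) (d n) ⟩
            ℚ.∣ d N ℚ.- d n ∣ ℚ.+ ℚ.∣ d n ∣  ≤⟨ ℚ.+-monoˡ-≤ (ℚ.∣ d n ∣) (h N n ℕ.≤-refl N≤n) ⟩
            e/4 ℚ.+ ℚ.∣ d n ∣                <⟨ ℚ.+-monoʳ-< e/4 d< ⟩
            e/4 ℚ.+ e/4                      ≡⟨ half+half (½ ℚ.* ε) ⟩
            ½ ℚ.* ε                          ∎))

#⇒¬≃ : ∀ x y → x # y → ¬ (x ≃ y)
#⇒¬≃ x y (ε , 0<ε , M , h) x≃y with x≃y (½ ℚ.* ε) (0<½* 0<ε)
... | N , k = ℚ.<-irrefl ≡.refl (begin-strict
    ε                                      ≤⟨ h n (ℕ.m≤m⊔n M N) ⟩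
    ℚ.∣ seq x n ℚ.- seq y n ∣              ≤⟨ k n (ℕ.m≤n⊔m M N) ⟩
    ½ ℚ.* ε                                ≡⟨ ℚ.+-identityʳ (½ ℚ.* ε) ⟨
    ½ ℚ.* ε ℚ.+ 0ℚ                         <⟨ ℚ.+-monoʳ-< (½ ℚ.* ε) (0<½* 0<ε) ⟩
    ½ ℚ.* ε ℚ.+ ½ ℚ.* ε                    ≡⟨ half+half ε ⟩
    ε                                      ∎)
  where
  open ℚ.≤-Reasoning
  n = M ℕ.⊔ N

¬#⇒≃ : ∀ x y → ¬ (x # y) → x ≃ y
¬#⇒≃ x y ¬x#y ε 0<ε = [ id , (λ x#y → contradiction x#y ¬x#y) ]′ (small-or-apart x y ε 0<ε)

-- Since `small-or-apart` settles every tolerance, refuting apartness already yields equality. This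
-- licenses proofs by contradiction of all equations between reals below.
≃-stable : ∀ x y → ¬ ¬ (x ≃ y) → x ≃ y
≃-stable x y ¬¬x≃y = ¬#⇒≃ x y λ x#y → ¬¬x≃y (#⇒¬≃ x y x#y)

1/ℝ-inverseʳ : ∀ x (x#0 : x # 0ℝ) → x *ᵣ 1/ℝ x x#0 ≃ 1ℝ
1/ℝ-inverseʳ x (e , 0<e , M , h) ε 0<ε = M , λ n M≤n → subst (ℚ._≤ ε)
  (cong (λ p → ℚ.∣ p ℚ.- 1ℚ ∣) (≡.sym (reciprocal-inverseʳ (seq x n)
    (bounded⇒≢0 0<e (subst (λ p → e ℚ.≤ ℚ.∣ p ∣) (ℚ.+-identityʳ (seq x n)) (h n M≤n))))))
  (ℚ.<⇒≤ 0<ε)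

invertible-cancel-zero : ∀ {c ℓ} (R : CommutativeRing c ℓ) → let open CommutativeRing R in
  ∀ {x u y} → x * u ≈ 1# → x * y ≈ 0# → y ≈ 0#
invertible-cancel-zero R {x} {u} {y} xu≈1 xy≈0 = begin
  y            ≈⟨ *-identityˡ y ⟨
  1# * y       ≈⟨ *-congʳ xu≈1 ⟨
  x * u * y    ≈⟨ *-congʳ (*-comm x u) ⟩
  u * x * y    ≈⟨ *-assoc u x y ⟩
  u * (x * y)  ≈⟨ *-congˡ xy≈0 ⟩
  u * 0#       ≈⟨ zeroʳ u ⟩
  0#           ∎
  where
  open CommutativeRing R
  open SetoidReasoning setoid

-- Division needs apartness from 0, while only `¬ (x ≃ 0ℝ)` is given. Stability bridges the gap:
-- were `y` nonzero, any apartness `x # 0ℝ` would be absurd, and so `x ≃ 0ℝ`.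
*ᵣ-cancel-zero : ∀ x y → x *ᵣ y ≃ 0ℝ → ¬ (x ≃ 0ℝ) → y ≃ 0ℝ
*ᵣ-cancel-zero x y xy≃0 x≄0 = ≃-stable y 0ℝ λ y≄0 → x≄0 (¬#⇒≃ x 0ℝ λ x#0 →
  y≄0 (invertible-cancel-zero ℝ-commutativeRing {x} {1/ℝ x x#0} {y} (1/ℝ-inverseʳ x x#0) xy≃0))

square≃0⇒≃0 : ∀ x → x *ᵣ x ≃ 0ℝ → x ≃ 0ℝ
square≃0⇒≃0 x xx≃0 = ≃-stable x 0ℝ λ x≄0 → x≄0 (*ᵣ-cancel-zero x x xx≃0 x≄0)

-- Not invariant under ≃, but closed under the operations and true of every square.
EventuallyNonNeg : ℝ → Set
EventuallyNonNeg x = ∃[ N ] (∀ n → N ℕ.≤ n → 0ℚ ℚ.≤ seq x n)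

nonNeg-+ : ∀ x y → EventuallyNonNeg x → EventuallyNonNeg y → EventuallyNonNeg (x +ᵣ y)
nonNeg-+ x y (M , h) (N , k) = M ℕ.⊔ N , λ n p →
  ℚ.+-mono-≤ (h n (ℕ.m⊔n≤o⇒m≤o M N p)) (k n (ℕ.m⊔n≤o⇒n≤o M N p))

0≤p*q : ∀ {p q} → 0ℚ ℚ.≤ p → 0ℚ ℚ.≤ q → 0ℚ ℚ.≤ p ℚ.* q
0≤p*q {p} {q} 0≤p 0≤q = ℚ.nonNegative⁻¹ (p ℚ.* q)
  {{ℚ.nonNeg*nonNeg⇒nonNeg p {{ℚ.nonNegative 0≤p}} q {{ℚ.nonNegative 0≤q}}}}

nonNeg-* : ∀ x y → EventuallyNonNeg x → EventuallyNonNeg y → EventuallyNonNeg (x *ᵣ y)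
nonNeg-* x y (M , h) (N , k) = M ℕ.⊔ N , λ n p →
  0≤p*q (h n (ℕ.m⊔n≤o⇒m≤o M N p)) (k n (ℕ.m⊔n≤o⇒n≤o M N p))

0≤p*p : ∀ p → 0ℚ ℚ.≤ p ℚ.* p
0≤p*p p with ℚ.≤-total 0ℚ p
... | inj₁ 0≤p = 0≤p*q 0≤p 0≤p
... | inj₂ p≤0 = subst (0ℚ ℚ.≤_) (solve 1 (λ p → (:- p) :* (:- p) := p :* p) ≡.refl p)
                   (0≤p*q (ℚ.neg-antimono-≤ p≤0) (ℚ.neg-antimono-≤ p≤0))

nonNeg-square : ∀ x → EventuallyNonNeg (x *ᵣ x)
nonNeg-square x = 0 , λ n _ → 0≤p*p (seq x n)

nonNeg-sum≃0ˡ : ∀ x y → EventuallyNonNeg x → EventuallyNonNeg y → x +ᵣ y ≃ 0ℝ → x ≃ 0ℝ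
nonNeg-sum≃0ˡ x y (L , h) (M , k) x+y≃0 ε 0<ε =
  let N , z = x+y≃0 ε 0<ε ; LM = L ℕ.⊔ M
  in LM ℕ.⊔ N , λ n p →
    let 0≤x = h n (ℕ.m⊔n≤o⇒m≤o L M (ℕ.m⊔n≤o⇒m≤o LM N p))
        0≤y = k n (ℕ.m⊔n≤o⇒n≤o L M (ℕ.m⊔n≤o⇒m≤o LM N p))
    in begin
    ℚ.∣ seq x n ℚ.- 0ℚ ∣               ≡⟨ cong ℚ.∣_∣ (ℚ.+-identityʳ (seq x n)) ⟩
    ℚ.∣ seq x n ∣                      ≡⟨ ℚ.0≤p⇒∣p∣≡p 0≤x ⟩
    seq x n                            ≡⟨ ℚ.+-identityʳ (seq x n) ⟨
    seq x n ℚ.+ 0ℚ                     ≤⟨ ℚ.+-monoʳ-≤ (seq x n) 0≤y ⟩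
    seq x n ℚ.+ seq y n                ≤⟨ p≤∣p∣ (seq x n ℚ.+ seq y n) ⟩
    ℚ.∣ seq x n ℚ.+ seq y n ∣          ≡⟨ cong ℚ.∣_∣ (ℚ.+-identityʳ (seq x n ℚ.+ seq y n)) ⟨
    ℚ.∣ seq x n ℚ.+ seq y n ℚ.- 0ℚ ∣   ≤⟨ z n (ℕ.m⊔n≤o⇒n≤o LM N p) ⟩
    ε                                  ∎
  where open ℚ.≤-Reasoning

nonNeg-sum≃0ʳ : ∀ x y → EventuallyNonNeg x → EventuallyNonNeg y → x +ᵣ y ≃ 0ℝ → y ≃ 0ℝ
nonNeg-sum≃0ʳ x y 0≤x 0≤y x+y≃0 = nonNeg-sum≃0ˡ y x 0≤y 0≤x
  (≃-trans (y +ᵣ x) (x +ᵣ y) 0ℝ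
    (≃-pointwise (y +ᵣ x) (x +ᵣ y) λ n → ℚ.+-comm (seq y n) (seq x n)) x+y≃0)

fromℚ-≄0 : ∀ p → p ≢ 0ℚ → ¬ (fromℚ p ≃ 0ℝ)
fromℚ-≄0 p p≢0 = #⇒¬≃ (fromℚ p) 0ℝ
  ( ℚ.∣ p ∣ , 0<∣p∣ , 0 , λ _ _ → ℚ.≤-reflexive (cong ℚ.∣_∣ (≡.sym (ℚ.+-identityʳ p))))
  where
  0<∣p∣ : 0ℚ ℚ.< ℚ.∣ p ∣
  0<∣p∣ = ℚ.≰⇒> λ ∣p∣≤0 → p≢0 (ℚ.∣p∣≡0⇒p≡0 p (ℚ.≤-antisym ∣p∣≤0 (ℚ.0≤∣p∣ p)))

-- The n-th term r satisfies r² ≤ a < (r + u)² with u = 1/(n+1), so the error is at most u (2r + u).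
-- With r ≤ R and u ≤ min(δ, 1) this is at most δ (2R + 1), which the choice of `δ` makes equal to
-- `ε`.
√-squared : ∀ x → EventuallyNonNeg x → √ x *ᵣ √ x ≃ x
√-squared x (L , 0≤x) ε 0<ε =
  let R , 0<R , K , r≤R = eventually-bounded (√ x)
      δ , 0<δ , δ*C≡ε = divide 0<ε (0<+ (0<+ 0<R 0<R) 0<1)
      M , fine = archimedean (δ ℚ.⊓ 1ℚ) (0<⊓ 0<δ 0<1)
      LK = L ℕ.⊔ K
  in LK ℕ.⊔ M , λ n p →
    let a = seq x n ; r = rootBelow n a ; u = unit n
        u≤ = fine n (ℕ.m⊔n≤o⇒n≤o LK M p)
        u≤δ = ℚ.≤-trans u≤ (ℚ.p⊓q≤p δ 1ℚ)
        u≤1 = ℚ.≤-trans u≤ (ℚ.p⊓q≤q δ 1ℚ)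
        a≡ = ℚ.0≤p⇒∣p∣≡p (0≤x n (ℕ.m⊔n≤o⇒m≤o L K (ℕ.m⊔n≤o⇒m≤o LK M p)))
        r≤ = ℚ.≤-trans (p≤∣p∣ r) (r≤R n (ℕ.m⊔n≤o⇒n≤o L K (ℕ.m⊔n≤o⇒m≤o LK M p)))
    in ∣∣-≤ {r ℚ.* r} {a} {ε}
      (ℚ.≤-trans (subst (r ℚ.* r ℚ.≤_) a≡ (rootBelow-lower n a))
                 (subst (ℚ._≤ a ℚ.+ ε) (ℚ.+-identityʳ a) (ℚ.+-monoʳ-≤ a (ℚ.<⇒≤ 0<ε))))
      (begin
        a                                      ≡⟨ a≡ ⟨
        ℚ.∣ a ∣                                <⟨ rootBelow-upper n a ⟩
        (r ℚ.+ u) ℚ.* (r ℚ.+ u)                ≡⟨ solve 2 (λ r u → (r :+ u) :* (r :+ u) := r :* r :+ u :* (r :+ r :+ u)) ≡.refl r u ⟩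
        r ℚ.* r ℚ.+ u ℚ.* (r ℚ.+ r ℚ.+ u)
          ≤⟨ ℚ.+-monoʳ-≤ (r ℚ.* r) (*-mono-≤ (0≤unit n) (ℚ.<⇒≤ (0<+ (0<+ 0<R 0<R) 0<1)) u≤δ
               (ℚ.+-mono-≤ (ℚ.+-mono-≤ r≤ r≤) u≤1)) ⟩
        r ℚ.* r ℚ.+ δ ℚ.* (R ℚ.+ R ℚ.+ 1ℚ)     ≡⟨ cong (r ℚ.* r ℚ.+_) δ*C≡ε ⟩
        r ℚ.* r ℚ.+ ε                          ∎)
  where
  open ℚ.≤-Reasoning
  0<⊓ : ∀ {p q} → 0ℚ ℚ.< p → 0ℚ ℚ.< q → 0ℚ ℚ.< p ℚ.⊓ q
  0<⊓ {p} {q} 0<p 0<q with ℚ.≤-total p q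
  ... | inj₁ p≤q = subst (0ℚ ℚ.<_) (≡.sym (ℚ.p≤q⇒p⊓q≡p p≤q)) 0<p
  ... | inj₂ q≤p = subst (0ℚ ℚ.<_) (≡.sym (ℚ.p≥q⇒p⊓q≡q q≤p)) 0<q

nonNeg-√ : ∀ x → EventuallyNonNeg (√ x)
nonNeg-√ x = 0 , λ n _ → 0≤rootBelow n (seq x n)

-- Power series

module SeriesProperties {c ℓ} (R : CommutativeRing c ℓ) where
  open CommutativeRing R
  open SetoidReasoning setoid
  open CommutativeSemigroupProperties +-commutativeSemigroup using (interchange; x∙yz≈y∙xz)

  module S = RawRing (seriesRing rawRing)

  private
    Series = ℕ → Carrier

  tail : Series → Series
  tail f n = f (suc n)

  -- The bound `k ≤ n` matters later, when geometric series are exchanged for truncations that agree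
  -- with them only in low degrees.
  *-congₛ : ∀ n {f f′ g g′ : Series} → (∀ k → k ℕ.≤ n → f k ≈ f′ k) → (∀ k → k ℕ.≤ n → g k ≈ g′ k) →
            (f S.* g) n ≈ (f′ S.* g′) n
  *-congₛ zero    p q = +-congʳ (*-cong (p 0 ℕ.z≤n) (q 0 ℕ.z≤n))
  *-congₛ (suc n) p q = +-cong (*-cong (p 0 ℕ.z≤n) (q (suc n) ℕ.≤-refl))
    (*-congₛ n (λ k k≤n → p (suc k) (ℕ.s≤s k≤n)) (λ k k≤n → q k (ℕ.m≤n⇒m≤1+n k≤n)))

  *-zeroₛ : ∀ n (f : Series) → (S.0# S.* f) n ≈ 0#
  *-zeroₛ zero    f = trans (+-identityʳ _) (zeroˡ (f 0))
  *-zeroₛ (suc n) f = trans (+-cong (zeroˡ (f (suc n))) (*-zeroₛ n f)) (+-identityʳ 0#)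

  *-distribʳ : ∀ n (f g h : Series) → ((g S.+ h) S.* f) n ≈ (g S.* f) n + (h S.* f) n
  *-distribʳ zero f g h = begin
    (g 0 + h 0) * f 0 + 0#            ≈⟨ +-identityʳ _ ⟩
    (g 0 + h 0) * f 0                 ≈⟨ distribʳ (f 0) (g 0) (h 0) ⟩
    g 0 * f 0 + h 0 * f 0             ≈⟨ +-cong (+-identityʳ _) (+-identityʳ _) ⟨
    g 0 * f 0 + 0# + (h 0 * f 0 + 0#) ∎
  *-distribʳ (suc n) f g h = begin
    (g 0 + h 0) * f (suc n) + ((tail g S.+ tail h) S.* f) n
      ≈⟨ +-cong (distribʳ (f (suc n)) (g 0) (h 0)) (*-distribʳ n f (tail g) (tail h)) ⟩
    g 0 * f (suc n) + h 0 * f (suc n) + ((tail g S.* f) n + (tail h S.* f) n)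
      ≈⟨ interchange _ _ _ _ ⟩
    g 0 * f (suc n) + (tail g S.* f) n + (h 0 * f (suc n) + (tail h S.* f) n) ∎

  *-scaleₛ : ∀ n a (f g : Series) → ((λ k → a * f k) S.* g) n ≈ a * (f S.* g) n
  *-scaleₛ zero a f g = begin
    a * f 0 * g 0 + 0#    ≈⟨ +-cong (*-assoc a (f 0) (g 0)) (sym (zeroʳ a)) ⟩
    a * (f 0 * g 0) + a * 0# ≈⟨ distribˡ a _ _ ⟨
    a * (f 0 * g 0 + 0#)  ∎
  *-scaleₛ (suc n) a f g = begin
    a * f 0 * g (suc n) + ((λ k → a * tail f k) S.* g) n
      ≈⟨ +-cong (*-assoc a (f 0) (g (suc n))) (*-scaleₛ n a (tail f) g) ⟩
    a * (f 0 * g (suc n)) + a * (tail f S.* g) n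
      ≈⟨ distribˡ a _ _ ⟨
    a * (f 0 * g (suc n) + (tail f S.* g) n) ∎

  -- The product unfolds by definition along its left factor. This is the mirror recursion along the
  -- right one, and the two together give commutativity by induction.
  *-sucʳ : ∀ n (f g : Series) → (f S.* g) (suc n) ≈ f (suc n) * g 0 + (f S.* tail g) n
  *-sucʳ zero f g = begin
    f 0 * g 1 + (f 1 * g 0 + 0#)   ≈⟨ x∙yz≈y∙xz _ _ _ ⟩
    f 1 * g 0 + (f 0 * g 1 + 0#)   ∎
  *-sucʳ (suc n) f g = begin
    f 0 * g (suc (suc n)) + (tail f S.* g) (suc n)
      ≈⟨ +-congˡ (*-sucʳ n (tail f) g) ⟩
    f 0 * g (suc (suc n)) + (f (suc (suc n)) * g 0 + (tail f S.* tail g) n)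
      ≈⟨ x∙yz≈y∙xz _ _ _ ⟩
    f (suc (suc n)) * g 0 + (f 0 * g (suc (suc n)) + (tail f S.* tail g) n) ∎

  *-commₛ : ∀ n (f g : Series) → (f S.* g) n ≈ (g S.* f) n
  *-commₛ zero    f g = +-congʳ (*-comm (f 0) (g 0))
  *-commₛ (suc n) f g = begin
    f 0 * g (suc n) + (tail f S.* g) n  ≈⟨ +-cong (*-comm _ _) (*-commₛ n (tail f) g) ⟩
    g (suc n) * f 0 + (g S.* tail f) n  ≈⟨ *-sucʳ n g f ⟨
    (g S.* f) (suc n)                   ∎

  *-assocₛ : ∀ n (f g h : Series) → ((f S.* g) S.* h) n ≈ (f S.* (g S.* h)) n
  *-assocₛ zero f g h = +-congʳ (begin
    (f 0 * g 0 + 0#) * h 0   ≈⟨ *-congʳ (+-identityʳ _) ⟩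
    f 0 * g 0 * h 0          ≈⟨ *-assoc _ _ _ ⟩
    f 0 * (g 0 * h 0)        ≈⟨ *-congˡ (+-identityʳ _) ⟨
    f 0 * (g 0 * h 0 + 0#)   ∎)
  *-assocₛ (suc n) f g h = begin
    (f 0 * g 0 + 0#) * h (suc n) + (tail (f S.* g) S.* h) n
      -- By definition `tail (f S.* g)` is `f 0` times `tail g` plus `tail f S.* g`, so
      -- distributivity applies to it.
      ≈⟨ +-cong (trans (*-congʳ (+-identityʳ _)) (*-assoc _ _ _))
           (*-distribʳ n h (λ k → f 0 * tail g k) (tail f S.* g)) ⟩
    f 0 * (g 0 * h (suc n)) + (((λ k → f 0 * tail g k) S.* h) n + ((tail f S.* g) S.* h) n)
      ≈⟨ +-congˡ (+-cong (*-scaleₛ n (f 0) (tail g) h) (*-assocₛ n (tail f) g h)) ⟩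
    f 0 * (g 0 * h (suc n)) + (f 0 * (tail g S.* h) n + (tail f S.* (g S.* h)) n)
      ≈⟨ +-assoc _ _ _ ⟨
    f 0 * (g 0 * h (suc n)) + f 0 * (tail g S.* h) n + (tail f S.* (g S.* h)) n
      ≈⟨ +-congʳ (distribˡ _ _ _) ⟨
    f 0 * (g 0 * h (suc n) + (tail g S.* h) n) + (tail f S.* (g S.* h)) n ∎

  constant-*ₛ : ∀ n a (f : Series) → (constantSeries rawRing a S.* f) n ≈ a * f n
  constant-*ₛ zero    a f = +-identityʳ _
  constant-*ₛ (suc n) a f = trans (+-congˡ (*-zeroₛ n f)) (+-identityʳ _)

  *-identityˡₛ : ∀ n (f : Series) → (S.1# S.* f) n ≈ f n
  *-identityˡₛ n f = trans (constant-*ₛ n 1# f) (*-identityˡ (f n))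

  variable-*-zero : ∀ (f : Series) → (variableSeries rawRing S.* f) 0 ≈ 0#
  variable-*-zero f = trans (+-identityʳ _) (zeroˡ (f 0))

  variable-*-suc : ∀ n (f : Series) → (variableSeries rawRing S.* f) (suc n) ≈ f n
  variable-*-suc n f = begin
    0# * f (suc n) + (tail (variableSeries rawRing) S.* f) n
      ≈⟨ +-cong (zeroˡ _) (*-congₛ n {g = f} (λ k _ → tail-variable k) (λ _ _ → refl)) ⟩
    0# + (S.1# S.* f) n  ≈⟨ +-identityˡ _ ⟩
    (S.1# S.* f) n       ≈⟨ *-identityˡₛ n f ⟩
    f n                  ∎
    where
    tail-variable : ∀ k → tail (variableSeries rawRing) k ≈ S.1# k
    tail-variable zero    = refl
    tail-variable (suc k) = refl

  seriesCommutativeRing : CommutativeRing c ℓ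
  seriesCommutativeRing = record
    { Carrier = S.Carrier ; _≈_ = S._≈_ ; _+_ = S._+_ ; _*_ = S._*_ ; -_ = S.-_ ; 0# = S.0# ; 1# = S.1#
    ; isCommutativeRing = record
      { isRing = record
        { +-isAbelianGroup = record
          { isGroup = record
            { isMonoid = record
              { isSemigroup = record
                { isMagma = record
                  { isEquivalence = record
                    { refl  = λ _ → refl
                    ; sym   = λ p n → sym (p n)
                    ; trans = λ p q n → trans (p n) (q n)
                    }
                  ; ∙-cong = λ p q n → +-cong (p n) (q n)
                  }
                ; assoc = λ f g h n → +-assoc (f n) (g n) (h n)
                }
              ; identity = (λ f n → +-identityˡ (f n)) , (λ f n → +-identityʳ (f n))
              }
            ; inverse = (λ f n → -‿inverseˡ (f n)) , (λ f n → -‿inverseʳ (f n))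
            ; ⁻¹-cong = λ p n → -‿cong (p n)
            }
          ; comm = λ f g n → +-comm (f n) (g n)
          }
        ; *-cong = λ p q n → *-congₛ n (λ k _ → p k) (λ k _ → q k)
        ; *-assoc = λ f g h n → *-assocₛ n f g h
        ; *-identity = (λ f n → *-identityˡₛ n f)
                     , (λ f n → trans (*-commₛ n f S.1#) (*-identityˡₛ n f))
        ; distrib = (λ f g h n → trans (*-commₛ n f (g S.+ h))
                       (trans (*-distribʳ n f g h) (+-cong (*-commₛ n g f) (*-commₛ n h f))))
                  , (λ f g h n → *-distribʳ n f g h)
        }
      ; *-comm = λ f g n → *-commₛ n f g
      }
    }

-- The field ℚ(√5) and its polynomials

-- ⟪ a , b , k ⟫ stands for (a + b√5) / 210ᵏ: such triples add and multiply without
-- gcd computations, and 210 clears every denominator that occurs.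
record K : Set where
  constructor ⟪_,_,_⟫
  field
    rational radical : ℤ
    scale : ℕ

infixl 6 _+ₖ_
infixl 7 _*ₖ_

0ₖ 1ₖ : K
0ₖ = ⟪ + 0 , + 0 , 0 ⟫
1ₖ = ⟪ + 1 , + 0 , 0 ⟫

210^_ : ℕ → ℤ
210^ zero  = + 1
210^ suc k = + 210 ℤ.* 210^ k

_+ₖ_ _*ₖ_ : K → K → K
⟪ a , b , k ⟫ +ₖ ⟪ c , d , l ⟫ =
  ⟪ a ℤ.* 210^ (l ∸ k) ℤ.+ c ℤ.* 210^ (k ∸ l) , b ℤ.* 210^ (l ∸ k) ℤ.+ d ℤ.* 210^ (k ∸ l) , k ℕ.⊔ l ⟫
⟪ a , b , k ⟫ *ₖ ⟪ c , d , l ⟫ = ⟪ a ℤ.* c ℤ.+ + 5 ℤ.* (b ℤ.* d) , a ℤ.* d ℤ.+ b ℤ.* c , k ℕ.+ l ⟫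

-ₖ_ : K → K
-ₖ ⟪ a , b , k ⟫ = ⟪ ℤ.- a , ℤ.- b , k ⟫

conjugate : K → K
conjugate ⟪ a , b , k ⟫ = ⟪ a , ℤ.- b , k ⟫

-- Triples have no canonical form, as equal numbers may carry different scales. Equality is
-- therefore always tested as the vanishing of a difference.
zero? : K → Bool
zero? ⟪ + 0 , + 0 , _ ⟫ = true
zero? _                 = false

fromℤ : ℤ → ℚ
fromℤ a = a ℚ./ 1

toℚᵘ-fromℤ : ∀ a → ℚ.toℚᵘ (fromℤ a) ℚᵘ.≃ ℚᵘ.mkℚᵘ a 0
toℚᵘ-fromℤ a = ℚ.toℚᵘ-fromℚᵘ (ℚᵘ.mkℚᵘ a 0)

fromℤ-+ : ∀ a b → fromℤ (a ℤ.+ b) ≡ fromℤ a ℚ.+ fromℤ b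
fromℤ-+ a b = ℚ.toℚᵘ-injective (ℚᵘ.≃-trans (toℚᵘ-fromℤ (a ℤ.+ b)) (ℚᵘ.≃-trans
  (ℚᵘ.*≡* (cong (ℤ._* + 1) (cong₂ ℤ._+_ (≡.sym (ℤ.*-identityʳ a)) (≡.sym (ℤ.*-identityʳ b)))))
  (ℚᵘ.≃-sym (ℚᵘ.≃-trans (ℚ.toℚᵘ-homo-+ (fromℤ a) (fromℤ b)) (ℚᵘ.+-cong (toℚᵘ-fromℤ a) (toℚᵘ-fromℤ b))))))

fromℤ-* : ∀ a b → fromℤ (a ℤ.* b) ≡ fromℤ a ℚ.* fromℤ b
fromℤ-* a b = ℚ.toℚᵘ-injective (ℚᵘ.≃-trans (toℚᵘ-fromℤ (a ℤ.* b))
  (ℚᵘ.≃-sym (ℚᵘ.≃-trans (ℚ.toℚᵘ-homo-* (fromℤ a) (fromℤ b)) (ℚᵘ.*-cong (toℚᵘ-fromℤ a) (toℚᵘ-fromℤ b)))))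

fromℤ-neg : ∀ a → fromℤ (ℤ.- a) ≡ ℚ.- fromℤ a
fromℤ-neg a = ℚ.toℚᵘ-injective (ℚᵘ.≃-trans (toℚᵘ-fromℤ (ℤ.- a))
  (ℚᵘ.≃-sym (ℚᵘ.≃-trans (ℚ.toℚᵘ-homo‿- (fromℤ a)) (ℚᵘ.-‿cong (toℚᵘ-fromℤ a)))))

1/210^_ : ℕ → ℚ
1/210^ zero  = 1ℚ
1/210^ suc k = (+ 1 ℚ./ 210) ℚ.* 1/210^ k

rat : ℤ → ℕ → ℚ
rat a k = fromℤ a ℚ.* 1/210^ k

module _ where
  open ≡-Reasoning

  1/210^-+ : ∀ k l → 1/210^ (k ℕ.+ l) ≡ (1/210^ k) ℚ.* (1/210^ l)
  1/210^-+ zero    l = ≡.sym (ℚ.*-identityˡ (1/210^ l))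
  1/210^-+ (suc k) l = ≡.trans (cong ((+ 1 ℚ./ 210) ℚ.*_) (1/210^-+ k l))
    (≡.sym (ℚ.*-assoc (+ 1 ℚ./ 210) (1/210^ k) (1/210^ l)))

  fromℤ-210^ : ∀ k → fromℤ (210^ k) ℚ.* (1/210^ k) ≡ 1ℚ
  fromℤ-210^ zero    = ≡.refl
  fromℤ-210^ (suc k) = begin
    fromℤ (+ 210 ℤ.* 210^ k) ℚ.* ((+ 1 ℚ./ 210) ℚ.* (1/210^ k))
      ≡⟨ cong (ℚ._* ((+ 1 ℚ./ 210) ℚ.* (1/210^ k))) (fromℤ-* (+ 210) (210^ k)) ⟩
    (fromℤ (+ 210) ℚ.* fromℤ (210^ k)) ℚ.* ((+ 1 ℚ./ 210) ℚ.* (1/210^ k))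
      ≡⟨ solve 4 (λ a b c d → (a :* b) :* (c :* d) := (a :* c) :* (b :* d)) ≡.refl
           (fromℤ (+ 210)) (fromℤ (210^ k)) (+ 1 ℚ./ 210) (1/210^ k) ⟩
    (fromℤ (+ 210) ℚ.* (+ 1 ℚ./ 210)) ℚ.* (fromℤ (210^ k) ℚ.* (1/210^ k))
      ≡⟨ cong (1ℚ ℚ.*_) (fromℤ-210^ k) ⟩
    1ℚ ∎

  ⊔-∸ : ∀ k l → k ℕ.⊔ l ≡ (l ∸ k) ℕ.+ k
  ⊔-∸ zero    l       = ≡.sym (ℕ.+-identityʳ l)
  ⊔-∸ (suc k) zero    = ≡.refl
  ⊔-∸ (suc k) (suc l) = ≡.trans (cong suc (⊔-∸ k l)) (≡.sym (ℕ.+-suc (l ∸ k) k))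

  -- In a sum only the triple of smaller scale is multiplied up: truncated subtraction gives the
  -- other one the factor 210⁰ = 1.
  rat-rescale : ∀ a k l → rat (a ℤ.* 210^ (l ∸ k)) (k ℕ.⊔ l) ≡ rat a k
  rat-rescale a k l = begin
    fromℤ (a ℤ.* 210^ m) ℚ.* (1/210^ (k ℕ.⊔ l))
      ≡⟨ cong₂ (λ p n → p ℚ.* (1/210^ n)) (fromℤ-* a (210^ m)) (⊔-∸ k l) ⟩
    fromℤ a ℚ.* fromℤ (210^ m) ℚ.* (1/210^ (m ℕ.+ k))
      ≡⟨ cong (fromℤ a ℚ.* fromℤ (210^ m) ℚ.*_) (1/210^-+ m k) ⟩
    fromℤ a ℚ.* fromℤ (210^ m) ℚ.* ((1/210^ m) ℚ.* (1/210^ k))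
      ≡⟨ solve 4 (λ a b c d → a :* b :* (c :* d) := (b :* c) :* (a :* d)) ≡.refl
           (fromℤ a) (fromℤ (210^ m)) (1/210^ m) (1/210^ k) ⟩
    (fromℤ (210^ m) ℚ.* (1/210^ m)) ℚ.* rat a k
      ≡⟨ cong (ℚ._* rat a k) (fromℤ-210^ m) ⟩
    1ℚ ℚ.* rat a k
      ≡⟨ ℚ.*-identityˡ (rat a k) ⟩
    rat a k ∎
    where m = l ∸ k

  rat-+ : ∀ a b k → rat (a ℤ.+ b) k ≡ rat a k ℚ.+ rat b k
  rat-+ a b k = ≡.trans (cong (ℚ._* 1/210^ k) (fromℤ-+ a b))
                      (ℚ.*-distribʳ-+ (1/210^ k) (fromℤ a) (fromℤ b))

  rat-* : ∀ a b k l → rat (a ℤ.* b) (k ℕ.+ l) ≡ rat a k ℚ.* rat b l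
  rat-* a b k l = ≡.trans (cong₂ ℚ._*_ (fromℤ-* a b) (1/210^-+ k l))
    (solve 4 (λ a b c d → a :* b :* (c :* d) := (a :* c) :* (b :* d)) ≡.refl
       (fromℤ a) (fromℤ b) (1/210^ k) (1/210^ l))

  rat-neg : ∀ a k → rat (ℤ.- a) k ≡ ℚ.- rat a k
  rat-neg a k = ≡.trans (cong (ℚ._* 1/210^ k) (fromℤ-neg a))
                      (≡.sym (ℚ.neg-distribˡ-* (fromℤ a) (1/210^ k)))

  rat-sum : ∀ a b k l →
    rat (a ℤ.* 210^ (l ∸ k) ℤ.+ b ℤ.* 210^ (k ∸ l)) (k ℕ.⊔ l) ≡ rat a k ℚ.+ rat b l
  rat-sum a b k l = ≡.trans (rat-+ (a ℤ.* 210^ (l ∸ k)) (b ℤ.* 210^ (k ∸ l)) (k ℕ.⊔ l))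
    (cong₂ ℚ._+_ (rat-rescale a k l)
      (≡.trans (cong (rat (b ℤ.* 210^ (k ∸ l))) (ℕ.⊔-comm k l)) (rat-rescale b l k)))

-- Rings with a map from ℚ(√5), and identities in them decided by normal forms

record KAlgebra c ℓ : Set (Level.suc (c ⊔ ℓ)) where
  field
    commutativeRing : CommutativeRing c ℓ
  open CommutativeRing commutativeRing public
  field
    ι     : K → Carrier
    ι-+   : ∀ a b → ι (a +ₖ b) ≈ ι a + ι b
    ι-*   : ∀ a b → ι (a *ₖ b) ≈ ι a * ι b
    ι-neg : ∀ a → ι (-ₖ a) ≈ - ι a
    ι-0   : ∀ a → zero? a ≡ true → ι a ≈ 0#
    ι-1   : ι 1ₖ ≈ 1#
  open RawSemiringOps (RawRing.rawSemiring rawRing) public using (_^_; sum)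

record KHomomorphism {c ℓ c′ ℓ′} (A : KAlgebra c ℓ) (B : KAlgebra c′ ℓ′) : Set (c ⊔ ℓ ⊔ c′ ⊔ ℓ′) where
  private
    module A = KAlgebra A
    module B = KAlgebra B
  field
    map-to  : A.Carrier → B.Carrier
    +-homo  : ∀ x y → map-to (x A.+ y) B.≈ map-to x B.+ map-to y
    *-homo  : ∀ x y → map-to (x A.* y) B.≈ map-to x B.* map-to y
    0-homo  : map-to A.0# B.≈ B.0#
    ι-homo  : ∀ a → map-to (A.ι a) B.≈ B.ι a

-- Polynomials in n variables, as nested lists of coefficients in Horner form.
Poly : ℕ → Set
Poly zero    = K
Poly (suc n) = List (Poly n)

infixl 6 _⊕_
infixl 7 _⊗_

0ₚ : ∀ {n} → Poly n
0ₚ {zero}  = 0ₖ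
0ₚ {suc n} = []

constant : ∀ {n} → K → Poly n
constant {zero}  a = a
constant {suc n} a = constant a ∷ []

variableₚ : ∀ {n} → Fin n → Poly n
variableₚ Fin.zero    = 0ₚ ∷ constant 1ₖ ∷ []
variableₚ (Fin.suc i) = variableₚ i ∷ []

_⊕_ : ∀ {n} → Poly n → Poly n → Poly n
_⊕_ {zero}  a        b        = a +ₖ b
_⊕_ {suc n} []       qs       = qs
_⊕_ {suc n} (p ∷ ps) []       = p ∷ ps
_⊕_ {suc n} (p ∷ ps) (q ∷ qs) = p ⊕ q ∷ ps ⊕ qs

⊖_ : ∀ {n} → Poly n → Poly n
⊖_ {zero}  a        = -ₖ a
⊖_ {suc n} []       = []
⊖_ {suc n} (p ∷ ps) = ⊖ p ∷ ⊖ ps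

_⊗_ : ∀ {n} → Poly n → Poly n → Poly n
scaleₚ : ∀ {n} → Poly n → Poly (suc n) → Poly (suc n)

_⊗_ {zero}  a        b  = a *ₖ b
_⊗_ {suc n} []       qs = []
_⊗_ {suc n} (p ∷ ps) qs = scaleₚ p qs ⊕ (0ₚ ∷ ps ⊗ qs)

scaleₚ p []       = []
scaleₚ p (q ∷ qs) = p ⊗ q ∷ scaleₚ p qs

_⊗^_ : ∀ {n} → Poly n → ℕ → Poly n
p ⊗^ zero  = constant 1ₖ
p ⊗^ suc k = p ⊗ (p ⊗^ k)

zeroₚ? : ∀ {n} → Poly n → Bool
zeroₚ? {zero}  a        = zero? a
zeroₚ? {suc n} []       = true
zeroₚ? {suc n} (p ∷ ps) = zeroₚ? p ∧ zeroₚ? ps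

coefficientOf : ∀ {n} → Poly (suc n) → ℕ → Poly n
coefficientOf []       _       = 0ₚ
coefficientOf (p ∷ _)  zero    = p
coefficientOf (_ ∷ ps) (suc k) = coefficientOf ps k

infixl 6 _`+_ _`-_
infixl 7 _`*_
infixr 8 _`^_
infix  9 `-_

data Expr (n : ℕ) : Set where
  con       : K → Expr n
  var       : Fin n → Expr n
  _`+_ _`*_ : Expr n → Expr n → Expr n
  `-_       : Expr n → Expr n
  _`^_      : Expr n → ℕ → Expr n

_`-_ : ∀ {n} → Expr n → Expr n → Expr n
e `- f = e `+ `- f

normalise : ∀ {n} → Expr n → Poly n
normalise (con a)  = constant a
normalise (var i)  = variableₚ i
normalise (e `+ f) = normalise e ⊕ normalise f
normalise (e `* f) = normalise e ⊗ normalise f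
normalise (`- e)   = ⊖ normalise e
normalise (e `^ k) = normalise e ⊗^ k

SamePoly : ∀ n → Poly n → Poly n → Set
SamePoly n p q = zeroₚ? (p ⊕ ⊖ q) ≡ true

Identity : ∀ {n} → Expr n → Expr n → Set
Identity {n} e f = SamePoly n (normalise e) (normalise f)

module Evaluation {c ℓ} (A : KAlgebra c ℓ) where
  open KAlgebra A
  open SetoidReasoning setoid
  open CommutativeSemigroupProperties +-commutativeSemigroup using (interchange)
  open CommutativeSemigroupProperties *-commutativeSemigroup using (x∙yz≈y∙xz)
  open RingProperties ring using (-‿distribʳ-*; -0#≈0#; -‿+-comm; x∙y⁻¹≈ε⇒x≈y)

  eval : ∀ {n} → Poly n → Vec Carrier n → Carrier
  eval {zero}  a        []      = ι a
  eval {suc n} []       (t ∷ ρ) = 0#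
  eval {suc n} (p ∷ ps) (t ∷ ρ) = eval p ρ + t * eval ps (t ∷ ρ)

  eval-0 : ∀ {n} (ρ : Vec Carrier n) → eval 0ₚ ρ ≈ 0#
  eval-0 []      = ι-0 0ₖ ≡.refl
  eval-0 (t ∷ ρ) = refl

  eval-constant : ∀ {n} a (ρ : Vec Carrier n) → eval (constant a) ρ ≈ ι a
  eval-constant a []      = refl
  eval-constant a (t ∷ ρ) = trans (+-cong (eval-constant a ρ) (zeroʳ t)) (+-identityʳ _)

  eval-variable : ∀ {n} i (ρ : Vec Carrier n) → eval (variableₚ i) ρ ≈ Vec.lookup ρ i
  eval-variable Fin.zero (t ∷ ρ) = begin
    eval 0ₚ ρ + t * (eval (constant 1ₖ) ρ + t * 0#)
      ≈⟨ +-cong (eval-0 ρ) (*-congˡ (+-cong (trans (eval-constant 1ₖ ρ) ι-1) (zeroʳ t))) ⟩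
    0# + t * (1# + 0#)  ≈⟨ +-identityˡ _ ⟩
    t * (1# + 0#)       ≈⟨ *-congˡ (+-identityʳ 1#) ⟩
    t * 1#              ≈⟨ *-identityʳ t ⟩
    t                   ∎
  eval-variable (Fin.suc i) (t ∷ ρ) = trans (+-cong (eval-variable i ρ) (zeroʳ t)) (+-identityʳ _)

  eval-⊕ : ∀ {n} (p q : Poly n) ρ → eval (p ⊕ q) ρ ≈ eval p ρ + eval q ρ
  eval-⊕ {zero}  a        b        []      = ι-+ a b
  eval-⊕ {suc n} []       qs       (t ∷ ρ) = sym (+-identityˡ _)
  eval-⊕ {suc n} (p ∷ ps) []       (t ∷ ρ) = sym (+-identityʳ _)
  eval-⊕ {suc n} (p ∷ ps) (q ∷ qs) (t ∷ ρ) = begin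
    eval (p ⊕ q) ρ + t * eval (ps ⊕ qs) (t ∷ ρ)
      ≈⟨ +-cong (eval-⊕ p q ρ) (trans (*-congˡ (eval-⊕ ps qs (t ∷ ρ))) (distribˡ t _ _)) ⟩
    eval p ρ + eval q ρ + (t * eval ps (t ∷ ρ) + t * eval qs (t ∷ ρ))
      ≈⟨ interchange _ _ _ _ ⟩
    eval p ρ + t * eval ps (t ∷ ρ) + (eval q ρ + t * eval qs (t ∷ ρ)) ∎

  eval-⊖ : ∀ {n} (p : Poly n) ρ → eval (⊖ p) ρ ≈ - eval p ρ
  eval-⊖ {zero}  a        []      = ι-neg a
  eval-⊖ {suc n} []       (t ∷ ρ) = sym -0#≈0#
  eval-⊖ {suc n} (p ∷ ps) (t ∷ ρ) = begin
    eval (⊖ p) ρ + t * eval (⊖ ps) (t ∷ ρ)  ≈⟨ +-cong (eval-⊖ p ρ) (*-congˡ (eval-⊖ ps (t ∷ ρ))) ⟩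
    - eval p ρ + t * - eval ps (t ∷ ρ)      ≈⟨ +-congˡ (-‿distribʳ-* t _) ⟨
    - eval p ρ + - (t * eval ps (t ∷ ρ))    ≈⟨ -‿+-comm _ _ ⟩
    - (eval p ρ + t * eval ps (t ∷ ρ))      ∎

  eval-⊗ : ∀ {n} (p q : Poly n) ρ → eval (p ⊗ q) ρ ≈ eval p ρ * eval q ρ
  eval-scale : ∀ {n} (p : Poly n) qs t ρ → eval (scaleₚ p qs) (t ∷ ρ) ≈ eval p ρ * eval qs (t ∷ ρ)

  eval-⊗ {zero}  a        b  []      = ι-* a b
  eval-⊗ {suc n} []       qs (t ∷ ρ) = sym (zeroˡ _)
  eval-⊗ {suc n} (p ∷ ps) qs (t ∷ ρ) = begin
    eval (scaleₚ p qs ⊕ (0ₚ ∷ ps ⊗ qs)) (t ∷ ρ)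
      ≈⟨ eval-⊕ (scaleₚ p qs) (0ₚ ∷ ps ⊗ qs) (t ∷ ρ) ⟩
    eval (scaleₚ p qs) (t ∷ ρ) + (eval 0ₚ ρ + t * eval (ps ⊗ qs) (t ∷ ρ))
      ≈⟨ +-cong (eval-scale p qs t ρ)
           (trans (+-cong (eval-0 ρ) (*-congˡ (eval-⊗ ps qs (t ∷ ρ)))) (+-identityˡ _)) ⟩
    eval p ρ * eval qs (t ∷ ρ) + t * (eval ps (t ∷ ρ) * eval qs (t ∷ ρ))
      ≈⟨ +-congˡ (*-assoc t _ _) ⟨
    eval p ρ * eval qs (t ∷ ρ) + t * eval ps (t ∷ ρ) * eval qs (t ∷ ρ)
      ≈⟨ distribʳ _ _ _ ⟨
    (eval p ρ + t * eval ps (t ∷ ρ)) * eval qs (t ∷ ρ) ∎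

  eval-scale p []       t ρ = sym (zeroʳ _)
  eval-scale p (q ∷ qs) t ρ = begin
    eval (p ⊗ q) ρ + t * eval (scaleₚ p qs) (t ∷ ρ)
      ≈⟨ +-cong (eval-⊗ p q ρ) (trans (*-congˡ (eval-scale p qs t ρ)) (x∙yz≈y∙xz t _ _)) ⟩
    eval p ρ * eval q ρ + eval p ρ * (t * eval qs (t ∷ ρ))
      ≈⟨ distribˡ _ _ _ ⟨
    eval p ρ * (eval q ρ + t * eval qs (t ∷ ρ)) ∎

  eval-⊗^ : ∀ {n} (p : Poly n) k ρ → eval (p ⊗^ k) ρ ≈ eval p ρ ^ k
  eval-⊗^ p zero    ρ = trans (eval-constant 1ₖ ρ) ι-1
  eval-⊗^ p (suc k) ρ = trans (eval-⊗ p (p ⊗^ k) ρ) (*-congˡ (eval-⊗^ p k ρ))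

  eval-zero? : ∀ {n} (p : Poly n) ρ → zeroₚ? p ≡ true → eval p ρ ≈ 0#
  eval-zero? {zero}  a        []      eq = ι-0 a eq
  eval-zero? {suc n} []       (t ∷ ρ) eq = refl
  eval-zero? {suc n} (p ∷ ps) (t ∷ ρ) eq with zeroₚ? p in eq₁
  ... | true = begin
    eval p ρ + t * eval ps (t ∷ ρ) ≈⟨ +-cong (eval-zero? p ρ eq₁) (*-congˡ (eval-zero? ps (t ∷ ρ) eq)) ⟩
    0# + t * 0#                    ≈⟨ +-identityˡ _ ⟩
    t * 0#                         ≈⟨ zeroʳ t ⟩
    0#                             ∎

  ⟦_⟧ₑ : ∀ {n} → Expr n → Vec Carrier n → Carrier
  ⟦ con a ⟧ₑ  ρ = ι a
  ⟦ var i ⟧ₑ  ρ = Vec.lookup ρ i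
  ⟦ e `+ f ⟧ₑ ρ = ⟦ e ⟧ₑ ρ + ⟦ f ⟧ₑ ρ
  ⟦ e `* f ⟧ₑ ρ = ⟦ e ⟧ₑ ρ * ⟦ f ⟧ₑ ρ
  ⟦ `- e ⟧ₑ   ρ = - ⟦ e ⟧ₑ ρ
  ⟦ e `^ k ⟧ₑ ρ = ⟦ e ⟧ₑ ρ ^ k

  ^-cong : ∀ {x y} k → x ≈ y → x ^ k ≈ y ^ k
  ^-cong zero    x≈y = refl
  ^-cong (suc k) x≈y = *-cong x≈y (^-cong k x≈y)

  normalise-correct : ∀ {n} (e : Expr n) ρ → eval (normalise e) ρ ≈ ⟦ e ⟧ₑ ρ
  normalise-correct (con a)  ρ = eval-constant a ρ
  normalise-correct (var i)  ρ = eval-variable i ρ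
  normalise-correct (e `+ f) ρ = trans (eval-⊕ (normalise e) (normalise f) ρ)
    (+-cong (normalise-correct e ρ) (normalise-correct f ρ))
  normalise-correct (e `* f) ρ = trans (eval-⊗ (normalise e) (normalise f) ρ)
    (*-cong (normalise-correct e ρ) (normalise-correct f ρ))
  normalise-correct (`- e)   ρ = trans (eval-⊖ (normalise e) ρ) (-‿cong (normalise-correct e ρ))
  normalise-correct (e `^ k) ρ = trans (eval-⊗^ (normalise e) k ρ) (^-cong k (normalise-correct e ρ))

  eval-≈ : ∀ {n} (p q : Poly n) ρ → SamePoly n p q → eval p ρ ≈ eval q ρ
  eval-≈ p q ρ eq = x∙y⁻¹≈ε⇒x≈y _ _ (begin
    eval p ρ - eval q ρ         ≈⟨ +-congˡ (eval-⊖ q ρ) ⟨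
    eval p ρ + eval (⊖ q) ρ     ≈⟨ eval-⊕ p (⊖ q) ρ ⟨
    eval (p ⊕ ⊖ q) ρ            ≈⟨ eval-zero? (p ⊕ ⊖ q) ρ eq ⟩
    0#                          ∎)

  -- For expressions with known constants the hypothesis is a closed Boolean computation, so
  -- `≡.refl` proves it. It mentions no particular algebra, hence serves both signs of √5 at once.
  by-normalisation : ∀ {n} (e f : Expr n) ρ → Identity e f →
                     ⟦ e ⟧ₑ ρ ≈ ⟦ f ⟧ₑ ρ
  by-normalisation e f ρ eq = begin
    ⟦ e ⟧ₑ ρ             ≈⟨ normalise-correct e ρ ⟨
    eval (normalise e) ρ ≈⟨ eval-≈ (normalise e) (normalise f) ρ eq ⟩
    eval (normalise f) ρ ≈⟨ normalise-correct f ρ ⟩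
    ⟦ f ⟧ₑ ρ             ∎

module _ {c ℓ c′ ℓ′} {A : KAlgebra c ℓ} {B : KAlgebra c′ ℓ′} (φ : KHomomorphism A B) where
  private
    module A = Evaluation A
    module B = Evaluation B
  open KAlgebra B
  open KHomomorphism φ

  eval-natural : ∀ {n} (p : Poly n) ρ → map-to (A.eval p ρ) ≈ B.eval p (Vec.map map-to ρ)
  eval-natural {zero}  a        []      = ι-homo a
  eval-natural {suc n} []       (t ∷ ρ) = 0-homo
  eval-natural {suc n} (p ∷ ps) (t ∷ ρ) = trans (+-homo _ _)
    (+-cong (eval-natural p ρ) (trans (*-homo _ _) (*-congˡ (eval-natural ps (t ∷ ρ)))))

module SeriesAlgebra {c ℓ} (A : KAlgebra c ℓ) where
  open KAlgebra A
  open SeriesProperties commutativeRing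
  open RingProperties ring using (-0#≈0#)

  private
    const = constantSeries rawRing

  const-≈0 : ∀ {a} → a ≈ 0# → ∀ n → const a n ≈ 0#
  const-≈0 a≈0 zero    = a≈0
  const-≈0 a≈0 (suc n) = refl

  const-cong : ∀ {a b} → a ≈ b → ∀ n → const a n ≈ const b n
  const-cong a≈b zero    = a≈b
  const-cong a≈b (suc n) = refl

  const-+ : ∀ a b n → const (a + b) n ≈ const a n + const b n
  const-+ a b zero    = refl
  const-+ a b (suc n) = sym (+-identityʳ 0#)

  const-* : ∀ a b n → const (a * b) n ≈ (const a S.* const b) n
  const-* a b n = sym (trans (constant-*ₛ n a (const b)) (scaled n))
    where
    scaled : ∀ n → a * const b n ≈ const (a * b) n
    scaled zero    = refl
    scaled (suc n) = zeroʳ a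

  const-neg : ∀ a n → const (- a) n ≈ - const a n
  const-neg a zero    = refl
  const-neg a (suc n) = sym -0#≈0#

  seriesAlgebra : KAlgebra c ℓ
  seriesAlgebra = record
    { commutativeRing = seriesCommutativeRing
    ; ι     = λ a → const (ι a)
    ; ι-+   = λ a b n → trans (const-cong (ι-+ a b) n) (const-+ (ι a) (ι b) n)
    ; ι-*   = λ a b n → trans (const-cong (ι-* a b) n) (const-* (ι a) (ι b) n)
    ; ι-neg = λ a n → trans (const-cong (ι-neg a) n) (const-neg (ι a) n)
    ; ι-0   = λ a eq → const-≈0 (ι-0 a eq)
    ; ι-1   = const-cong ι-1
    }

  constantHomomorphism : KHomomorphism A seriesAlgebra
  constantHomomorphism = record
    { map-to = const
    ; +-homo = const-+
    ; *-homo = const-*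
    ; 0-homo = const-≈0 refl
    ; ι-homo = λ a n → refl
    }

  private
    module A = Evaluation A
    module 𝕊 = Evaluation seriesAlgebra

  -- Horner nesting mirrors the nesting of power series: evaluated at the series variable, the
  -- outermost variable merely indexes the list. In this way equations between series become
  -- equations between computed coefficients.
  eval-coefficient : ∀ {n} (p : Poly (suc n)) ρ k →
    𝕊.eval p (variableSeries rawRing ∷ Vec.map const ρ) k ≈ A.eval (coefficientOf p k) ρ
  eval-coefficient []       ρ k       = sym (A.eval-0 ρ)
  eval-coefficient (p ∷ ps) ρ zero    = trans
    (+-cong (sym (eval-natural constantHomomorphism p ρ 0)) (variable-*-zero (𝕊.eval ps _)))
    (+-identityʳ _)
  eval-coefficient (p ∷ ps) ρ (suc k) = trans
    (+-cong (sym (eval-natural constantHomomorphism p ρ (suc k)))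
            (trans (variable-*-suc k (𝕊.eval ps _)) (eval-coefficient ps ρ k)))
    (+-identityˡ _)

-- ℝ and ℂ as algebras over ℚ(√5), for either square root of 5

module ℝR = CommutativeRing ℝ-commutativeRing

5ℝ : ℝ
5ℝ = fromℚ (+ 5 ℚ./ 1)

module _ (s : ℝ) (s²≃5 : s *ᵣ s ≃ 5ℝ) where

  embed : K → ℝ
  embed ⟪ a , b , k ⟫ = fromℚ (rat a k) +ᵣ fromℚ (rat b k) *ᵣ s

  embed-+ : ∀ a b → embed (a +ₖ b) ≃ embed a +ᵣ embed b
  embed-+ ⟪ a , b , k ⟫ ⟪ c , d , l ⟫ =
    ≃-pointwise (embed (⟪ a , b , k ⟫ +ₖ ⟪ c , d , l ⟫)) (embed ⟪ a , b , k ⟫ +ᵣ embed ⟪ c , d , l ⟫) λ n →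
      ≡.trans (cong₂ (λ p q → p ℚ.+ q ℚ.* seq s n) (rat-sum a c k l) (rat-sum b d k l))
        (solve 5 (λ a b c d s → (a :+ c) :+ (b :+ d) :* s := (a :+ b :* s) :+ (c :+ d :* s)) ≡.refl
          (rat a k) (rat b k) (rat c l) (rat d l) (seq s n))

  embed-neg : ∀ a → embed (-ₖ a) ≃ -ᵣ embed a
  embed-neg ⟪ a , b , k ⟫ = ≃-pointwise (embed (-ₖ ⟪ a , b , k ⟫)) (-ᵣ embed ⟪ a , b , k ⟫) λ n →
    ≡.trans (cong₂ (λ p q → p ℚ.+ q ℚ.* seq s n) (rat-neg a k) (rat-neg b k))
      (solve 3 (λ a b s → (:- a) :+ (:- b) :* s := :- (a :+ b :* s)) ≡.refl (rat a k) (rat b k) (seq s n))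

  embed-* : ∀ a b → embed (a *ₖ b) ≃ embed a *ᵣ embed b
  embed-* ⟪ a , b , k ⟫ ⟪ c , d , l ⟫ = ≃-trans L (X +ᵣ fromℚ D *ᵣ 5ℝ) M
    (≃-pointwise L (X +ᵣ fromℚ D *ᵣ 5ℝ) λ n → begin
      rat (a ℤ.* c ℤ.+ + 5 ℤ.* (b ℤ.* d)) m ℚ.+ rat (a ℤ.* d ℤ.+ b ℤ.* c) m ℚ.* seq s n
        ≡⟨ cong₂ (λ p q → p ℚ.+ q ℚ.* seq s n)
             (≡.trans (rat-+ (a ℤ.* c) (+ 5 ℤ.* (b ℤ.* d)) m)
               (cong₂ ℚ._+_ (rat-* a c k l)
                 (≡.trans (rat-* (+ 5) (b ℤ.* d) 0 m) (cong ((+ 5 ℚ./ 1) ℚ.*_) (rat-* b d k l)))))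
             (≡.trans (rat-+ (a ℤ.* d) (b ℤ.* c) m) (cong₂ ℚ._+_ (rat-* a d k l) (rat-* b c k l))) ⟩
      (A ℚ.* C ℚ.+ (+ 5 ℚ./ 1) ℚ.* D) ℚ.+ (A ℚ.* E ℚ.+ B ℚ.* C) ℚ.* seq s n
        ≡⟨ solve 5 (λ p d f q s → (p :+ f :* d) :+ q :* s := (p :+ q :* s) :+ d :* f) ≡.refl
             (A ℚ.* C) D (+ 5 ℚ./ 1) (A ℚ.* E ℚ.+ B ℚ.* C) (seq s n) ⟩
      (A ℚ.* C ℚ.+ (A ℚ.* E ℚ.+ B ℚ.* C) ℚ.* seq s n) ℚ.+ D ℚ.* (+ 5 ℚ./ 1) ∎)
    -- The terms of `s` square to 5 only in the limit, so exchanging `5ℝ` for `s *ᵣ s` is the one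
    -- step that is not an equality term by term.
    (≃-trans (X +ᵣ fromℚ D *ᵣ 5ℝ) (X +ᵣ fromℚ D *ᵣ (s *ᵣ s)) M
      (+ᵣ-cong X X (fromℚ D *ᵣ 5ℝ) (fromℚ D *ᵣ (s *ᵣ s)) (ℝR.refl {X})
        (*ᵣ-cong (fromℚ D) (fromℚ D) 5ℝ (s *ᵣ s) (ℝR.refl {fromℚ D}) (≃-sym (s *ᵣ s) 5ℝ s²≃5)))
      (≃-pointwise (X +ᵣ fromℚ D *ᵣ (s *ᵣ s)) M λ n →
        solve 5 (λ a b c d s → (a :* c :+ (a :* d :+ b :* c) :* s) :+ b :* d :* (s :* s)
                            := (a :+ b :* s) :* (c :+ d :* s)) ≡.refl A B C E (seq s n)))
    where
    open ≡-Reasoning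
    L = embed (⟪ a , b , k ⟫ *ₖ ⟪ c , d , l ⟫)
    M = embed ⟪ a , b , k ⟫ *ᵣ embed ⟪ c , d , l ⟫
    m = k ℕ.+ l
    A = rat a k
    B = rat b k
    C = rat c l
    E = rat d l
    D = B ℚ.* E
    X = fromℚ (A ℚ.* C) +ᵣ fromℚ (A ℚ.* E ℚ.+ B ℚ.* C) *ᵣ s

  embed-0 : ∀ a → zero? a ≡ true → embed a ≃ 0ℝ
  embed-0 ⟪ + 0 , + 0 , k ⟫ _ = ≃-pointwise (embed ⟪ + 0 , + 0 , k ⟫) 0ℝ λ n →
    ≡.trans (cong₂ (λ p q → p ℚ.+ q ℚ.* seq s n) (ℚ.*-zeroˡ (1/210^ k)) (ℚ.*-zeroˡ (1/210^ k)))
            (≡.trans (ℚ.+-identityˡ (0ℚ ℚ.* seq s n)) (ℚ.*-zeroˡ (seq s n)))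

  embed-rational : ∀ a k → embed ⟪ a , + 0 , k ⟫ ≃ fromℚ (rat a k)
  embed-rational a k = ≃-pointwise (embed ⟪ a , + 0 , k ⟫) (fromℚ (rat a k)) λ n →
    ≡.trans (cong (λ q → rat a k ℚ.+ q ℚ.* seq s n) (ℚ.*-zeroˡ (1/210^ k)))
            (≡.trans (cong (rat a k ℚ.+_) (ℚ.*-zeroˡ (seq s n))) (ℚ.+-identityʳ (rat a k)))

  ℝ-algebra : KAlgebra 0ℓ 0ℓ
  ℝ-algebra = record
    { commutativeRing = ℝ-commutativeRing
    ; ι     = embed
    ; ι-+   = embed-+
    ; ι-*   = embed-*
    ; ι-neg = embed-neg
    ; ι-0   = embed-0
    ; ι-1   = embed-rational (+ 1) 0
    }

√5-squared : √5 *ᵣ √5 ≃ 5ℝ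
√5-squared = √-squared 5ℝ (0 , λ _ _ → ℚ.≤ᵇ⇒≤ {0ℚ} {+ 5 ℚ./ 1} _)

-√5-squared : (-ᵣ √5) *ᵣ (-ᵣ √5) ≃ 5ℝ
-√5-squared = ≃-trans ((-ᵣ √5) *ᵣ (-ᵣ √5)) (√5 *ᵣ √5) 5ℝ
  (≃-pointwise ((-ᵣ √5) *ᵣ (-ᵣ √5)) (√5 *ᵣ √5) λ n →
    solve 1 (λ s → (:- s) :* (:- s) := s :* s) ≡.refl (seq √5 n)) √5-squared

module ℝ-Identities = Evaluation (ℝ-algebra √5 √5-squared)

module _ where
  open RawRing ℂ-rawRing
  open ℝ-Identities using (by-normalisation)

  private
    v : ∀ {n} → Fin n → Expr n
    v = var

  ℂ-*-cong : ∀ z z′ w w′ → z ≈ z′ → w ≈ w′ → z * w ≈ z′ * w′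
  ℂ-*-cong (a +i b) (a′ +i b′) (c +i d) (c′ +i d′) (a≃ , b≃) (c≃ , d≃) =
    +ᵣ-cong (a *ᵣ c) (a′ *ᵣ c′) (-ᵣ (b *ᵣ d)) (-ᵣ (b′ *ᵣ d′)) (*ᵣ-cong a a′ c c′ a≃ c≃)
      (-ᵣ-cong (b *ᵣ d) (b′ *ᵣ d′) (*ᵣ-cong b b′ d d′ b≃ d≃)) ,
    +ᵣ-cong (a *ᵣ d) (a′ *ᵣ d′) (b *ᵣ c) (b′ *ᵣ c′) (*ᵣ-cong a a′ d d′ a≃ d≃) (*ᵣ-cong b b′ c c′ b≃ c≃)

  ℂ-*-assoc : ∀ z w u → (z * w) * u ≈ z * (w * u)
  ℂ-*-assoc (a +i b) (c +i d) (e +i f) =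
    by-normalisation
      ((v 0F `* v 2F `- v 1F `* v 3F) `* v 4F `- (v 0F `* v 3F `+ v 1F `* v 2F) `* v 5F)
      (v 0F `* (v 2F `* v 4F `- v 3F `* v 5F) `- v 1F `* (v 2F `* v 5F `+ v 3F `* v 4F)) ρ ≡.refl ,
    by-normalisation
      ((v 0F `* v 2F `- v 1F `* v 3F) `* v 5F `+ (v 0F `* v 3F `+ v 1F `* v 2F) `* v 4F)
      (v 0F `* (v 2F `* v 5F `+ v 3F `* v 4F) `+ v 1F `* (v 2F `* v 4F `- v 3F `* v 5F)) ρ ≡.refl
    where ρ = a ∷ b ∷ c ∷ d ∷ e ∷ f ∷ []

  ℂ-*-comm : ∀ z w → z * w ≈ w * z
  ℂ-*-comm (a +i b) (c +i d) =
    by-normalisation (v 0F `* v 2F `- v 1F `* v 3F) (v 2F `* v 0F `- v 3F `* v 1F) ρ ≡.refl ,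
    by-normalisation (v 0F `* v 3F `+ v 1F `* v 2F) (v 2F `* v 1F `+ v 3F `* v 0F) ρ ≡.refl
    where ρ = a ∷ b ∷ c ∷ d ∷ []

  ℂ-*-identityˡ : ∀ z → 1# * z ≈ z
  ℂ-*-identityˡ (a +i b) =
    ≃-pointwise (1ℝ *ᵣ a -ᵣ 0ℝ *ᵣ b) a (λ n →
      solve 2 (λ a b → con 1ℚ :* a :- con 0ℚ :* b := a) ≡.refl (seq a n) (seq b n)) ,
    ≃-pointwise (1ℝ *ᵣ b +ᵣ 0ℝ *ᵣ a) b (λ n →
      solve 2 (λ a b → con 1ℚ :* b :+ con 0ℚ :* a := b) ≡.refl (seq a n) (seq b n))
    where open ℚ-Solver.+-*-Solver using (solve; _:=_; _:+_; _:*_; _:-_; con)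

  ℂ-distribˡ : ∀ z w u → z * (w + u) ≈ z * w + z * u
  ℂ-distribˡ (a +i b) (c +i d) (e +i f) =
    by-normalisation
      (v 0F `* (v 2F `+ v 4F) `- v 1F `* (v 3F `+ v 5F))
      ((v 0F `* v 2F `- v 1F `* v 3F) `+ (v 0F `* v 4F `- v 1F `* v 5F)) ρ ≡.refl ,
    by-normalisation
      (v 0F `* (v 3F `+ v 5F) `+ v 1F `* (v 2F `+ v 4F))
      ((v 0F `* v 3F `+ v 1F `* v 2F) `+ (v 0F `* v 5F `+ v 1F `* v 4F)) ρ ≡.refl
    where ρ = a ∷ b ∷ c ∷ d ∷ e ∷ f ∷ []

  ℂ-+-cong : ∀ z z′ w w′ → z ≈ z′ → w ≈ w′ → z + w ≈ z′ + w′
  ℂ-+-cong (a +i b) (a′ +i b′) (c +i d) (c′ +i d′) (a≃ , b≃) (c≃ , d≃) =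
    +ᵣ-cong a a′ c c′ a≃ c≃ , +ᵣ-cong b b′ d d′ b≃ d≃

  ℂ-+-comm : ∀ z w → z + w ≈ w + z
  ℂ-+-comm z w = ℝR.+-comm (re z) (re w) , ℝR.+-comm (im z) (im w)

  ℂ-trans : ∀ z w u → z ≈ w → w ≈ u → z ≈ u
  ℂ-trans z w u (p , p′) (q , q′) = ≃-trans (re z) (re w) (re u) p q , ≃-trans (im z) (im w) (im u) p′ q′

  ℂ-commutativeRing : CommutativeRing 0ℓ 0ℓ
  ℂ-commutativeRing = record
    { Carrier = Carrier ; _≈_ = _≈_ ; _+_ = _+_ ; _*_ = _*_ ; -_ = -_ ; 0# = 0# ; 1# = 1#
    ; isCommutativeRing = record
      { isRing = record
        { +-isAbelianGroup = record
          { isGroup = record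
            { isMonoid = record
              { isSemigroup = record
                { isMagma = record
                  { isEquivalence = record
                    { refl  = λ {z} → ℝR.refl {re z} , ℝR.refl {im z}
                    ; sym   = λ {z w} (p , q) → ≃-sym (re z) (re w) p , ≃-sym (im z) (im w) q
                    ; trans = λ {z w u} → ℂ-trans z w u
                    }
                  ; ∙-cong = λ {z z′ w w′} → ℂ-+-cong z z′ w w′
                  }
                ; assoc = λ z w u → ℝR.+-assoc (re z) (re w) (re u) , ℝR.+-assoc (im z) (im w) (im u)
                }
              ; identity = (λ z → ℝR.+-identityˡ (re z) , ℝR.+-identityˡ (im z))
                         , (λ z → ℝR.+-identityʳ (re z) , ℝR.+-identityʳ (im z))
              }
            ; inverse = (λ z → ℝR.-‿inverseˡ (re z) , ℝR.-‿inverseˡ (im z))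
                      , (λ z → ℝR.-‿inverseʳ (re z) , ℝR.-‿inverseʳ (im z))
            ; ⁻¹-cong = λ {z w} (p , q) → -ᵣ-cong (re z) (re w) p , -ᵣ-cong (im z) (im w) q
            }
          ; comm = ℂ-+-comm
          }
        ; *-cong = λ {z z′ w w′} → ℂ-*-cong z z′ w w′
        ; *-assoc = ℂ-*-assoc
        ; *-identity = ℂ-*-identityˡ , λ z → ℂ-trans (z * 1#) (1# * z) z (ℂ-*-comm z 1#) (ℂ-*-identityˡ z)
        ; distrib = ℂ-distribˡ , λ z w u → ℂ-trans ((w + u) * z) (z * (w + u)) (w * z + u * z)
            (ℂ-*-comm (w + u) z) (ℂ-trans (z * (w + u)) (z * w + z * u) (w * z + u * z) (ℂ-distribˡ z w u)
              (ℂ-+-cong (z * w) (w * z) (z * u) (u * z) (ℂ-*-comm z w) (ℂ-*-comm z u)))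
        }
      ; *-comm = ℂ-*-comm
      }
    }

  fromℝ-cong : ∀ x y → x ≃ y → fromℝ x ≈ fromℝ y
  fromℝ-cong x y x≃y = x≃y , ℝR.refl {0ℝ}

  fromℝ-+ : ∀ x y → fromℝ (x +ᵣ y) ≈ fromℝ x + fromℝ y
  fromℝ-+ x y = ℝR.refl {x +ᵣ y} , ≃-pointwise 0ℝ (0ℝ +ᵣ 0ℝ) (λ _ → ≡.refl)

  fromℝ-* : ∀ x y → fromℝ (x *ᵣ y) ≈ fromℝ x * fromℝ y
  fromℝ-* x y =
    ≃-pointwise (x *ᵣ y) (x *ᵣ y -ᵣ 0ℝ *ᵣ 0ℝ) (λ n → ≡.sym (ℚ.+-identityʳ (seq x n ℚ.* seq y n))) ,
    ≃-pointwise 0ℝ (x *ᵣ 0ℝ +ᵣ 0ℝ *ᵣ y) (λ n →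
      solve 2 (λ a b → con 0ℚ := a :* con 0ℚ :+ con 0ℚ :* b) ≡.refl (seq x n) (seq y n))
    where open ℚ-Solver.+-*-Solver using (solve; _:=_; _:+_; _:*_; con)

  fromℝ-neg : ∀ x → fromℝ (-ᵣ x) ≈ - fromℝ x
  fromℝ-neg x = ℝR.refl { -ᵣ x } , ≃-pointwise 0ℝ (-ᵣ 0ℝ) (λ _ → ≡.refl)

module _ (s : ℝ) (s²≃5 : s *ᵣ s ≃ 5ℝ) where
  private
    module ℂR = CommutativeRing ℂ-commutativeRing
    e = embed s s²≃5

  ℂ-algebra : KAlgebra 0ℓ 0ℓ
  ℂ-algebra = record
    { commutativeRing = ℂ-commutativeRing
    ; ι     = λ a → fromℝ (e a)
    ; ι-+   = λ a b → ℂ-trans (fromℝ (e (a +ₖ b))) (fromℝ (e a +ᵣ e b)) (fromℝ (e a) ℂR.+ fromℝ (e b))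
                (fromℝ-cong (e (a +ₖ b)) (e a +ᵣ e b) (embed-+ s s²≃5 a b)) (fromℝ-+ (e a) (e b))
    ; ι-*   = λ a b → ℂ-trans (fromℝ (e (a *ₖ b))) (fromℝ (e a *ᵣ e b)) (fromℝ (e a) ℂR.* fromℝ (e b))
                (fromℝ-cong (e (a *ₖ b)) (e a *ᵣ e b) (embed-* s s²≃5 a b)) (fromℝ-* (e a) (e b))
    ; ι-neg = λ a → ℂ-trans (fromℝ (e (-ₖ a))) (fromℝ (-ᵣ e a)) (ℂR.- fromℝ (e a))
                (fromℝ-cong (e (-ₖ a)) (-ᵣ e a) (embed-neg s s²≃5 a)) (fromℝ-neg (e a))
    ; ι-0   = λ a eq → fromℝ-cong (e a) 0ℝ (embed-0 s s²≃5 a eq)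
    ; ι-1   = fromℝ-cong (e 1ₖ) 1ℝ (embed-rational s s²≃5 (+ 1) 0)
    }


-- Linear systems over ℚ(√5) and power series in x and y

module Calculus {c ℓ} (A : KAlgebra c ℓ) where
  open KAlgebra A public
  open SetoidReasoning setoid public
  open Evaluation A public
  open SumProperties semiring public using (sum-cong-≋; *-distribˡ-sum; ∑-distrib-+)
  open ExpProperties commutativeSemiring public using (^-distrib-*)
  open SemiringExpProperties semiring public using (^-homo-*)
  open RingProperties ring public using (-‿distribʳ-*; -‿distribˡ-*; x∙y⁻¹≈ε⇒x≈y; -‿involutive)

sumₖ : ∀ {n} → (Fin n → K) → K
sumₖ {zero}  f = 0ₖ
sumₖ {suc n} f = f Fin.zero +ₖ sumₖ (λ i → f (Fin.suc i))

sumₑ : ∀ {m n} → (Fin n → Expr m) → Expr m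
sumₑ {n = zero}  f = con 0ₖ
sumₑ {n = suc n} f = f Fin.zero `+ sumₑ (λ i → f (Fin.suc i))

all? : ∀ {n} → (Fin n → Bool) → Bool
all? {zero}  f = true
all? {suc n} f = f Fin.zero ∧ all? (λ i → f (Fin.suc i))

∧-true : ∀ a {b} → a ∧ b ≡ true → a ≡ true × b ≡ true
∧-true true eq = ≡.refl , eq

all?-true : ∀ {n} (f : Fin n → Bool) → all? f ≡ true → ∀ i → f i ≡ true
all?-true f eq Fin.zero    = proj₁ (∧-true (f Fin.zero) eq)
all?-true f eq (Fin.suc i) = all?-true (λ i → f (Fin.suc i)) (proj₂ (∧-true (f Fin.zero) eq)) i

lower-triangular? : ∀ {n} → (Fin n → Fin n → K) → (Fin n → K) → Bool
lower-triangular? {zero}  M inv = true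
lower-triangular? {suc n} M inv =
  zero? (M Fin.zero Fin.zero *ₖ inv Fin.zero +ₖ -ₖ 1ₖ)
  ∧ all? (λ j → zero? (M Fin.zero (Fin.suc j)))
  ∧ lower-triangular? (λ a j → M (Fin.suc a) (Fin.suc j)) (λ j → inv (Fin.suc j))

module LinearAlgebra {c ℓ} (A : KAlgebra c ℓ) where
  open KAlgebra A
  open SetoidReasoning setoid
  open Evaluation A
  open SumProperties semiring using (sum-cong-≋; *-distribˡ-sum; ∑-comm)

  ι-sum : ∀ {n} (f : Fin n → K) → ι (sumₖ f) ≈ sum (λ i → ι (f i))
  ι-sum {zero}  f = ι-0 0ₖ ≡.refl
  ι-sum {suc n} f = trans (ι-+ _ _) (+-congˡ (ι-sum (λ i → f (Fin.suc i))))

  ⟦sum⟧ₑ : ∀ {m n} (f : Fin n → Expr m) ρ → ⟦ sumₑ f ⟧ₑ ρ ≈ sum (λ i → ⟦ f i ⟧ₑ ρ)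
  ⟦sum⟧ₑ {n = zero}  f ρ = ι-0 0ₖ ≡.refl
  ⟦sum⟧ₑ {n = suc n} f ρ = +-congˡ (⟦sum⟧ₑ (λ i → f (Fin.suc i)) ρ)

  ι-≈ : ∀ a b → zero? (a +ₖ -ₖ b) ≡ true → ι a ≈ ι b
  ι-≈ a b eq = eval-≈ {0} a b [] eq

  sum-zero : ∀ {n} (f : Fin n → Carrier) → (∀ i → f i ≈ 0#) → sum f ≈ 0#
  sum-zero {zero}  f f≈0 = refl
  sum-zero {suc n} f f≈0 =
    trans (+-cong (f≈0 Fin.zero) (sum-zero (λ i → f (Fin.suc i)) (λ i → f≈0 (Fin.suc i)))) (+-identityʳ 0#)

  combine-rows : ∀ {m n} (X : Fin n → Carrier) (M : Fin m → Fin n → K) (w : Fin m → K) →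
    (∀ a → sum (λ i → X i * ι (M a i)) ≈ 0#) →
    sum (λ i → X i * ι (sumₖ (λ a → w a *ₖ M a i))) ≈ 0#
  combine-rows X M w rows = begin
    sum (λ i → X i * ι (sumₖ (λ a → w a *ₖ M a i)))
      ≈⟨ sum-cong-≋ (λ i → begin
           X i * ι (sumₖ (λ a → w a *ₖ M a i))
             ≈⟨ *-congˡ (ι-sum (λ a → w a *ₖ M a i)) ⟩
           X i * sum (λ a → ι (w a *ₖ M a i))
             ≈⟨ *-distribˡ-sum (X i) (λ a → ι (w a *ₖ M a i)) ⟩
           sum (λ a → X i * ι (w a *ₖ M a i))
             ≈⟨ sum-cong-≋ (λ a → trans (*-congˡ (ι-* (w a) (M a i)))
                  (trans (sym (*-assoc (X i) (ι (w a)) (ι (M a i))))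
                    (trans (*-congʳ (*-comm (X i) (ι (w a)))) (*-assoc (ι (w a)) (X i) (ι (M a i)))))) ⟩
           sum (λ a → ι (w a) * (X i * ι (M a i))) ∎) ⟩
    sum (λ i → sum (λ a → ι (w a) * (X i * ι (M a i))))
      ≈⟨ ∑-comm (λ i a → ι (w a) * (X i * ι (M a i))) ⟩
    sum (λ a → sum (λ i → ι (w a) * (X i * ι (M a i))))
      ≈⟨ sum-zero _ (λ a → begin
           sum (λ i → ι (w a) * (X i * ι (M a i)))  ≈⟨ *-distribˡ-sum (ι (w a)) (λ i → X i * ι (M a i)) ⟨
           ι (w a) * sum (λ i → X i * ι (M a i))    ≈⟨ *-congˡ (rows a) ⟩
           ι (w a) * 0#                             ≈⟨ zeroʳ _ ⟩
           0#                                       ∎) ⟩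
    0# ∎

  unit-cancel : ∀ X a b → zero? (a *ₖ b +ₖ -ₖ 1ₖ) ≡ true → X * ι a ≈ 0# → X ≈ 0#
  unit-cancel X a b ab≡1 Xa≈0 = begin
    X                ≈⟨ *-identityʳ X ⟨
    X * 1#           ≈⟨ *-congˡ (trans (sym (ι-* a b)) (trans (ι-≈ (a *ₖ b) 1ₖ ab≡1) ι-1)) ⟨
    X * (ι a * ι b)  ≈⟨ *-assoc X (ι a) (ι b) ⟨
    X * ι a * ι b    ≈⟨ *-congʳ Xa≈0 ⟩
    0# * ι b         ≈⟨ zeroˡ _ ⟩
    0#               ∎

  -- Forward substitution: the first row has a single nonzero entry, inverted by `inv`, so the first
  -- unknown vanishes and drops out of the remaining rows.
  triangular-kernel : ∀ {n} (X : Fin n → Carrier) M inv → lower-triangular? M inv ≡ true →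
    (∀ a → sum (λ j → X j * ι (M a j)) ≈ 0#) → ∀ j → X j ≈ 0#
  triangular-kernel {suc n} X M inv eq rows = λ
    { Fin.zero    → X₀≈0
    ; (Fin.suc j) → triangular-kernel (λ j → X (Fin.suc j)) (λ a j → M (Fin.suc a) (Fin.suc j))
        (λ j → inv (Fin.suc j)) (proj₂ eq₂) rest j }
    where
    eq₁ = ∧-true (zero? (M Fin.zero Fin.zero *ₖ inv Fin.zero +ₖ -ₖ 1ₖ)) eq
    eq₂ = ∧-true (all? (λ j → zero? (M Fin.zero (Fin.suc j)))) (proj₂ eq₁)
    X₀≈0 : X Fin.zero ≈ 0#
    X₀≈0 = unit-cancel (X Fin.zero) (M Fin.zero Fin.zero) (inv Fin.zero) (proj₁ eq₁) (begin
      X Fin.zero * ι (M Fin.zero Fin.zero)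
        ≈⟨ +-identityʳ _ ⟨
      X Fin.zero * ι (M Fin.zero Fin.zero) + 0#
        ≈⟨ +-congˡ (sum-zero (λ j → X (Fin.suc j) * ι (M Fin.zero (Fin.suc j))) (λ j → trans
             (*-congˡ (ι-0 _ (all?-true (λ j → zero? (M Fin.zero (Fin.suc j))) (proj₁ eq₂) j))) (zeroʳ _))) ⟨
      sum (λ j → X j * ι (M Fin.zero j))
        ≈⟨ rows Fin.zero ⟩
      0# ∎)
    rest : ∀ a → sum (λ j → X (Fin.suc j) * ι (M (Fin.suc a) (Fin.suc j))) ≈ 0#
    rest a = begin
      sum (λ j → X (Fin.suc j) * ι (M (Fin.suc a) (Fin.suc j)))
        ≈⟨ +-identityˡ _ ⟨
      0# + sum (λ j → X (Fin.suc j) * ι (M (Fin.suc a) (Fin.suc j)))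
        ≈⟨ +-congʳ (trans (*-congʳ X₀≈0) (zeroˡ _)) ⟨
      sum (λ j → X j * ι (M (Fin.suc a) j))
        ≈⟨ rows (Fin.suc a) ⟩
      0# ∎

module DoubleSeries {c ℓ} (A : KAlgebra c ℓ) where
  open KAlgebra A

  𝔸⟦y⟧ 𝔸⟦x,y⟧ : KAlgebra c ℓ
  𝔸⟦y⟧   = SeriesAlgebra.seriesAlgebra A
  𝔸⟦x,y⟧ = SeriesAlgebra.seriesAlgebra 𝔸⟦y⟧

  private
    module Y  = KAlgebra 𝔸⟦y⟧
    module YX = KAlgebra 𝔸⟦x,y⟧

  x y : YX.Carrier
  x = variableSeries Y.rawRing
  y = constantSeries Y.rawRing (variableSeries rawRing)

  scalar : Carrier → YX.Carrier
  scalar a = constantSeries Y.rawRing (constantSeries rawRing a)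

  scalar-cong : ∀ {a b} → a ≈ b → scalar a YX.≈ scalar b
  scalar-cong a≈b = SeriesAlgebra.const-cong 𝔸⟦y⟧ (SeriesAlgebra.const-cong A a≈b)

  scalar-* : ∀ a b → scalar (a * b) YX.≈ scalar a YX.* scalar b
  scalar-* a b = YX.trans
    (SeriesAlgebra.const-cong 𝔸⟦y⟧ (SeriesAlgebra.const-* A a b))
    (SeriesAlgebra.const-* 𝔸⟦y⟧ (constantSeries rawRing a) (constantSeries rawRing b))

  scalar-neg : ∀ a → scalar (- a) YX.≈ YX.- scalar a
  scalar-neg a = YX.trans
    (SeriesAlgebra.const-cong 𝔸⟦y⟧ (SeriesAlgebra.const-neg A a))
    (SeriesAlgebra.const-neg 𝔸⟦y⟧ (constantSeries rawRing a))

  scalar-+ : ∀ a b → scalar (a + b) YX.≈ scalar a YX.+ scalar b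
  scalar-+ a b = YX.trans
    (SeriesAlgebra.const-cong 𝔸⟦y⟧ (SeriesAlgebra.const-+ A a b))
    (SeriesAlgebra.const-+ 𝔸⟦y⟧ (constantSeries rawRing a) (constantSeries rawRing b))

  scalar-*-coefficient : ∀ a f i j → (scalar a YX.* f) i j ≈ a * f i j
  scalar-*-coefficient a f i j = trans
    (SeriesProperties.constant-*ₛ Y.commutativeRing i (constantSeries rawRing a) f j)
    (SeriesProperties.constant-*ₛ commutativeRing j a (f i))

  sum-coefficient : ∀ {n} (f : Fin n → YX.Carrier) i j → YX.sum f i j ≈ sum (λ k → f k i j)
  sum-coefficient {zero}  f i j = refl
  sum-coefficient {suc n} f i j = +-congˡ (sum-coefficient (λ k → f (Fin.suc k)) i j)

  open Evaluation using (eval)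

  eval-xy-coefficient : ∀ (p : Poly 2) i j →
    eval 𝔸⟦x,y⟧ p (x ∷ y ∷ []) i j ≈ ι (coefficientOf (coefficientOf p i) j)
  eval-xy-coefficient p i j = trans
    (SeriesAlgebra.eval-coefficient 𝔸⟦y⟧ p (variableSeries rawRing ∷ []) i j)
    (SeriesAlgebra.eval-coefficient A (coefficientOf p i) [] j)

  -- Comparing coefficients of xⁱyʲ turns a relation between series into a linear equation.
  linear-relation : ∀ {n} (X : Fin n → Carrier) (p : Fin n → Poly 2) →
    YX.sum (λ k → scalar (X k) YX.* eval 𝔸⟦x,y⟧ (p k) (x ∷ y ∷ [])) YX.≈ YX.0# → ∀ i j →
    sum (λ k → X k * ι (coefficientOf (coefficientOf (p k) i) j)) ≈ 0#
  linear-relation X p rel i j = trans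
    (sum-cong-≋ (λ k → sym (trans (scalar-*-coefficient (X k) (eval 𝔸⟦x,y⟧ (p k) (x ∷ y ∷ [])) i j)
       (*-congˡ (eval-xy-coefficient (p k) i j)))))
    (trans (sym (sum-coefficient (λ k → scalar (X k) YX.* eval 𝔸⟦x,y⟧ (p k) (x ∷ y ∷ [])) i j)) (rel i j))
    where open SumProperties semiring using (sum-cong-≋)

-- Anti-invariance and extremality

-ᶻ_ : ℕ → ℤ
-ᶻ n = ℤ.- + n

qₖ q-1ₖ : K
qₖ   = ⟪ + 420 , + 84 , 1 ⟫
q-1ₖ = ⟪ + 210 , + 84 , 1 ⟫

φₖ : Fin 11 → K
φₖ 0F  = 1ₖ
φₖ 2F  = -ₖ ⟪ + 45 , + 18 , 0 ⟫
φₖ 4F  = ⟪ + 378 , + 168 , 0 ⟫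
φₖ 6F  = -ₖ ⟪ + 149940 , + 67032 , 1 ⟫
φₖ 8F  = ⟪ + 60858 , + 27216 , 1 ⟫
φₖ (Fin.suc 9F) = -ₖ ⟪ + 112984200 , + 50528016 , 3 ⟫
φₖ _   = 0ₖ

-- X ↦ q⁵(X^σ + X) applied to the monomial x^(n-i) y^i for n = 10, where r¹⁰ = q⁻⁵ makes it
-- free of r = 1/√q. The degree stays a variable so that no sum over it unfolds during conversion.
anti-invariance : ∀ n → Fin (suc n) → Expr 2
anti-invariance n i =
  (var 0F `+ con q-1ₖ `* var 1F) `^ (n ∸ toℕ i) `* (var 0F `- var 1F) `^ toℕ i
  `+ con qₖ `^ 5 `* (var 0F `^ (n ∸ toℕ i) `* var 1F `^ toℕ i)

module _ {c ℓ} (B : KAlgebra c ℓ) where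
  open Calculus B

  -- `R[q-1]` and `R[-1]` are arguments of their own because the entries of the matrix are multiples
  -- of `R` only up to `≈`.
  module Transform
    (x y R R[q-1] R[-1] : Carrier) (R[q-1]≈ : R[q-1] ≈ R * ι q-1ₖ) (R[-1]≈ : R[-1] ≈ - R)
    (R²q≈1 : R * R * ι qₖ ≈ 1#)
    (n : ℕ) (n≡10 : n ≡ 10)
    (p : Fin (suc n) → Poly 2) (p≡ : ∀ i → p i ≡ normalise (anti-invariance n i)) where

    private
      Q u v u′ v′ : Carrier
      Q  = ι qₖ
      u  = R * x + R[q-1] * y
      v  = R * x + R[-1] * y
      u′ = x + ι q-1ₖ * y
      v′ = x - y

      xy : Vec Carrier 2
      xy = x ∷ y ∷ []

      p-correct : ∀ i → eval (p i) xy ≈ ⟦ anti-invariance n i ⟧ₑ xy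
      p-correct i = trans (reflexive (cong (λ p → eval p xy) (p≡ i))) (normalise-correct (anti-invariance n i) xy)

    form transform : (Fin (suc n) → Carrier) → Carrier
    form      C = sum λ i → C i * x ^ (n ∸ toℕ i) * y ^ toℕ i
    transform C = sum λ i → C i * u ^ (n ∸ toℕ i) * v ^ toℕ i

    private
      u≈ : u ≈ R * u′
      u≈ = begin
        R * x + R[q-1] * y        ≈⟨ +-congˡ (*-congʳ R[q-1]≈) ⟩
        R * x + R * ι q-1ₖ * y    ≈⟨ +-congˡ (*-assoc R (ι q-1ₖ) y) ⟩
        R * x + R * (ι q-1ₖ * y)  ≈⟨ distribˡ R x (ι q-1ₖ * y) ⟨
        R * u′                    ∎

      v≈ : v ≈ R * v′
      v≈ = begin
        R * x + R[-1] * y  ≈⟨ +-congˡ (*-congʳ R[-1]≈) ⟩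
        R * x + - R * y    ≈⟨ +-congˡ (trans (sym (-‿distribˡ-* R y)) (-‿distribʳ-* R y)) ⟩
        R * x + R * - y    ≈⟨ distribˡ R x (- y) ⟨
        R * v′             ∎

      R¹⁰Q⁵≈1 : R ^ 10 * Q ^ 5 ≈ 1#
      R¹⁰Q⁵≈1 = begin
        R ^ 10 * Q ^ 5
          ≈⟨ by-normalisation (var 0F `^ 10 `* var 1F `^ 5) ((var 0F `* var 0F `* var 1F) `^ 5)
               (R ∷ Q ∷ []) ≡.refl ⟩
        (R * R * Q) ^ 5  ≈⟨ ^-cong 5 R²q≈1 ⟩
        -- The unit passes through `ι 1ₖ` because the normaliser knows only constants from `K`.
        1# ^ 5           ≈⟨ ^-cong 5 ι-1 ⟨
        ι 1ₖ ^ 5         ≈⟨ by-normalisation (con 1ₖ `^ 5) (con 1ₖ) [] ≡.refl ⟩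
        ι 1ₖ             ≈⟨ ι-1 ⟩
        1#               ∎

      RⁿQ⁵≈1 : R ^ n * Q ^ 5 ≈ 1#
      RⁿQ⁵≈1 = subst (λ k → R ^ k * Q ^ 5 ≈ 1#) (≡.sym n≡10) R¹⁰Q⁵≈1

      product-of-powers : ∀ i → i ℕ.≤ n → u ^ (n ∸ i) * v ^ i ≈ R ^ n * (u′ ^ (n ∸ i) * v′ ^ i)
      product-of-powers i i≤n = begin
        u ^ m * v ^ i
          ≈⟨ *-cong (trans (^-cong m u≈) (^-distrib-* R u′ m)) (trans (^-cong i v≈) (^-distrib-* R v′ i)) ⟩
        (R ^ m * u′ ^ m) * (R ^ i * v′ ^ i)
          ≈⟨ by-normalisation ((var 0F `* var 1F) `* (var 2F `* var 3F))
               ((var 0F `* var 2F) `* (var 1F `* var 3F)) (R ^ m ∷ u′ ^ m ∷ R ^ i ∷ v′ ^ i ∷ []) ≡.refl ⟩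
        (R ^ m * R ^ i) * (u′ ^ m * v′ ^ i)
          ≈⟨ *-congʳ (^-homo-* R m i) ⟨
        R ^ (m ℕ.+ i) * (u′ ^ m * v′ ^ i)
          ≈⟨ *-congʳ (reflexive (cong (R ^_) (ℕ.m∸n+n≡m i≤n))) ⟩
        R ^ n * (u′ ^ m * v′ ^ i) ∎
        where m = n ∸ i

      scaled-term : ∀ (C : Fin (suc n) → Carrier) i →
        Q ^ 5 * (C i * u ^ (n ∸ toℕ i) * v ^ toℕ i + C i * x ^ (n ∸ toℕ i) * y ^ toℕ i)
        ≈ C i * eval (p i) xy
      scaled-term C i = begin
        Q ^ 5 * (S * u ^ m * v ^ k + S * x ^ m * y ^ k)
          ≈⟨ *-congˡ (+-congʳ (trans (*-assoc S (u ^ m) (v ^ k))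
               (*-congˡ (product-of-powers k (Fin.toℕ≤pred[n] i))))) ⟩
        Q ^ 5 * (S * (R ^ n * (u′ ^ m * v′ ^ k)) + S * x ^ m * y ^ k)
          ≈⟨ by-normalisation
               (var 0F `* (var 1F `* (var 2F `* var 3F) `+ var 1F `* var 4F `* var 5F))
               (var 1F `* ((var 2F `* var 0F) `* var 3F `+ var 0F `* (var 4F `* var 5F)))
               (Q ^ 5 ∷ S ∷ R ^ n ∷ u′ ^ m * v′ ^ k ∷ x ^ m ∷ y ^ k ∷ []) ≡.refl ⟩
        S * ((R ^ n * Q ^ 5) * (u′ ^ m * v′ ^ k) + Q ^ 5 * (x ^ m * y ^ k))
          ≈⟨ *-congˡ (+-congʳ (trans (*-congʳ RⁿQ⁵≈1) (*-identityˡ _))) ⟩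
        S * ⟦ anti-invariance n i ⟧ₑ xy
          ≈⟨ *-congˡ (p-correct i) ⟨
        S * eval (p i) xy ∎
        where
        S = C i
        m = n ∸ toℕ i
        k = toℕ i

    anti-invariance-sum : (Fin (suc n) → Carrier) → Carrier
    anti-invariance-sum C = sum λ i → C i * eval (p i) xy

    private
      scaled-sum : ∀ C → Q ^ 5 * (transform C + form C) ≈ anti-invariance-sum C
      scaled-sum C = begin
        Q ^ 5 * (transform C + form C)
          ≈⟨ *-congˡ (∑-distrib-+ (λ i → C i * u ^ (n ∸ toℕ i) * v ^ toℕ i)
                                  (λ i → C i * x ^ (n ∸ toℕ i) * y ^ toℕ i)) ⟨
        Q ^ 5 * sum (λ i → C i * u ^ (n ∸ toℕ i) * v ^ toℕ i + C i * x ^ (n ∸ toℕ i) * y ^ toℕ i)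
          ≈⟨ *-distribˡ-sum (Q ^ 5)
               (λ i → C i * u ^ (n ∸ toℕ i) * v ^ toℕ i + C i * x ^ (n ∸ toℕ i) * y ^ toℕ i) ⟩
        sum (λ i → Q ^ 5 * (C i * u ^ (n ∸ toℕ i) * v ^ toℕ i + C i * x ^ (n ∸ toℕ i) * y ^ toℕ i))
          ≈⟨ sum-cong-≋ (scaled-term C) ⟩
        anti-invariance-sum C ∎

    -- Scaling by q⁵ loses nothing, since `R ^ n` is its inverse.
    sum⇒anti-invariant : ∀ C → anti-invariance-sum C ≈ 0# → transform C ≈ - form C
    sum⇒anti-invariant C sum≈0 = begin
      transform C
        ≈⟨ by-normalisation (var 0F) ((var 0F `+ var 1F) `+ `- var 1F) (transform C ∷ form C ∷ []) ≡.refl ⟩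
      (transform C + form C) + - form C
        ≈⟨ +-congʳ (begin
             transform C + form C                    ≈⟨ *-identityˡ (transform C + form C) ⟨
             1# * (transform C + form C)             ≈⟨ *-congʳ RⁿQ⁵≈1 ⟨
             R ^ n * Q ^ 5 * (transform C + form C)  ≈⟨ *-assoc (R ^ n) (Q ^ 5) (transform C + form C) ⟩
             R ^ n * (Q ^ 5 * (transform C + form C)) ≈⟨ *-congˡ (trans (scaled-sum C) sum≈0) ⟩
             R ^ n * 0#                              ≈⟨ zeroʳ (R ^ n) ⟩
             0#                                      ∎) ⟩
      0# + - form C
        ≈⟨ +-identityˡ (- form C) ⟩
      - form C ∎

    anti-invariant⇒sum : ∀ C → transform C ≈ - form C → anti-invariance-sum C ≈ 0#
    anti-invariant⇒sum C eq = begin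
      anti-invariance-sum C           ≈⟨ scaled-sum C ⟨
      Q ^ 5 * (transform C + form C)  ≈⟨ *-congˡ (trans (+-congʳ eq) (-‿inverseˡ (form C))) ⟩
      Q ^ 5 * 0#                      ≈⟨ zeroʳ (Q ^ 5) ⟩
      0#                              ∎

    known-anti-invariant : ∀ (α : Fin (suc n) → K) C →
      zeroₚ? (normalise (sumₑ (λ i → con (α i) `* anti-invariance n i))) ≡ true →
      (∀ i → C i ≈ ι (α i)) → transform C ≈ - form C
    known-anti-invariant α C vanishes C≈ = sum⇒anti-invariant C (begin
      anti-invariance-sum C
        ≈⟨ sum-cong-≋ (λ i → *-cong (C≈ i) (p-correct i)) ⟩
      sum (λ i → ⟦ con (α i) `* anti-invariance n i ⟧ₑ xy)
        ≈⟨ LinearAlgebra.⟦sum⟧ₑ B (λ i → con (α i) `* anti-invariance n i) xy ⟨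
      ⟦ sumₑ (λ i → con (α i) `* anti-invariance n i) ⟧ₑ xy
        ≈⟨ normalise-correct (sumₑ (λ i → con (α i) `* anti-invariance n i)) xy ⟨
      eval (normalise (sumₑ (λ i → con (α i) `* anti-invariance n i))) xy
        ≈⟨ eval-zero? (normalise (sumₑ (λ i → con (α i) `* anti-invariance n i))) xy vanishes ⟩
      0# ∎)

-- Weights for the coefficients of x^(10-a) y^a, a ≤ 4, found by solving the linear system:
-- they eliminate the unknown coefficients at y⁴, y⁶, y⁸ and y¹⁰.
weights : Fin 5 → K
weights 0F = ⟪ + 46250 , -ᶻ 18350 , 0 ⟫
weights 1F = ⟪ + 25100 , -ᶻ 10460 , 0 ⟫
weights 2F = ⟪ + 11300 , -ᶻ 4900 , 0 ⟫
weights 3F = ⟪ + 3625 , -ᶻ 1775 , 0 ⟫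
weights 4F = ⟪ + 625 , -ᶻ 375 , 0 ⟫

coefficients : (Fin 11 → Poly 2) → Fin 5 → Fin 11 → K
coefficients p a i = coefficientOf (coefficientOf (p i) (10 ∸ toℕ a)) (toℕ a)

eliminated : (Fin 11 → Poly 2) → Fin 11 → K
eliminated p i = sumₖ λ a → weights a *ₖ coefficients p a i

-- A record, so that two such relations are compared without unfolding the sum.
record LinearRelation {c ℓ} (R : RawRing c ℓ) (ι : K → RawRing.Carrier R) {n}
  (X : Fin n → RawRing.Carrier R) (m : Fin n → K) : Set ℓ where
  open RawRing R
  open RawSemiringOps rawSemiring using (sum)
  field
    holds : sum (λ i → X i * ι (m i)) ≈ 0#

eliminated? : (Fin 11 → Poly 2) → Bool
eliminated? p = zero? (eliminated p 0F +ₖ -ₖ ⟪ + 294912 , + 0 , 0 ⟫) ∧ zero? (eliminated p 4F)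
  ∧ zero? (eliminated p 6F) ∧ zero? (eliminated p 8F) ∧ zero? (eliminated p (Fin.suc 9F))

module Gap {c ℓ} (A : KAlgebra c ℓ) where
  open KAlgebra A
  open LinearAlgebra A using (combine-rows; sum-zero; ι-≈; unit-cancel)
  open SetoidReasoning setoid

  no-larger-gap : ∀ p (C : Fin 11 → Carrier) → eliminated? p ≡ true →
    C 0F ≈ 1# → C 1F ≈ 0# → C 2F ≈ 0# → C 3F ≈ 0# → C 5F ≈ 0# → C 7F ≈ 0# → C 9F ≈ 0# →
    (∀ a → LinearRelation rawRing ι C (coefficients p a)) → 1# ≈ 0#
  no-larger-gap p C eq C₀ C₁ C₂ C₃ C₅ C₇ C₉ rel =
    -- 294912 = 2¹⁵ · 9, so over the denominator 210¹⁵ its inverse has numerator 105¹⁵ / 9 = 105¹³ ·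
    -- 1225.
    unit-cancel 1# ⟪ + 294912 , + 0 , 0 ⟫ ⟪ + (105 ℕ.^ 13 ℕ.* 1225) , + 0 , 15 ⟫ ≡.refl (begin
      1# * ι ⟪ + 294912 , + 0 , 0 ⟫
        ≈⟨ *-cong C₀ (ι-≈ (eliminated p 0F) ⟪ + 294912 , + 0 , 0 ⟫ e₀) ⟨
      C 0F * ι (eliminated p 0F)
        ≈⟨ trans (+-congˡ (sum-zero (λ i → C (Fin.suc i) * ι (eliminated p (Fin.suc i))) rest)) (+-identityʳ _) ⟨
      sum (λ i → C i * ι (eliminated p i))
        ≈⟨ combine-rows C (coefficients p) weights (λ a → LinearRelation.holds (rel a)) ⟩
      0# ∎)
    where
    s₀ = ∧-true (zero? (eliminated p 0F +ₖ -ₖ ⟪ + 294912 , + 0 , 0 ⟫)) eq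
    s₄ = ∧-true (zero? (eliminated p 4F)) (proj₂ s₀)
    s₆ = ∧-true (zero? (eliminated p 6F)) (proj₂ s₄)
    s₈ = ∧-true (zero? (eliminated p 8F)) (proj₂ s₆)
    e₀ = proj₁ s₀
    e₄ = proj₁ s₄
    e₆ = proj₁ s₆
    e₈ = proj₁ s₈
    e₁₀ = proj₂ s₈
    known : ∀ i → C i ≈ 0# → C i * ι (eliminated p i) ≈ 0#
    known i Cᵢ≈0 = trans (*-congʳ Cᵢ≈0) (zeroˡ _)
    unknown : ∀ i → zero? (eliminated p i) ≡ true → C i * ι (eliminated p i) ≈ 0#
    unknown i eq = trans (*-congˡ (ι-0 (eliminated p i) eq)) (zeroʳ _)
    rest : ∀ i → C (Fin.suc i) * ι (eliminated p (Fin.suc i)) ≈ 0#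
    rest 0F = known 1F C₁
    rest 1F = known 2F C₂
    rest 2F = known 3F C₃
    rest 3F = unknown 4F e₄
    rest 4F = known 5F C₅
    rest 5F = unknown 6F e₆
    rest 6F = known 7F C₇
    rest 7F = unknown 8F e₈
    rest 8F = known 9F C₉
    rest 9F = unknown (Fin.suc 9F) e₁₀

module _ {c ℓ} (R : CommutativeRing c ℓ) where
  open CommutativeRing R
  open SetoidReasoning setoid

  inverse-root : ∀ {w r q} → w * w ≈ q → w * r ≈ 1# → r * r * q ≈ 1#
  inverse-root {w} {r} {q} ww≈q wr≈1 = begin
    r * r * q          ≈⟨ *-congˡ ww≈q ⟨
    r * r * (w * w)    ≈⟨ *-assoc r r (w * w) ⟩
    r * (r * (w * w))  ≈⟨ *-congˡ (trans (sym (*-assoc r w w)) (trans (*-congʳ (trans (*-comm r w) wr≈1)) (*-identityˡ w))) ⟩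
    r * w              ≈⟨ *-comm r w ⟩
    w * r              ≈⟨ wr≈1 ⟩
    1#                 ∎

  inverse-unique : ∀ {a b b′} → a * b ≈ 1# → a * b′ ≈ 1# → b ≈ b′
  inverse-unique {a} {b} {b′} ab≈1 ab′≈1 = begin
    b             ≈⟨ *-identityʳ b ⟨
    b * 1#        ≈⟨ *-congˡ ab′≈1 ⟨
    b * (a * b′)  ≈⟨ *-assoc b a b′ ⟨
    b * a * b′    ≈⟨ *-congʳ (trans (*-comm b a) ab≈1) ⟩
    1# * b′       ≈⟨ *-identityˡ b′ ⟩
    b′            ∎

1ℝ≄0ℝ : ¬ (1ℝ ≃ 0ℝ)
1ℝ≄0ℝ = fromℚ-≄0 1ℚ λ ()

1/√q²q≃1 : ∀ Q → let open Parameter Q in 1/√q *ᵣ 1/√q *ᵣ q ≃ 1ℝ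
1/√q²q≃1 Q = inverse-root ℝ-commutativeRing {√ q} {1/√q} {q}
  (√-squared q (nonNegative q 0<q)) (1/ℝ-inverseʳ (√ q) (0<⇒#0 {√ q} (√-pos {q} 0<q)))
  where
  open Parameter Q
  nonNegative : ∀ x → 0ℝ < x → EventuallyNonNeg x
  nonNegative x (ε , 0<ε , N , h) = N , λ n N≤n →
    ℚ.≤-trans (ℚ.≤-trans (ℚ.<⇒≤ 0<ε) (ℚ.≤-reflexive (≡.sym (ℚ.+-identityˡ ε)))) (h n N≤n)

module _ {c ℓ} (A : KAlgebra c ℓ) where
  open KAlgebra A

  module DoubleSeriesTransform
    (r r[q-1] r[-1] : Carrier) (r[q-1]≈ : r[q-1] ≈ r * ι q-1ₖ) (r[-1]≈ : r[-1] ≈ - r)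
    (r²q≈1 : r * r * ι qₖ ≈ 1#)
    (n : ℕ) (n≡10 : n ≡ 10)
    (p : Fin (suc n) → Poly 2) (p≡ : ∀ i → p i ≡ normalise (anti-invariance n i)) where

    module D = DoubleSeries A
    module B = KAlgebra D.𝔸⟦x,y⟧

    private
      R²q≈1 : D.scalar r B.* D.scalar r B.* B.ι qₖ B.≈ B.1#
      R²q≈1 = B.trans {D.scalar r B.* D.scalar r B.* B.ι qₖ} {D.scalar (r * r) B.* B.ι qₖ} {B.1#}
        (B.*-congʳ {B.ι qₖ} {D.scalar r B.* D.scalar r} {D.scalar (r * r)}
          (B.sym {D.scalar (r * r)} {D.scalar r B.* D.scalar r} (D.scalar-* r r)))
        (B.trans {D.scalar (r * r) B.* B.ι qₖ} {D.scalar (r * r * ι qₖ)} {B.1#}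
          (B.sym {D.scalar (r * r * ι qₖ)} {D.scalar (r * r) B.* B.ι qₖ} (D.scalar-* (r * r) (ι qₖ)))
          (D.scalar-cong r²q≈1))

    module T = Transform D.𝔸⟦x,y⟧ D.x D.y (D.scalar r) (D.scalar r[q-1]) (D.scalar r[-1])
      (B.trans {D.scalar r[q-1]} {D.scalar (r * ι q-1ₖ)} {D.scalar r B.* B.ι q-1ₖ}
        (D.scalar-cong r[q-1]≈) (D.scalar-* r (ι q-1ₖ)))
      (B.trans {D.scalar r[-1]} {D.scalar (- r)} {B.- D.scalar r}
        (D.scalar-cong r[-1]≈) (D.scalar-neg r))
      R²q≈1 n n≡10 p p≡

    known-anti-invariant : ∀ (α : Fin (suc n) → K) (C : Fin (suc n) → Carrier) →
      zeroₚ? (normalise (sumₑ (λ i → con (α i) `* anti-invariance n i))) ≡ true →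
      (∀ i → C i ≈ ι (α i)) → T.transform (λ i → D.scalar (C i)) B.≈ B.- T.form (λ i → D.scalar (C i))
    known-anti-invariant α C vanishes C≈ =
      T.known-anti-invariant α (λ i → D.scalar (C i)) vanishes (λ i → D.scalar-cong {C i} {ι (α i)} (C≈ i))

    coefficient-relation : ∀ (C : Fin (suc n) → Carrier) →
      T.transform (λ i → D.scalar (C i)) B.≈ B.- T.form (λ i → D.scalar (C i)) → ∀ i j →
      sum (λ k → C k * ι (coefficientOf (coefficientOf (p k) i) j)) ≈ 0#
    coefficient-relation C eq = D.linear-relation C p (T.anti-invariant⇒sum (λ i → D.scalar (C i)) eq)

-- The operations of Defs.XY, kept abstract: at the concrete ring ℂ⟦x,y⟧ Agda would otherwise
-- compare sums by unfolding them down to the moduli of real numbers.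
record Operations {a c} (A : Set a) (C : Set c) : Set (a ⊔ c) where
  infixl 6 _+_
  infixl 7 _*_
  infixr 8 _^_
  field
    sum     : ∀ {n} → (Fin n → C) → C
    _+_ _*_ : C → C → C
    _^_     : C → ℕ → C
    scalar  : A → C
    x y     : C
    substituted : ∀ n → (Fin (suc n) → A) → C → C → C
    substituted-correct : ∀ n X u v →
      substituted n X u v ≡ sum λ i → scalar (X i) * u ^ (n ∸ toℕ i) * v ^ toℕ i
    transformed : ∀ n → (Fin (suc n) → A) → A → A → A → A → C
    form : ∀ n → (Fin (suc n) → A) → C
    form-correct : ∀ n X → form n X ≡ substituted n X x y
    transformed-correct : ∀ n X a b c e →
      transformed n X a b c e ≡ substituted n X (scalar a * x + scalar b * y) (scalar c * x + scalar e * y)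

-- Every field holds by `≡.refl` at the concrete ring. As propositional equations they allow one
-- operation at a time to be rewritten while the rest stays opaque.
record Agrees {a ℓ} (R : RawRing a ℓ) (ops : Operations (RawRing.Carrier R) (ℕ → ℕ → RawRing.Carrier R)) : Set a where
  private
    module O = Operations ops
    module S = RawRing (seriesRing (seriesRing R))
    module P = RawSemiringOps S.rawSemiring
  field
    sum-agrees : ∀ {n} (f : Fin n → S.Carrier) → O.sum f ≡ P.sum f
    +-agrees   : ∀ f g → f O.+ g ≡ f S.+ g
    *-agrees   : ∀ f g → f O.* g ≡ f S.* g
    ^-agrees   : ∀ f k → f O.^ k ≡ f P.^ k
    scalar-agrees : ∀ a → O.scalar a ≡ constantSeries (seriesRing R) (constantSeries R a)
    x-agrees   : O.x ≡ variableSeries (seriesRing R)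
    y-agrees   : O.y ≡ constantSeries (seriesRing R) (variableSeries R)

record EnumeratorFacts {c ℓ} (R : RawRing c ℓ) (ι : K → RawRing.Carrier R)
  (r r[q-1] r[-1] : RawRing.Carrier R) (n : ℕ) (p : Fin (suc n) → Poly 2)
  (ops : Operations (RawRing.Carrier R) (ℕ → ℕ → RawRing.Carrier R)) : Set (c ⊔ ℓ) where
  open RawRing R
  field
    known-anti-invariant : ∀ (α : Fin (suc n) → K) (X : Fin (suc n) → Carrier) →
      zeroₚ? (normalise (sumₑ (λ i → con (α i) `* anti-invariance n i))) ≡ true →
      (∀ i → X i ≈ ι (α i)) → ∀ i j →
      Operations.transformed ops n X r r[q-1] r r[-1] i j ≈ - Operations.form ops n X i j
    coefficient-relation : ∀ (X : Fin (suc n) → Carrier) →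
      (∀ i j → Operations.transformed ops n X r r[q-1] r r[-1] i j ≈ - Operations.form ops n X i j) → ∀ i j →
      LinearRelation R ι X (λ k → coefficientOf (coefficientOf (p k) i) j)

module OperationsAgree {c ℓ} (A : KAlgebra c ℓ)
  (ops : Operations (KAlgebra.Carrier A) (ℕ → ℕ → KAlgebra.Carrier A))
  (agrees : Agrees (KAlgebra.rawRing A) ops) where

  private
    module O = Operations ops
    module D = DoubleSeries A
    module B = KAlgebra D.𝔸⟦x,y⟧
  open Agrees agrees

  substituted-agrees : ∀ n (X : Fin (suc n) → KAlgebra.Carrier A) u v →
    O.substituted n X u v B.≈ B.sum λ i → D.scalar (X i) B.* u B.^ (n ∸ toℕ i) B.* v B.^ toℕ i
  substituted-agrees n X u v = B.trans
    {O.substituted n X u v} {B.sum λ i → O.scalar (X i) O.* u O.^ (n ∸ toℕ i) O.* v O.^ toℕ i}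
    {B.sum λ i → D.scalar (X i) B.* u B.^ (n ∸ toℕ i) B.* v B.^ toℕ i}
    (B.reflexive (≡.trans (O.substituted-correct n X u v) (sum-agrees _)))
    (SumProperties.sum-cong-≋ B.semiring
      {x = λ i → O.scalar (X i) O.* u O.^ (n ∸ toℕ i) O.* v O.^ toℕ i}
      {y = λ i → D.scalar (X i) B.* u B.^ (n ∸ toℕ i) B.* v B.^ toℕ i}
      λ i → B.reflexive (≡.trans (*-agrees _ _) (cong₂ B._*_
        (≡.trans (*-agrees _ _) (cong₂ B._*_ (scalar-agrees (X i)) (^-agrees u (n ∸ toℕ i))))
        (^-agrees v (toℕ i)))))

  linear-agrees : ∀ a b → O.scalar a O.* O.x O.+ O.scalar b O.* O.y ≡ D.scalar a B.* D.x B.+ D.scalar b B.* D.y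
  linear-agrees a b = ≡.trans (+-agrees _ _) (cong₂ B._+_
    (≡.trans (*-agrees _ _) (cong₂ B._*_ (scalar-agrees a) x-agrees))
    (≡.trans (*-agrees _ _) (cong₂ B._*_ (scalar-agrees b) y-agrees)))

enumerator-facts : ∀ {c ℓ} (A : KAlgebra c ℓ) → let open KAlgebra A in
  ∀ r r[q-1] r[-1] → r[q-1] ≈ r * ι q-1ₖ → r[-1] ≈ - r → r * r * ι qₖ ≈ 1# →
  ∀ n → n ≡ 10 → (p : Fin (suc n) → Poly 2) → (∀ i → p i ≡ normalise (anti-invariance n i)) →
  ∀ ops → Agrees rawRing ops → EnumeratorFacts rawRing ι r r[q-1] r[-1] n p ops
enumerator-facts A r r[q-1] r[-1] r[q-1]≈ r[-1]≈ r²q≈1 n n≡10 p p≡ ops agrees = record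
  { known-anti-invariant = λ α X vanishes X≈ →
      B.trans {O.transformed n X r r[q-1] r r[-1]} {𝕋.T.transform (λ i → D.scalar (X i))}
        {B.- O.form n X} (transformed≈ X)
        (B.trans {𝕋.T.transform (λ i → D.scalar (X i))} {B.- 𝕋.T.form (λ i → D.scalar (X i))}
          {B.- O.form n X} (𝕋.known-anti-invariant α X vanishes X≈)
          (B.-‿cong {𝕋.T.form (λ i → D.scalar (X i))} {O.form n X}
            (B.sym {O.form n X} {𝕋.T.form (λ i → D.scalar (X i))} (form≈ X))))
  ; coefficient-relation = λ X eq i j → record { holds = 𝕋.coefficient-relation X
      (B.trans {𝕋.T.transform (λ i → D.scalar (X i))} {O.transformed n X r r[q-1] r r[-1]}
        {B.- 𝕋.T.form (λ i → D.scalar (X i))}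
        (B.sym {O.transformed n X r r[q-1] r r[-1]} {𝕋.T.transform (λ i → D.scalar (X i))} (transformed≈ X))
        (B.trans {O.transformed n X r r[q-1] r r[-1]} {B.- O.form n X}
          {B.- 𝕋.T.form (λ i → D.scalar (X i))} eq
          (B.-‿cong {O.form n X} {𝕋.T.form (λ i → D.scalar (X i))} (form≈ X)))) i j }
  }
  where
  module O = Operations ops
  module D = DoubleSeries A
  module B = KAlgebra D.𝔸⟦x,y⟧
  module 𝕋 = DoubleSeriesTransform A r r[q-1] r[-1] r[q-1]≈ r[-1]≈ r²q≈1 n n≡10 p p≡
  open OperationsAgree A ops agrees

  form≈ : ∀ X → O.form n X B.≈ 𝕋.T.form (λ i → D.scalar (X i))
  form≈ X = B.trans {O.form n X} {O.substituted n X D.x D.y} {𝕋.T.form (λ i → D.scalar (X i))}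
    (B.reflexive (≡.trans (O.form-correct n X)
      (cong₂ (O.substituted n X) (Agrees.x-agrees agrees) (Agrees.y-agrees agrees))))
    (substituted-agrees n X D.x D.y)

  transformed≈ : ∀ X → O.transformed n X r r[q-1] r r[-1] B.≈ 𝕋.T.transform (λ i → D.scalar (X i))
  transformed≈ X = B.trans {O.transformed n X r r[q-1] r r[-1]}
    {O.substituted n X (D.scalar r B.* D.x B.+ D.scalar r[q-1] B.* D.y) (D.scalar r B.* D.x B.+ D.scalar r[-1] B.* D.y)}
    {𝕋.T.transform (λ i → D.scalar (X i))}
    (B.reflexive (≡.trans (O.transformed-correct n X r r[q-1] r r[-1])
      (cong₂ (O.substituted n X) (linear-agrees r r[q-1]) (linear-agrees r r[-1]))))
    (substituted-agrees n X (D.scalar r B.* D.x B.+ D.scalar r[q-1] B.* D.y) (D.scalar r B.* D.x B.+ D.scalar r[-1] B.* D.y))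

xy-operations : Operations ℂ XY.Carrier
xy-operations = record
  { sum = XY.sum ; _+_ = XY._+_ ; _*_ = XY._*_ ; _^_ = XY._^_ ; scalar = XY.scalar ; x = XY.x ; y = XY.y
  ; substituted = λ n X u v → XY.sum λ i → XY.scalar (X i) XY.* u XY.^ (n ∸ toℕ i) XY.* v XY.^ toℕ i
  ; substituted-correct = λ n X u v → ≡.refl
  ; form = λ n X → XY.sum λ i → XY.scalar (X i) XY.* XY.x XY.^ (n ∸ toℕ i) XY.* XY.y XY.^ toℕ i
  ; form-correct = λ n X → ≡.refl
  ; transformed = λ n X a b c e → XY.sum λ i → XY.scalar (X i)
      XY.* (XY.scalar a XY.* XY.x XY.+ XY.scalar b XY.* XY.y) XY.^ (n ∸ toℕ i)
      XY.* (XY.scalar c XY.* XY.x XY.+ XY.scalar e XY.* XY.y) XY.^ toℕ i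
  ; transformed-correct = λ n X a b c e → ≡.refl
  }

xy-agrees : Agrees ℂ-rawRing xy-operations
xy-agrees = record
  { sum-agrees = λ _ → ≡.refl ; +-agrees = λ _ _ → ≡.refl ; *-agrees = λ _ _ → ≡.refl
  ; ^-agrees = λ _ _ → ≡.refl ; scalar-agrees = λ _ → ≡.refl ; x-agrees = ≡.refl ; y-agrees = ≡.refl }

form-agrees : ∀ {n} (A : Form n) →
  ⟦ A ⟧ ≡ Operations.form xy-operations n A
form-agrees A = ≡.refl

transform-agrees : ∀ {n} (A : Form n) M a b c e → M ≡ matrix a b c e →
  A ⟨ M ⟩ ≡ Operations.transformed xy-operations n A a b c e
transform-agrees A M a b c e ≡.refl = ≡.refl

anti-invariant-intro : ∀ n (A : Form n) M a b c e → M ≡ matrix a b c e →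
  (∀ i j → Operations.transformed xy-operations n A a b c e i j ℂ-Ring.≈ ℂ-Ring.- Operations.form xy-operations n A i j) →
  A ⟨ M ⟩ XY.≈ XY.- ⟦ A ⟧
anti-invariant-intro n A M a b c e M≡ h = subst₂ (λ f g → f XY.≈ XY.- g)
  (≡.sym (transform-agrees A M a b c e M≡)) (≡.sym (form-agrees A))
  (coerce (Operations.transformed xy-operations n A a b c e) (Operations.form xy-operations n A) h)
  where
  coerce : ∀ f g → (∀ i j → f i j ℂ-Ring.≈ ℂ-Ring.- g i j) → f XY.≈ XY.- g
  coerce f g h = h

anti-invariant-elim : ∀ n (A : Form n) M a b c e → M ≡ matrix a b c e → A ⟨ M ⟩ XY.≈ XY.- ⟦ A ⟧ →
  (∀ i j → Operations.transformed xy-operations n A a b c e i j ℂ-Ring.≈ ℂ-Ring.- Operations.form xy-operations n A i j)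
anti-invariant-elim n A M a b c e M≡ eq =
  uncoerce (Operations.transformed xy-operations n A a b c e) (Operations.form xy-operations n A)
    (subst₂ (λ f g → f XY.≈ XY.- g) (transform-agrees A M a b c e M≡) (form-agrees A) eq)
  where
  uncoerce : ∀ f g → f XY.≈ XY.- g → ∀ i j → f i j ℂ-Ring.≈ ℂ-Ring.- g i j
  uncoerce f g h = h

module Enumerators (s : ℝ) (s²≃5 : s *ᵣ s ≃ 5ℝ) (Q : Parameter)
  (q≃ : Parameter.q Q ≃ embed s s²≃5 qₖ) (q-1≃ : Parameter.q Q -ᵣ 1ℝ ≃ embed s s²≃5 q-1ₖ)
  (n : ℕ) (n≡10 : n ≡ 10)
  (p : Fin (suc n) → Poly 2) (p≡ : ∀ i → p i ≡ normalise (anti-invariance n i)) where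

  open Parameter Q

  𝔸 : KAlgebra 0ℓ 0ℓ
  𝔸 = ℂ-algebra s s²≃5

  module ℂA = KAlgebra 𝔸

  private
    r r[q-1] r[-1] : ℂ
    r      = fromℝ 1/√q
    r[q-1] = fromℝ (1/√q *ᵣ (q -ᵣ 1ℝ))
    r[-1]  = fromℝ (1/√q *ᵣ (-ᵣ 1ℝ))

    r[q-1]≈ : r[q-1] ℂA.≈ r ℂA.* ℂA.ι q-1ₖ
    r[q-1]≈ = ℂ-trans r[q-1] (fromℝ (1/√q *ᵣ embed s s²≃5 q-1ₖ)) (r ℂA.* ℂA.ι q-1ₖ)
      (fromℝ-cong (1/√q *ᵣ (q -ᵣ 1ℝ)) (1/√q *ᵣ embed s s²≃5 q-1ₖ)
        (*ᵣ-cong 1/√q 1/√q (q -ᵣ 1ℝ) (embed s s²≃5 q-1ₖ) (ℝR.refl {1/√q}) q-1≃))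
      (fromℝ-* 1/√q (embed s s²≃5 q-1ₖ))

    r[-1]≈ : r[-1] ℂA.≈ ℂA.- r
    r[-1]≈ = ℂ-trans r[-1] (fromℝ (-ᵣ 1/√q)) (ℂA.- r)
      (fromℝ-cong (1/√q *ᵣ (-ᵣ 1ℝ)) (-ᵣ 1/√q) (≃-pointwise (1/√q *ᵣ (-ᵣ 1ℝ)) (-ᵣ 1/√q) λ n →
        ≡.trans (≡.sym (ℚ.neg-distribʳ-* (seq 1/√q n) 1ℚ)) (cong ℚ.-_ (ℚ.*-identityʳ (seq 1/√q n)))))
      (fromℝ-neg 1/√q)

    r²q≈1 : r ℂA.* r ℂA.* ℂA.ι qₖ ℂA.≈ ℂA.1#
    r²q≈1 = begin
      r ℂA.* r ℂA.* ℂA.ι qₖ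
        ≈⟨ ℂA.*-cong {r ℂA.* r} {fromℝ (1/√q *ᵣ 1/√q)} {ℂA.ι qₖ} {fromℝ q}
             (ℂA.sym {fromℝ (1/√q *ᵣ 1/√q)} {r ℂA.* r} (fromℝ-* 1/√q 1/√q))
             (fromℝ-cong (embed s s²≃5 qₖ) q (≃-sym q (embed s s²≃5 qₖ) q≃)) ⟩
      fromℝ (1/√q *ᵣ 1/√q) ℂA.* fromℝ q
        ≈⟨ fromℝ-* (1/√q *ᵣ 1/√q) q ⟨
      fromℝ (1/√q *ᵣ 1/√q *ᵣ q)
        ≈⟨ fromℝ-cong (1/√q *ᵣ 1/√q *ᵣ q) 1ℝ (1/√q²q≃1 Q) ⟩
      fromℝ 1ℝ ∎
      where open SetoidReasoning ℂA.setoid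

    facts : EnumeratorFacts ℂ-rawRing (λ a → fromℝ (embed s s²≃5 a)) r r[q-1] r[-1] n p xy-operations
    -- The raw ring of `𝔸` and `ℂ-rawRing` are definitionally equal. Transport along one equation of
    -- pairs, with the ring a variable in `P`, confines the comparison to the operations and keeps
    -- the sums built from them out of it.
    facts = subst P pair (λ r r[q-1] r[-1] a b c n n≡10 p p≡ ops agrees →
      enumerator-facts 𝔸 r r[q-1] r[-1] a b c n n≡10 p p≡ ops agrees)
      r r[q-1] r[-1] r[q-1]≈ r[-1]≈ r²q≈1 n n≡10 p p≡ xy-operations xy-agrees
      where
      P : (Σ[ R ∈ RawRing 0ℓ 0ℓ ] (K → RawRing.Carrier R)) → Set _
      P (R , ι) = ∀ r r[q-1] r[-1] → r[q-1] ≈ r * ι q-1ₖ → r[-1] ≈ - r → r * r * ι qₖ ≈ 1# →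
        ∀ n → n ≡ 10 → (p : Fin (suc n) → Poly 2) → (∀ i → p i ≡ normalise (anti-invariance n i)) →
        ∀ ops → Agrees R ops → EnumeratorFacts R ι r r[q-1] r[-1] n p ops
        where open RawRing R
      pair : (KAlgebra.rawRing 𝔸 , KAlgebra.ι 𝔸) ≡ (ℂ-rawRing , λ a → fromℝ (embed s s²≃5 a))
      pair = ≡.refl

  anti-invariant : ∀ (α : Fin (suc n) → K) (A : Form n) →
    zeroₚ? (normalise (sumₑ (λ i → con (α i) `* anti-invariance n i))) ≡ true →
    (∀ i → A i ℂ-Ring.≈ fromℝ (embed s s²≃5 (α i))) → A ⟨ Parameter.σ Q ⟩ XY.≈ XY.- ⟦ A ⟧
  anti-invariant α A vanishes A≈ =
    let result = anti-invariant-intro n A (Parameter.σ Q) r r[q-1] r r[-1] ≡.refl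
                   (EnumeratorFacts.known-anti-invariant facts α A vanishes A≈)
    in result

  relation : ∀ (A : Form n) → A ⟨ Parameter.σ Q ⟩ XY.≈ XY.- ⟦ A ⟧ → ∀ i j →
    LinearRelation ℂ-rawRing (λ a → fromℝ (embed s s²≃5 a)) A (λ k → coefficientOf (coefficientOf (p k) i) j)
  relation A eq =
    let result = anti-invariant-elim n A (Parameter.σ Q) r r[q-1] r r[-1] ≡.refl eq
    in EnumeratorFacts.coefficient-relation facts A result

  gap-contradiction : ∀ (p : Fin 11 → Poly 2) (C : Form 10) → eliminated? p ≡ true → let open ℂ-Ring in
    C 0F ≈ 1# → C 1F ≈ 0# → C 2F ≈ 0# → C 3F ≈ 0# → C 5F ≈ 0# → C 7F ≈ 0# → C 9F ≈ 0# →
    (∀ a → LinearRelation ℂ-rawRing (λ a → fromℝ (embed s s²≃5 a)) C (coefficients p a)) → 1# ≈ 0#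
  gap-contradiction = subst P pair (Gap.no-larger-gap 𝔸)
    where
    P : (Σ[ R ∈ RawRing 0ℓ 0ℓ ] (K → RawRing.Carrier R)) → Set _
    P (R , ι) = ∀ (p : Fin 11 → Poly 2) (C : Fin 11 → Carrier) → eliminated? p ≡ true →
      C 0F ≈ 1# → C 1F ≈ 0# → C 2F ≈ 0# → C 3F ≈ 0# → C 5F ≈ 0# → C 7F ≈ 0# → C 9F ≈ 0# →
      (∀ a → LinearRelation R ι C (coefficients p a)) → 1# ≈ 0#
      where open RawRing R
    pair : (KAlgebra.rawRing 𝔸 , KAlgebra.ι 𝔸) ≡ (ℂ-rawRing , λ a → fromℝ (embed s s²≃5 a))
    pair = ≡.refl

ℂ-stable : ∀ z w → ¬ ¬ (z ℂ-Ring.≈ w) → z ℂ-Ring.≈ w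
ℂ-stable z w ¬¬z≈w =
  ≃-stable (re z) (re w) (λ re≄ → ¬¬z≈w λ z≈w → re≄ (proj₁ z≈w)) ,
  ≃-stable (im z) (im w) (λ im≄ → ¬¬z≈w λ z≈w → im≄ (proj₂ z≈w))

-- An inverse exhibited in `K` certifies that a number is nonzero under either embedding. The
-- witnesses `b` below are such inverses, written over a power of 210.
unit-≄0 : ∀ s s²≃5 a b → zero? (a *ₖ b +ₖ -ₖ 1ₖ) ≡ true → ¬ (embed s s²≃5 a ≃ 0ℝ)
unit-≄0 s s²≃5 a b ab≡1 a≃0 = 1ℝ≄0ℝ (LinearAlgebra.unit-cancel (ℝ-algebra s s²≃5) 1ℝ a b ab≡1
  (≃-trans (1ℝ *ᵣ embed s s²≃5 a) (embed s s²≃5 a) 0ℝ (ℝR.*-identityˡ (embed s s²≃5 a)) a≃0))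

module _ (s : ℝ) (s²≃5 : s *ᵣ s ≃ 5ℝ) where
  private
    e = embed s s²≃5

    rational : ∀ a b k → fromℚ (rat a k) +ᵣ fromℚ (rat b k) *ᵣ s ≃ e ⟪ a , b , k ⟫
    rational a b k = ℝR.refl {e ⟪ a , b , k ⟫}

    negative : ∀ a b k → -ᵣ (fromℚ (rat a k) +ᵣ fromℚ (rat b k) *ᵣ s) ≃ e (-ₖ ⟪ a , b , k ⟫)
    negative a b k = ≃-sym (e (-ₖ ⟪ a , b , k ⟫)) (-ᵣ e ⟪ a , b , k ⟫) (embed-neg s s²≃5 ⟪ a , b , k ⟫)

    zero≃ : 0ℝ ≃ e 0ₖ
    zero≃ = ≃-sym (e 0ₖ) 0ℝ (embed-0 s s²≃5 0ₖ ≡.refl)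

  φ₁₀-coefficients : ∀ i → φ₁₀ s i ℂ-Ring.≈ fromℝ (e (φₖ i))
  φ₁₀-coefficients 0F = fromℝ-cong 1ℝ (e 1ₖ) (≃-sym (e 1ₖ) 1ℝ (embed-rational s s²≃5 (+ 1) 0))
  φ₁₀-coefficients 1F = fromℝ-cong 0ℝ (e 0ₖ) zero≃
  φ₁₀-coefficients 2F = fromℝ-cong (re (φ₁₀ s 2F)) (e (φₖ 2F)) (negative (+ 45) (+ 18) 0)
  φ₁₀-coefficients 3F = fromℝ-cong 0ℝ (e 0ₖ) zero≃
  φ₁₀-coefficients 4F = fromℝ-cong (re (φ₁₀ s 4F)) (e (φₖ 4F)) (rational (+ 378) (+ 168) 0)
  φ₁₀-coefficients 5F = fromℝ-cong 0ℝ (e 0ₖ) zero≃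
  φ₁₀-coefficients 6F = fromℝ-cong (re (φ₁₀ s 6F)) (e (φₖ 6F)) (negative (+ 149940) (+ 67032) 1)
  φ₁₀-coefficients 7F = fromℝ-cong 0ℝ (e 0ₖ) zero≃
  φ₁₀-coefficients 8F = fromℝ-cong (re (φ₁₀ s 8F)) (e (φₖ 8F)) (rational (+ 60858) (+ 27216) 1)
  φ₁₀-coefficients 9F = fromℝ-cong 0ℝ (e 0ₖ) zero≃
  φ₁₀-coefficients (Fin.suc 9F) = fromℝ-cong (re (φ₁₀ s (Fin.suc 9F))) (e (φₖ (Fin.suc 9F)))
    (negative (+ 112984200) (+ 50528016) 3)

  φ₁₀-leading : HasLeadingIndex (φ₁₀ s) 2F
  φ₁₀-leading = record
    { 0<d     = ℕ.s≤s ℕ.z≤n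
    ; monic   = ℝR.refl {1ℝ} , ℝR.refl {0ℝ}
    ; gap     = gap
    -- -(45 + 18√5) = -9 (5 + 2√5) has the inverse -(5 - 2√5)/45, here over 210⁴.
    ; nonzero = λ φ₂≈0 → unit-≄0 s s²≃5 (φₖ 2F) ⟪ -ᶻ 216090000 , + 86436000 , 4 ⟫ ≡.refl
        (≃-trans (e (φₖ 2F)) (re (φ₁₀ s 2F)) 0ℝ
          (≃-sym (re (φ₁₀ s 2F)) (e (φₖ 2F)) (proj₁ (φ₁₀-coefficients 2F))) (proj₁ φ₂≈0))
    }
    where
    gap : ∀ (i : Fin 11) → 0 ℕ.< toℕ i → toℕ i ℕ.< 2 → φ₁₀ s i ℂ-Ring.≈ ℂ-Ring.0#
    gap 1F _ _ = ℝR.refl {0ℝ} , ℝR.refl {0ℝ}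
    gap (Fin.suc (Fin.suc i)) _ (ℕ.s≤s (ℕ.s≤s ()))

  φ₁₀-divisible : DivisibleBy 2 (φ₁₀ s)
  φ₁₀-divisible 0F _ = divides 0 ≡.refl
  φ₁₀-divisible 2F _ = divides 1 ≡.refl
  φ₁₀-divisible 4F _ = divides 2 ≡.refl
  φ₁₀-divisible 6F _ = divides 3 ≡.refl
  φ₁₀-divisible 8F _ = divides 4 ≡.refl
  φ₁₀-divisible (Fin.suc 9F) _ = divides 5 ≡.refl
  φ₁₀-divisible 1F ≉0 = contradiction (ℝR.refl {0ℝ} , ℝR.refl {0ℝ}) ≉0
  φ₁₀-divisible 3F ≉0 = contradiction (ℝR.refl {0ℝ} , ℝR.refl {0ℝ}) ≉0
  φ₁₀-divisible 5F ≉0 = contradiction (ℝR.refl {0ℝ} , ℝR.refl {0ℝ}) ≉0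
  φ₁₀-divisible 7F ≉0 = contradiction (ℝR.refl {0ℝ} , ℝR.refl {0ℝ}) ≉0
  φ₁₀-divisible 9F ≉0 = contradiction (ℝR.refl {0ℝ} , ℝR.refl {0ℝ}) ≉0

enumerator-intro : ∀ Q n (A : Form n) d → HasLeadingIndex A d → A ⟨ Parameter.σ Q ⟩ XY.≈ XY.- ⟦ A ⟧ →
  IsFormalWeightEnumerator Q A d
enumerator-intro Q n A d leading eq = leading , eq

enumerator-leading : ∀ Q n (A : Form n) d → IsFormalWeightEnumerator Q A d → HasLeadingIndex A d
enumerator-leading Q n A d (leading , eq) = leading

enumerator-equation : ∀ Q n (A : Form n) d → IsFormalWeightEnumerator Q A d →
  A ⟨ Parameter.σ Q ⟩ XY.≈ XY.- ⟦ A ⟧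
enumerator-equation Q n A d (leading , eq) = eq

module Extremality (s : ℝ) (s²≃5 : s *ᵣ s ≃ 5ℝ) (Q : Parameter)
  (q≃ : Parameter.q Q ≃ embed s s²≃5 qₖ) (q-1≃ : Parameter.q Q -ᵣ 1ℝ ≃ embed s s²≃5 q-1ₖ)
  (p : Fin 11 → Poly 2) (p≡ : ∀ i → p i ≡ normalise (anti-invariance 10 i))
  (vanishes : zeroₚ? (normalise (sumₑ (λ i → con (φₖ i) `* anti-invariance 10 i))) ≡ true)
  (eliminated : eliminated? p ≡ true) where

  module E = Enumerators s s²≃5 Q q≃ q-1≃ 10 ≡.refl p p≡

  φ₁₀-enumerator : IsFormalWeightEnumerator Q (φ₁₀ s) 2F
  φ₁₀-enumerator = enumerator-intro Q 10 (φ₁₀ s) 2F (φ₁₀-leading s s²≃5)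
    (E.anti-invariant φₖ (φ₁₀ s) vanishes (φ₁₀-coefficients s s²≃5))

  maximal : ∀ (B : Form 10) d′ → IsFormalWeightEnumerator Q B d′ → DivisibleBy 2 B → toℕ d′ ℕ.≤ 2
  -- The order on ℕ is decidable, so d′ > 2 may be assumed; then the gap removes the coefficients at
  -- y and y², and divisibility the odd ones.
  maximal B d′ enumerator divisible = decidable-stable (toℕ d′ ℕ.≤? 2) λ d′≰2 → 1ℝ≄0ℝ
    (proj₁ (E.gap-contradiction p B eliminated monic
      (below d′≰2 1F (ℕ.s≤s ℕ.z≤n) (ℕ.s≤s (ℕ.s≤s ℕ.z≤n)))
      (below d′≰2 2F (ℕ.s≤s ℕ.z≤n) (ℕ.s≤s (ℕ.s≤s (ℕ.s≤s ℕ.z≤n))))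
      (odd 3F _) (odd 5F _) (odd 7F _) (odd 9F _)
      (λ a → E.relation B equation (10 ∸ toℕ a) (toℕ a))))
    where
    open HasLeadingIndex (enumerator-leading Q 10 B d′ enumerator)
    equation : B ⟨ Parameter.σ Q ⟩ XY.≈ XY.- ⟦ B ⟧
    equation = enumerator-equation Q 10 B d′ enumerator
    below : ¬ (toℕ d′ ℕ.≤ 2) → ∀ i → 0 ℕ.< toℕ i → toℕ i ℕ.< 3 → B i ℂ-Ring.≈ ℂ-Ring.0#
    below d′≰2 i 0<i i<3 = gap i 0<i (ℕ.<-≤-trans i<3 (ℕ.≰⇒> d′≰2))
    odd : ∀ i → False (2 ∣? toℕ i) → B i ℂ-Ring.≈ ℂ-Ring.0#
    -- Divisibility speaks only of nonzero coefficients; that an odd one equals zero comes from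
    -- stability of equality in ℂ.
    odd i 2∤i = ℂ-stable (B i) ℂ-Ring.0# λ ≉0 → toWitnessFalse 2∤i (divisible i ≉0)

  φ₁₀-extremal : IsExtremal Q 2 (φ₁₀ s)
  φ₁₀-extremal = 2F , φ₁₀-enumerator , φ₁₀-divisible s s²≃5 , maximal


-- The term b aᵏ, with the power accumulated in `b` to stay in step with the recursion of
-- `truncated-geometric`.
geometricₖ : K → K → ℕ → K
geometricₖ a b zero    = b
geometricₖ a b (suc k) = geometricₖ a (a *ₖ b) k

truncated-geometric : ∀ {n} → K → K → ℕ → Poly (suc n)
truncated-geometric a b zero    = []
truncated-geometric a b (suc m) = constant b ∷ truncated-geometric a (a *ₖ b) m

truncated-geometric-coefficient : ∀ {n} a b m k → k ℕ.< m →
  coefficientOf (truncated-geometric {n} a b m) k ≡ constant (geometricₖ a b k)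
truncated-geometric-coefficient a b (suc m) zero    _           = ≡.refl
truncated-geometric-coefficient a b (suc m) (suc k) (ℕ.s≤s k<m) =
  truncated-geometric-coefficient a (a *ₖ b) m k k<m

-- Zeta polynomials

-- The variables are T, x, y in this order. Only the coefficients up to T⁸ matter, so 1/(1-aT) is cut there.
line : Expr 3
line = var 2F `* (con 1ₖ `+ `- var 0F) `+ var 1F `* var 0F

-- Up to T⁸ this is the generating function for P = 1. A general P then enters linearly, by shifting
-- and combining these coefficients.
kernel : ℕ → Poly 3
kernel n = (truncated-geometric 1ₖ 1ₖ 9 ⊗ truncated-geometric qₖ 1ₖ 9) ⊗ (normalise line ⊗^ n)

sumₚ : ∀ {m n} → (Fin n → Poly m) → Poly m
sumₚ {n = zero}  f = 0ₚ
sumₚ {n = suc n} f = f Fin.zero ⊕ sumₚ (λ i → f (Fin.suc i))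

-- 1/(q-1) = 5 - 2√5.
1/[q-1]ₖ : K
1/[q-1]ₖ = ⟪ + 5 , -ᶻ 2 , 0 ⟫

remainder : ∀ n → (Fin (suc n) → K) → Expr 2
remainder n α = con 1/[q-1]ₖ
  `* (sumₑ (λ i → con (α i) `* var 0F `^ (n ∸ toℕ i) `* var 1F `^ toℕ i) `+ `- (var 0F `^ n))

zeta? : ∀ n N → Poly 3 → (Fin (suc n) → K) → (Fin (suc N) → K) → Bool
zeta? n N h α π =
  zeroₚ? (sumₚ (λ k → constant (π k) ⊗ coefficientOf h (N ∸ toℕ k)) ⊕ ⊖ normalise (remainder n α))

-- Row a belongs to the coefficient of x^(N-a) y^(n-N+a).
zeta-matrix : ∀ n N → Poly 3 → Fin (suc N) → Fin (suc N) → K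
zeta-matrix n N h a k =
  coefficientOf (coefficientOf (coefficientOf h (N ∸ toℕ k)) (N ∸ toℕ a)) (n ∸ (N ∸ toℕ a))

module _ {c ℓ} (A : KAlgebra c ℓ) where
  open KAlgebra A

  ι-geometric : ∀ a b k → ι (geometricₖ a b k) ≈ ι a ^ k * ι b
  ι-geometric a b zero    = sym (*-identityˡ (ι b))
  ι-geometric a b (suc k) = begin
    ι (geometricₖ a (a *ₖ b) k)  ≈⟨ ι-geometric a (a *ₖ b) k ⟩
    ι a ^ k * ι (a *ₖ b)         ≈⟨ *-congˡ (ι-* a b) ⟩
    ι a ^ k * (ι a * ι b)        ≈⟨ *-assoc (ι a ^ k) (ι a) (ι b) ⟨
    ι a ^ k * ι a * ι b          ≈⟨ *-congʳ (*-comm (ι a ^ k) (ι a)) ⟩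
    ι a * ι a ^ k * ι b          ∎
    where open SetoidReasoning setoid

module GeneratingFunction {c ℓ} (B : KAlgebra c ℓ) (x y : KAlgebra.Carrier B)
  (n : ℕ) (h : Poly 3) (h≡ : h ≡ kernel n) where
  open KAlgebra B

  private
    𝕋-algebra = SeriesAlgebra.seriesAlgebra B
    module 𝕋 = KAlgebra 𝕋-algebra
    module 𝔼 = Evaluation B
    module 𝕋E = Evaluation 𝕋-algebra
    open SeriesProperties commutativeRing using (*-congₛ)

    const : Carrier → 𝕋.Carrier
    const = constantSeries rawRing

    T : 𝕋.Carrier
    T = variableSeries rawRing

    xy : Vec Carrier 2
    xy = x ∷ y ∷ []

    Txy : Vec 𝕋.Carrier 3
    Txy = T ∷ const x ∷ const y ∷ []

  line-series : 𝕋.Carrier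
  line-series = const y 𝕋.* (𝕋.1# 𝕋.+ 𝕋.- T) 𝕋.+ const x 𝕋.* T

  private
    geometric-eval : ∀ a (g : 𝕋.Carrier) → (∀ k → g k ≈ ι (geometricₖ a 1ₖ k)) → ∀ k → k ℕ.≤ 8 →
      g k ≈ 𝕋E.eval (truncated-geometric a 1ₖ 9) Txy k
    geometric-eval a g g≈ k k≤8 = begin
      g k
        ≈⟨ g≈ k ⟩
      ι (geometricₖ a 1ₖ k)
        ≈⟨ 𝔼.eval-constant (geometricₖ a 1ₖ k) xy ⟨
      𝔼.eval (constant (geometricₖ a 1ₖ k)) xy
        ≈⟨ reflexive (cong (λ p → 𝔼.eval p xy) (truncated-geometric-coefficient {2} a 1ₖ 9 k (ℕ.s≤s k≤8))) ⟨
      𝔼.eval (coefficientOf (truncated-geometric a 1ₖ 9) k) xy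
        ≈⟨ SeriesAlgebra.eval-coefficient B (truncated-geometric a 1ₖ 9) xy k ⟨
      𝕋E.eval (truncated-geometric a 1ₖ 9) Txy k ∎
      where open SetoidReasoning setoid

    line-eval : line-series 𝕋.≈ 𝕋E.eval (normalise line) Txy
    line-eval = 𝕋.trans {line-series} {𝕋E.⟦ line ⟧ₑ Txy} {𝕋E.eval (normalise line) Txy}
      (𝕋.+-cong {const y 𝕋.* (𝕋.1# 𝕋.+ 𝕋.- T)} {const y 𝕋.* (𝕋.ι 1ₖ 𝕋.+ 𝕋.- T)} {const x 𝕋.* T} {const x 𝕋.* T}
        (𝕋.*-cong {const y} {const y} {𝕋.1# 𝕋.+ 𝕋.- T} {𝕋.ι 1ₖ 𝕋.+ 𝕋.- T} (𝕋.refl {const y})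
          (𝕋.+-cong {𝕋.1#} {𝕋.ι 1ₖ} {𝕋.- T} {𝕋.- T} (𝕋.sym {𝕋.ι 1ₖ} {𝕋.1#} 𝕋.ι-1) (𝕋.refl {𝕋.- T})))
        (𝕋.refl {const x 𝕋.* T}))
      (𝕋.sym {𝕋E.eval (normalise line) Txy} {𝕋E.⟦ line ⟧ₑ Txy} (𝕋E.normalise-correct line Txy))

  -- The coefficient of a product at Tᵏ involves only coefficients up to k of the factors, so for k
  -- ≤ 8 cutting both geometric series after T⁸ changes nothing.
  kernel-coefficient : ∀ (g₁ g₂ : 𝕋.Carrier) → (∀ k → g₁ k ≈ ι (geometricₖ 1ₖ 1ₖ k)) → (∀ k → g₂ k ≈ ι (geometricₖ qₖ 1ₖ k)) →
    ∀ k → k ℕ.≤ 8 → ((g₁ 𝕋.* g₂) 𝕋.* line-series 𝕋.^ n) k ≈ 𝔼.eval (coefficientOf h k) xy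
  kernel-coefficient g₁ g₂ g₁≈ g₂≈ k k≤8 = begin
    ((g₁ 𝕋.* g₂) 𝕋.* line-series 𝕋.^ n) k
      ≈⟨ *-congₛ k {g₁ 𝕋.* g₂} {𝕋E.eval g₁ₚ Txy 𝕋.* 𝕋E.eval g₂ₚ Txy} {line-series 𝕋.^ n} {𝕋E.eval lₚ Txy 𝕋.^ n}
           (λ j j≤k → *-congₛ j {g₁} {𝕋E.eval g₁ₚ Txy} {g₂} {𝕋E.eval g₂ₚ Txy}
             (λ i i≤j → geometric-eval 1ₖ g₁ g₁≈ i (ℕ.≤-trans i≤j (ℕ.≤-trans j≤k k≤8)))
             (λ i i≤j → geometric-eval qₖ g₂ g₂≈ i (ℕ.≤-trans i≤j (ℕ.≤-trans j≤k k≤8))))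
           (λ j _ → 𝕋E.^-cong {line-series} {𝕋E.eval lₚ Txy} n line-eval j) ⟩
    ((𝕋E.eval g₁ₚ Txy 𝕋.* 𝕋E.eval g₂ₚ Txy) 𝕋.* 𝕋E.eval lₚ Txy 𝕋.^ n) k
      ≈⟨ 𝕋.*-cong {𝕋E.eval (g₁ₚ ⊗ g₂ₚ) Txy} {𝕋E.eval g₁ₚ Txy 𝕋.* 𝕋E.eval g₂ₚ Txy}
           {𝕋E.eval (lₚ ⊗^ n) Txy} {𝕋E.eval lₚ Txy 𝕋.^ n}
           (𝕋E.eval-⊗ g₁ₚ g₂ₚ Txy) (𝕋E.eval-⊗^ lₚ n Txy) k ⟨
    (𝕋E.eval (g₁ₚ ⊗ g₂ₚ) Txy 𝕋.* 𝕋E.eval (lₚ ⊗^ n) Txy) k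
      ≈⟨ 𝕋E.eval-⊗ (g₁ₚ ⊗ g₂ₚ) (lₚ ⊗^ n) Txy k ⟨
    𝕋E.eval (kernel n) Txy k
      ≈⟨ SeriesAlgebra.eval-coefficient B (kernel n) xy k ⟩
    𝔼.eval (coefficientOf (kernel n) k) xy
      ≈⟨ reflexive (cong (λ p → 𝔼.eval (coefficientOf p k) xy) h≡) ⟨
    𝔼.eval (coefficientOf h k) xy ∎
    where
    open SetoidReasoning setoid
    g₁ₚ g₂ₚ lₚ : Poly 3
    g₁ₚ = truncated-geometric 1ₖ 1ₖ 9
    g₂ₚ = truncated-geometric qₖ 1ₖ 9
    lₚ  = normalise line

  -- The generating function is linear in the zeta polynomial p, with the coefficients of h as matrix.
  generating-coefficient : ∀ (p g₁ g₂ : 𝕋.Carrier) → (∀ k → g₁ k ≈ ι (geometricₖ 1ₖ 1ₖ k)) →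
    (∀ k → g₂ k ≈ ι (geometricₖ qₖ 1ₖ k)) → ∀ m → m ℕ.≤ 8 →
    (p 𝕋.* g₁ 𝕋.* g₂ 𝕋.* line-series 𝕋.^ n) m
      ≈ sum {suc m} (λ k → p (toℕ k) * 𝔼.eval (coefficientOf h (m ∸ toℕ k)) xy)
  generating-coefficient p g₁ g₂ g₁≈ g₂≈ m m≤8 = begin
    (p 𝕋.* g₁ 𝕋.* g₂ 𝕋.* l) m
      ≈⟨ 𝕋.*-cong {p 𝕋.* g₁ 𝕋.* g₂} {p 𝕋.* (g₁ 𝕋.* g₂)} {l} {l} (𝕋.*-assoc p g₁ g₂) (𝕋.refl {l}) m ⟩
    (p 𝕋.* (g₁ 𝕋.* g₂) 𝕋.* l) m
      ≈⟨ 𝕋.*-assoc p (g₁ 𝕋.* g₂) l m ⟩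
    (p 𝕋.* ((g₁ 𝕋.* g₂) 𝕋.* l)) m
      ≈⟨ sum-cong-≋ {suc m} (λ k → *-congˡ {p (toℕ k)} (kernel-coefficient g₁ g₂ g₁≈ g₂≈ (m ∸ toℕ k)
           (ℕ.≤-trans (ℕ.m∸n≤m m (toℕ k)) m≤8))) ⟩
    sum {suc m} (λ k → p (toℕ k) * 𝔼.eval (coefficientOf h (m ∸ toℕ k)) xy) ∎
    where
    open SetoidReasoning setoid
    open SumProperties semiring using (sum-cong-≋)
    l = line-series 𝕋.^ n

  eval-sumₚ : ∀ {m k} (f : Fin k → Poly m) ρ → 𝔼.eval (sumₚ f) ρ ≈ sum (λ i → 𝔼.eval (f i) ρ)
  eval-sumₚ {k = zero}  f ρ = 𝔼.eval-0 ρ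
  eval-sumₚ {k = suc k} f ρ = trans (𝔼.eval-⊕ (f Fin.zero) (sumₚ (λ i → f (Fin.suc i))) ρ)
    (+-congˡ (eval-sumₚ (λ i → f (Fin.suc i)) ρ))

  zeta-identity : ∀ N (α : Fin (suc n) → K) (π : Fin (suc N) → K) → zeta? n N h α π ≡ true →
    ∀ (P : Fin (suc N) → Carrier) (X : Fin (suc n) → Carrier) c′ →
    (∀ k → P k ≈ ι (π k)) → (∀ i → X i ≈ ι (α i)) → c′ ≈ ι 1/[q-1]ₖ →
    sum (λ k → P k * 𝔼.eval (coefficientOf h (N ∸ toℕ k)) xy)
      ≈ c′ * (sum (λ i → X i * x ^ (n ∸ toℕ i) * y ^ toℕ i) + - (x ^ n))
  zeta-identity N α π check P X c′ P≈ X≈ c′≈ = begin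
    sum (λ k → P k * 𝔼.eval (coefficientOf h (N ∸ toℕ k)) xy)
      ≈⟨ sum-cong-≋ {x = λ k → P k * 𝔼.eval (coefficientOf h (N ∸ toℕ k)) xy}
           {y = λ k → 𝔼.eval (constant (π k) ⊗ coefficientOf h (N ∸ toℕ k)) xy}
           (λ k → trans (*-congʳ (trans (P≈ k) (sym (𝔼.eval-constant (π k) xy))))
             (sym (𝔼.eval-⊗ (constant (π k)) (coefficientOf h (N ∸ toℕ k)) xy))) ⟩
    sum (λ k → 𝔼.eval (constant (π k) ⊗ coefficientOf h (N ∸ toℕ k)) xy)
      ≈⟨ eval-sumₚ (λ k → constant (π k) ⊗ coefficientOf h (N ∸ toℕ k)) xy ⟨
    𝔼.eval (sumₚ (λ k → constant (π k) ⊗ coefficientOf h (N ∸ toℕ k))) xy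
      ≈⟨ 𝔼.eval-≈ (sumₚ (λ k → constant (π k) ⊗ coefficientOf h (N ∸ toℕ k))) (normalise (remainder n α)) xy check ⟩
    𝔼.eval (normalise (remainder n α)) xy
      ≈⟨ 𝔼.normalise-correct (remainder n α) xy ⟩
    ι 1/[q-1]ₖ * (𝔼.⟦ sumₑ (λ i → con (α i) `* var 0F `^ (n ∸ toℕ i) `* var 1F `^ toℕ i) ⟧ₑ xy + - (x ^ n))
      ≈⟨ *-cong c′≈ (+-congʳ (trans
           (sum-cong-≋ {x = λ i → X i * x ^ (n ∸ toℕ i) * y ^ toℕ i} {y = λ i → ι (α i) * x ^ (n ∸ toℕ i) * y ^ toℕ i}
             (λ i → *-congʳ (*-congʳ (X≈ i))))
           (sym (LinearAlgebra.⟦sum⟧ₑ B (λ i → con (α i) `* var 0F `^ (n ∸ toℕ i) `* var 1F `^ toℕ i) xy)))) ⟨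
    c′ * (sum (λ i → X i * x ^ (n ∸ toℕ i) * y ^ toℕ i) + - (x ^ n)) ∎
    where
    open SetoidReasoning setoid
    open SumProperties semiring using (sum-cong-≋)

  sum-difference : ∀ {m} (X Y e : Fin m → Carrier) →
    sum (λ k → X k * e k) ≈ sum (λ k → Y k * e k) → sum (λ k → (X k - Y k) * e k) ≈ 0#
  sum-difference X Y e eq = begin
    sum (λ k → (X k - Y k) * e k)
      ≈⟨ sum-cong-≋ {x = λ k → (X k - Y k) * e k} {y = λ k → X k * e k + ι (-ₖ 1ₖ) * (Y k * e k)}
           (λ k → 𝔼.by-normalisation ((var 0F `- var 1F) `* var 2F)
             (var 0F `* var 2F `+ con (-ₖ 1ₖ) `* (var 1F `* var 2F)) (X k ∷ Y k ∷ e k ∷ []) ≡.refl) ⟩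
    sum (λ k → X k * e k + ι (-ₖ 1ₖ) * (Y k * e k))
      ≈⟨ ∑-distrib-+ (λ k → X k * e k) (λ k → ι (-ₖ 1ₖ) * (Y k * e k)) ⟩
    sum (λ k → X k * e k) + sum (λ k → ι (-ₖ 1ₖ) * (Y k * e k))
      ≈⟨ +-cong eq (sym (*-distribˡ-sum (ι (-ₖ 1ₖ)) (λ k → Y k * e k))) ⟩
    sum (λ k → Y k * e k) + ι (-ₖ 1ₖ) * sum (λ k → Y k * e k)
      ≈⟨ 𝔼.by-normalisation (var 0F `+ con (-ₖ 1ₖ) `* var 0F) (con 0ₖ) (sum (λ k → Y k * e k) ∷ []) ≡.refl ⟩
    ι 0ₖ
      ≈⟨ ι-0 0ₖ ≡.refl ⟩
    0# ∎
    where
    open SetoidReasoning setoid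
    open SumProperties semiring using (sum-cong-≋; ∑-distrib-+; *-distribˡ-sum)

module ZetaUniqueness {c ℓ} (A : KAlgebra c ℓ) (n N : ℕ) (h : Poly 3) (inv : Fin (suc N) → K)
  (triangular : lower-triangular? (zeta-matrix n N h) inv ≡ true) where
  open KAlgebra A

  private
    module D = DoubleSeries A
    module B = KAlgebra D.𝔸⟦x,y⟧

    e : Fin (suc N) → B.Carrier
    e k = Evaluation.eval D.𝔸⟦x,y⟧ (coefficientOf h (N ∸ toℕ k)) (D.x ∷ D.y ∷ [])

  -- For the kernel, triangularity has a simple cause: in (y(1 - T) + xT)ⁿ every x brings a T, so
  -- the coefficient of T^(N-k) has degree at most N - k in x. Row a reads off x^(N-a), whence zeros
  -- for k > a. On the diagonal only the constant terms 1 of the geometric series contribute and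
  -- leave a binomial coefficient.
  unique : ∀ (P P′ : Fin (suc N) → Carrier) →
    B.sum (λ k → D.scalar (P k) B.* e k) B.≈ B.sum (λ k → D.scalar (P′ k) B.* e k) →
    ∀ k → P k - P′ k ≈ 0#
  unique P P′ eq = LinearAlgebra.triangular-kernel A (λ k → P k - P′ k) (zeta-matrix n N h) inv triangular
    λ a → D.linear-relation (λ k → P k - P′ k) (λ k → coefficientOf h (N ∸ toℕ k))
      (B.trans {B.sum (λ k → D.scalar (P k - P′ k) B.* e k)} {B.sum (λ k → (D.scalar (P k) B.- D.scalar (P′ k)) B.* e k)} {B.0#}
        (SumProperties.sum-cong-≋ B.semiring
          {x = λ k → D.scalar (P k - P′ k) B.* e k} {y = λ k → (D.scalar (P k) B.- D.scalar (P′ k)) B.* e k}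
          λ k → B.*-cong {D.scalar (P k - P′ k)} {D.scalar (P k) B.- D.scalar (P′ k)} {e k} {e k}
            (B.trans {D.scalar (P k - P′ k)} {D.scalar (P k) B.+ D.scalar (- P′ k)} {D.scalar (P k) B.- D.scalar (P′ k)}
              (D.scalar-+ (P k) (- P′ k))
              (B.+-cong {D.scalar (P k)} {D.scalar (P k)} {D.scalar (- P′ k)} {B.- D.scalar (P′ k)}
                (B.refl {D.scalar (P k)}) (D.scalar-neg (P′ k))))
            (B.refl {e k}))
        (GeneratingFunction.sum-difference D.𝔸⟦x,y⟧ D.x D.y n (kernel n) ≡.refl
          (λ k → D.scalar (P k)) (λ k → D.scalar (P′ k)) e eq))
      (N ∸ toℕ a) (n ∸ (N ∸ toℕ a))

-- The counterpart of `Operations` for the defining equation of the zeta polynomial. The index ₂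
-- marks operations on series in x and y; those without it act on series in T over them.
record ZetaOperations {a c} (A : Set a) (C : Set c) : Set (a ⊔ c) where
  infixl 6 _+_ _+₂_
  infixl 7 _*_ _*₂_
  infixr 8 _^_ _^₂_
  infix  9 -_ -₂_
  field
    _+₂_ _*₂_ : C → C → C
    -₂_       : C → C
    _^₂_      : C → ℕ → C
    scalar    : A → C
    x y       : C
    form      : ∀ n → (Fin (suc n) → A) → C
    _+_ _*_ : (ℕ → C) → (ℕ → C) → ℕ → C
    -_      : (ℕ → C) → ℕ → C
    _^_     : (ℕ → C) → ℕ → ℕ → C
    1# T    : ℕ → C
    lift    : C → ℕ → C
    generating : ∀ n → (p g₁ g₂ : ℕ → C) → ℕ → C
    generating-correct : ∀ n p g₁ g₂ →
      generating n p g₁ g₂ ≡ p * g₁ * g₂ * (lift y * (1# + - T) + lift x * T) ^ n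
    right-side : ∀ n → A → (Fin (suc n) → A) → C
    right-side-correct : ∀ n c X → right-side n c X ≡ scalar c *₂ (form n X +₂ -₂ (x ^₂ n))

record ZetaAgrees {a ℓ} (R : RawRing a ℓ) (ops : Operations (RawRing.Carrier R) (ℕ → ℕ → RawRing.Carrier R))
  (zops : ZetaOperations (RawRing.Carrier R) (ℕ → ℕ → RawRing.Carrier R)) : Set a where
  private
    module Z = ZetaOperations zops
    module S = RawRing (seriesRing (seriesRing R))
    module P₂ = RawSemiringOps S.rawSemiring
    module U = RawRing (seriesRing (seriesRing (seriesRing R)))
    module P = RawSemiringOps U.rawSemiring
  field
    +₂-agrees : ∀ f g → f Z.+₂ g ≡ f S.+ g
    *₂-agrees : ∀ f g → f Z.*₂ g ≡ f S.* g
    -₂-agrees : ∀ f → Z.-₂ f ≡ S.- f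
    ^₂-agrees : ∀ f k → f Z.^₂ k ≡ f P₂.^ k
    scalar-agrees : ∀ a → Z.scalar a ≡ constantSeries (seriesRing R) (constantSeries R a)
    x-agrees : Z.x ≡ variableSeries (seriesRing R)
    y-agrees : Z.y ≡ constantSeries (seriesRing R) (variableSeries R)
    form₂-agrees : ∀ n X → Z.form n X ≡ Operations.form ops n X
    +-agrees : ∀ f g → f Z.+ g ≡ f U.+ g
    *-agrees : ∀ f g → f Z.* g ≡ f U.* g
    neg-agrees : ∀ f → Z.- f ≡ U.- f
    ^-agrees : ∀ f k → f Z.^ k ≡ f P.^ k
    1-agrees : Z.1# ≡ U.1#
    T-agrees : Z.T ≡ variableSeries (seriesRing (seriesRing R))
    lift-agrees : ∀ f → Z.lift f ≡ constantSeries (seriesRing (seriesRing R)) f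

record ZetaFacts {c ℓ} (R : RawRing c ℓ) (ι : K → RawRing.Carrier R) (n N : ℕ)
  (α : Fin (suc n) → K) (π : Fin (suc N) → K)
  (zops : ZetaOperations (RawRing.Carrier R) (ℕ → ℕ → RawRing.Carrier R))
  (q : RawRing.Carrier R) : Set (c ⊔ ℓ) where
  open RawRing R
  open RawSemiringOps rawSemiring using (_^_)
  field
    identity : ∀ (P : Fin (suc N) → Carrier) (X : Fin (suc n) → Carrier) c p g₁ g₂ →
      (∀ k → p (toℕ k) ≡ ZetaOperations.scalar zops (P k)) →
      (∀ k → g₁ k ≡ ZetaOperations.scalar zops (1# ^ k)) → (∀ k → g₂ k ≡ ZetaOperations.scalar zops (q ^ k)) →
      (∀ k → P k ≈ ι (π k)) → (∀ i → X i ≈ ι (α i)) → c ≈ ι 1/[q-1]ₖ →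
      ∀ i j → ZetaOperations.generating zops n p g₁ g₂ N i j ≈ ZetaOperations.right-side zops n c X i j
    unique : ∀ (P P′ : Fin (suc N) → Carrier) (p p′ g₁ g₂ : ℕ → ℕ → ℕ → Carrier) (r : ℕ → ℕ → Carrier) →
      (∀ k → p (toℕ k) ≡ ZetaOperations.scalar zops (P k)) → (∀ k → p′ (toℕ k) ≡ ZetaOperations.scalar zops (P′ k)) →
      (∀ k → g₁ k ≡ ZetaOperations.scalar zops (1# ^ k)) → (∀ k → g₂ k ≡ ZetaOperations.scalar zops (q ^ k)) →
      (∀ i j → ZetaOperations.generating zops n p g₁ g₂ N i j ≈ r i j) →
      (∀ i j → ZetaOperations.generating zops n p′ g₁ g₂ N i j ≈ r i j) →
      ∀ k → P k ≈ P′ k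

zeta-facts : ∀ {c ℓ} (A : KAlgebra c ℓ) → let open KAlgebra A in
  ∀ q → q ≈ ι qₖ → ∀ n N → N ℕ.≤ 8 → (h : Poly 3) → h ≡ kernel n → ∀ α π → zeta? n N h α π ≡ true →
  ∀ inv → lower-triangular? (zeta-matrix n N h) inv ≡ true →
  ∀ ops → Agrees rawRing ops → (zops : ZetaOperations Carrier (ℕ → ℕ → Carrier)) → ZetaAgrees rawRing ops zops →
  ZetaFacts rawRing ι n N α π zops q
zeta-facts A q q≈ n N N≤8 h h≡ α π check inv triangular ops agrees zops zagrees = record
  { identity = λ P X c p g₁ g₂ p≡ g₁≡ g₂≡ P≈ X≈ c≈ →
      B.trans {Z.generating n p g₁ g₂ N} {B.sum (λ k → D.scalar (P k) B.* e k)} {Z.right-side n c X}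
        (generating≈ P p g₁ g₂ p≡ g₁≡ g₂≡)
        (B.trans {B.sum (λ k → D.scalar (P k) B.* e k)} {right c X} {Z.right-side n c X}
          (G.zeta-identity N α π check (λ k → D.scalar (P k)) (λ i → D.scalar (X i)) (D.scalar c)
            (λ k → D.scalar-cong {P k} {ι (π k)} (P≈ k)) (λ i → D.scalar-cong {X i} {ι (α i)} (X≈ i))
            (D.scalar-cong {c} {ι 1/[q-1]ₖ} c≈))
          (B.sym {Z.right-side n c X} {right c X} (right-side≈ c X)))
  ; unique = λ P P′ p p′ g₁ g₂ r p≡ p′≡ g₁≡ g₂≡ eq eq′ k → x∙y⁻¹≈ε⇒x≈y (P k) (P′ k)
      (ZetaUniqueness.unique A n N h inv triangular P P′
        (B.trans {B.sum (λ k → D.scalar (P k) B.* e k)} {Z.generating n p g₁ g₂ N} {B.sum (λ k → D.scalar (P′ k) B.* e k)}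
          (B.sym {Z.generating n p g₁ g₂ N} {B.sum (λ k → D.scalar (P k) B.* e k)}
            (generating≈ P p g₁ g₂ p≡ g₁≡ g₂≡))
          (B.trans {Z.generating n p g₁ g₂ N} {r} {B.sum (λ k → D.scalar (P′ k) B.* e k)} eq
            (B.trans {r} {Z.generating n p′ g₁ g₂ N} {B.sum (λ k → D.scalar (P′ k) B.* e k)}
              (B.sym {Z.generating n p′ g₁ g₂ N} {r} eq′)
              (generating≈ P′ p′ g₁ g₂ p′≡ g₁≡ g₂≡)))) k)
  }
  where
  open KAlgebra A
  open RingProperties ring using (x∙y⁻¹≈ε⇒x≈y)
  module O = Operations ops
  module OA = Agrees agrees
  module Z = ZetaOperations zops
  module ZA = ZetaAgrees zagrees
  module D = DoubleSeries A
  module B = KAlgebra D.𝔸⟦x,y⟧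
  module U = KAlgebra (SeriesAlgebra.seriesAlgebra D.𝔸⟦x,y⟧)
  module G = GeneratingFunction D.𝔸⟦x,y⟧ D.x D.y n h h≡

  e : Fin (suc N) → B.Carrier
  e k = Evaluation.eval D.𝔸⟦x,y⟧ (coefficientOf h (N ∸ toℕ k)) (D.x ∷ D.y ∷ [])

  right : Carrier → (Fin (suc n) → Carrier) → B.Carrier
  right c X = D.scalar c B.* (B.sum (λ i → D.scalar (X i) B.* D.x B.^ (n ∸ toℕ i) B.* D.y B.^ toℕ i) B.+ B.- (D.x B.^ n))

  right-side≈ : ∀ c X → Z.right-side n c X B.≈ right c X
  right-side≈ c X = B.trans {Z.right-side n c X} {D.scalar c B.* (O.form n X B.+ B.- (D.x B.^ n))} {right c X}
    (B.reflexive (≡.trans (Z.right-side-correct n c X) (≡.trans (ZA.*₂-agrees _ _) (cong₂ B._*_ (ZA.scalar-agrees c)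
      (≡.trans (ZA.+₂-agrees _ _) (cong₂ B._+_ (ZA.form₂-agrees n X) (≡.trans (ZA.-₂-agrees _)
        (cong B.-_ (≡.trans (ZA.^₂-agrees _ n) (cong (B._^ n) ZA.x-agrees))))))))))
    (B.*-cong {D.scalar c} {D.scalar c} {O.form n X B.+ B.- (D.x B.^ n)}
      {B.sum (λ i → D.scalar (X i) B.* D.x B.^ (n ∸ toℕ i) B.* D.y B.^ toℕ i) B.+ B.- (D.x B.^ n)} (B.refl {D.scalar c})
      (B.+-cong {O.form n X} {B.sum (λ i → D.scalar (X i) B.* D.x B.^ (n ∸ toℕ i) B.* D.y B.^ toℕ i)}
        {B.- (D.x B.^ n)} {B.- (D.x B.^ n)}
        (B.trans {O.form n X} {O.substituted n X D.x D.y} {B.sum (λ i → D.scalar (X i) B.* D.x B.^ (n ∸ toℕ i) B.* D.y B.^ toℕ i)}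
          (B.reflexive (≡.trans (O.form-correct n X) (cong₂ (O.substituted n X) OA.x-agrees OA.y-agrees)))
          (OperationsAgree.substituted-agrees A ops agrees n X D.x D.y))
        (B.refl {B.- (D.x B.^ n)})))

  generating≡ : ∀ p g₁ g₂ → Z.generating n p g₁ g₂ ≡ p U.* g₁ U.* g₂ U.* G.line-series U.^ n
  generating≡ p g₁ g₂ = ≡.trans (Z.generating-correct n p g₁ g₂) (≡.trans (ZA.*-agrees _ _) (cong₂ U._*_
    (≡.trans (ZA.*-agrees _ _) (cong (U._* g₂) (ZA.*-agrees p g₁)))
    (≡.trans (ZA.^-agrees _ n) (cong (U._^ n) (≡.trans (ZA.+-agrees _ _) (cong₂ U._+_
      (≡.trans (ZA.*-agrees _ _) (cong₂ U._*_ (≡.trans (ZA.lift-agrees _) (cong (constantSeries B.rawRing) ZA.y-agrees))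
        (≡.trans (ZA.+-agrees _ _) (cong₂ U._+_ ZA.1-agrees (≡.trans (ZA.neg-agrees _) (cong U.-_ ZA.T-agrees))))))
      (≡.trans (ZA.*-agrees _ _) (cong₂ U._*_ (≡.trans (ZA.lift-agrees _) (cong (constantSeries B.rawRing) ZA.x-agrees))
        ZA.T-agrees))))))))

  power≈ : ∀ a b → a ≈ ι b → ∀ k → a ^ k ≈ ι (geometricₖ b 1ₖ k)
  power≈ a b a≈ k = trans (Evaluation.^-cong A k a≈)
    (trans (sym (*-identityʳ (ι b ^ k))) (trans (*-congˡ (sym ι-1)) (sym (ι-geometric A b 1ₖ k))))

  generating≈ : ∀ P p g₁ g₂ → (∀ k → p (toℕ k) ≡ Z.scalar (P k)) →
    (∀ k → g₁ k ≡ Z.scalar (1# ^ k)) → (∀ k → g₂ k ≡ Z.scalar (q ^ k)) →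
    Z.generating n p g₁ g₂ N B.≈ B.sum (λ k → D.scalar (P k) B.* e k)
  generating≈ P p g₁ g₂ p≡ g₁≡ g₂≡ =
    B.trans {Z.generating n p g₁ g₂ N} {(p U.* g₁ U.* g₂ U.* G.line-series U.^ n) N} {B.sum (λ k → D.scalar (P k) B.* e k)}
      (B.reflexive (cong (λ f → f N) (generating≡ p g₁ g₂)))
      (B.trans {(p U.* g₁ U.* g₂ U.* G.line-series U.^ n) N} {B.sum (λ k → p (toℕ k) B.* e k)} {B.sum (λ k → D.scalar (P k) B.* e k)}
        (G.generating-coefficient p g₁ g₂
          (λ k → B.trans {g₁ k} {D.scalar (1# ^ k)} {B.ι (geometricₖ 1ₖ 1ₖ k)}
            (B.reflexive (≡.trans (g₁≡ k) (ZA.scalar-agrees (1# ^ k))))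
            (D.scalar-cong {1# ^ k} {ι (geometricₖ 1ₖ 1ₖ k)} (power≈ 1# 1ₖ (sym ι-1) k)))
          (λ k → B.trans {g₂ k} {D.scalar (q ^ k)} {B.ι (geometricₖ qₖ 1ₖ k)}
            (B.reflexive (≡.trans (g₂≡ k) (ZA.scalar-agrees (q ^ k))))
            (D.scalar-cong {q ^ k} {ι (geometricₖ qₖ 1ₖ k)} (power≈ q qₖ q≈ k)))
          N N≤8)
        (B.reflexive (cong-sum (λ k → cong (B._* e k) (≡.trans (p≡ k) (ZA.scalar-agrees (P k)))))))
    where
    cong-sum : ∀ {m} {f g : Fin m → B.Carrier} → (∀ k → f k ≡ g k) → B.sum f ≡ B.sum g
    cong-sum {zero}  eq = ≡.refl
    cong-sum {suc m} eq = cong₂ B._+_ (eq Fin.zero) (cong-sum (λ k → eq (Fin.suc k)))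

xyt-operations : ZetaOperations ℂ XY.Carrier
xyt-operations = record
  { _+_ = XYT._+_ ; _*_ = XYT._*_ ; -_ = XYT.-_ ; _^_ = XYT._^_ ; 1# = XYT.1# ; T = XYT.T
  ; lift = XYT.coefficient ; _+₂_ = XY._+_ ; _*₂_ = XY._*_ ; -₂_ = XY.-_ ; _^₂_ = XY._^_
  ; scalar = XY.scalar ; x = XY.x ; y = XY.y ; form = λ n X → ⟦ X ⟧
  ; generating = λ n p g₁ g₂ → p XYT.* g₁ XYT.* g₂
      XYT.* (XYT.coefficient XY.y XYT.* (XYT.1# XYT.+ XYT.- XYT.T) XYT.+ XYT.coefficient XY.x XYT.* XYT.T) XYT.^ n
  ; generating-correct = λ n p g₁ g₂ → ≡.refl
  ; right-side = λ n c X → XY.scalar c XY.* (⟦ X ⟧ XY.+ XY.- (XY.x XY.^ n))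
  ; right-side-correct = λ n c X → ≡.refl
  }

xyt-agrees : ZetaAgrees ℂ-rawRing xy-operations xyt-operations
xyt-agrees = record
  { +-agrees = λ _ _ → ≡.refl ; *-agrees = λ _ _ → ≡.refl ; neg-agrees = λ _ → ≡.refl
  ; ^-agrees = λ _ _ → ≡.refl ; 1-agrees = ≡.refl ; T-agrees = ≡.refl
  ; lift-agrees = λ _ → ≡.refl ; +₂-agrees = λ _ _ → ≡.refl ; *₂-agrees = λ _ _ → ≡.refl ; -₂-agrees = λ _ → ≡.refl
  ; ^₂-agrees = λ _ _ → ≡.refl ; scalar-agrees = λ _ → ≡.refl ; x-agrees = ≡.refl ; y-agrees = ≡.refl
  ; form₂-agrees = λ n X → form-agrees X }


-- With `n` and `A` variables the defining equation is matched with `xyt-operations` before any sum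
-- of degree 10 can be expanded.
zeta-intro : ∀ Q n (A : Form n) d (P : Polynomial≤ (n ∸ toℕ d)) →
  (∀ i j → ZetaOperations.generating xyt-operations n (inT P) (geometric (RawRing.1# ℂ-rawRing))
             (geometric (fromℝ (Parameter.q Q))) (n ∸ toℕ d) i j
    ℂ-Ring.≈ ZetaOperations.right-side xyt-operations n (fromℝ (Parameter.1/[q-1] Q)) A i j) →
  IsZetaPolynomial Q A d P
zeta-intro Q n A d P h = h

zeta-elim : ∀ Q n (A : Form n) d (P : Polynomial≤ (n ∸ toℕ d)) → IsZetaPolynomial Q A d P →
  (∀ i j → ZetaOperations.generating xyt-operations n (inT P) (geometric (RawRing.1# ℂ-rawRing))
             (geometric (fromℝ (Parameter.q Q))) (n ∸ toℕ d) i j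
    ℂ-Ring.≈ ZetaOperations.right-side xyt-operations n (fromℝ (Parameter.1/[q-1] Q)) A i j)
zeta-elim Q n A d P h = h

inT-coefficient : ∀ m (P : Polynomial≤ m) k → inT P (toℕ k) ≡ XY.scalar (P k)
inT-coefficient zero    P 0F          = ≡.refl
inT-coefficient (suc m) P Fin.zero    = ≡.refl
inT-coefficient (suc m) P (Fin.suc k) = inT-coefficient m (λ i → P (Fin.suc i)) k

zeta-polynomial-intro : ∀ Q n (A : Form n) d → HasLeadingIndex A d → 2 ℕ.≤ toℕ d → ∀ P → IsZetaPolynomial Q A d P →
  (∀ P′ → IsZetaPolynomial Q A d P′ → ∀ i → P′ i ℂ-Ring.≈ P i) → ZetaPolynomial Q A
zeta-polynomial-intro Q n A d leading 2≤d P zeta unique = d , leading , 2≤d , P , zeta , unique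

module Zeta (s : ℝ) (s²≃5 : s *ᵣ s ≃ 5ℝ) (Q : Parameter)
  (q≃ : Parameter.q Q ≃ embed s s²≃5 qₖ) (1/[q-1]≃ : Parameter.1/[q-1] Q ≃ embed s s²≃5 1/[q-1]ₖ)
  (n : ℕ) (d : Fin (suc n)) (N≤8 : n ∸ toℕ d ℕ.≤ 8) (h : Poly 3) (h≡ : h ≡ kernel n)
  (α : Fin (suc n) → K) (π : Fin (suc (n ∸ toℕ d)) → K) (check : zeta? n (n ∸ toℕ d) h α π ≡ true)
  (inv : Fin (suc (n ∸ toℕ d)) → K)
  (triangular : lower-triangular? (zeta-matrix n (n ∸ toℕ d) h) inv ≡ true)
  (A : Form n) (A≈ : ∀ i → A i ℂ-Ring.≈ fromℝ (embed s s²≃5 (α i))) where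

  private
    facts : ZetaFacts ℂ-rawRing (λ a → fromℝ (embed s s²≃5 a)) n (n ∸ toℕ d) α π xyt-operations (fromℝ (Parameter.q Q))
    facts = subst P pair (λ q q≈ n N N≤8 h h≡ α π check inv triangular ops agrees zops zagrees →
      zeta-facts (ℂ-algebra s s²≃5) q q≈ n N N≤8 h h≡ α π check inv triangular ops agrees zops zagrees)
      (fromℝ (Parameter.q Q)) (fromℝ-cong (Parameter.q Q) (embed s s²≃5 qₖ) q≃)
      n (n ∸ toℕ d) N≤8 h h≡ α π check inv triangular xy-operations xy-agrees xyt-operations xyt-agrees
      where
      P : (Σ[ R ∈ RawRing 0ℓ 0ℓ ] (K → RawRing.Carrier R)) → Set _
      P (R , ι) = ∀ q → q ≈ ι qₖ → ∀ n N → N ℕ.≤ 8 → (h : Poly 3) → h ≡ kernel n →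
        ∀ α π → zeta? n N h α π ≡ true → ∀ inv → lower-triangular? (zeta-matrix n N h) inv ≡ true →
        ∀ ops → Agrees R ops → (zops : ZetaOperations Carrier (ℕ → ℕ → Carrier)) → ZetaAgrees R ops zops →
        ZetaFacts R ι n N α π zops q
        where open RawRing R
      pair : (KAlgebra.rawRing (ℂ-algebra s s²≃5) , KAlgebra.ι (ℂ-algebra s s²≃5))
             ≡ (ℂ-rawRing , λ a → fromℝ (embed s s²≃5 a))
      pair = ≡.refl

    g₁≡ : ∀ k → geometric (RawRing.1# ℂ-rawRing) k ≡ ZetaOperations.scalar xyt-operations
      (RawSemiringOps._^_ (RawRing.rawSemiring ℂ-rawRing) (RawRing.1# ℂ-rawRing) k)
    g₁≡ k = ≡.refl

    g₂≡ : ∀ k → geometric (fromℝ (Parameter.q Q)) k ≡ ZetaOperations.scalar xyt-operations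
      (RawSemiringOps._^_ (RawRing.rawSemiring ℂ-rawRing) (fromℝ (Parameter.q Q)) k)
    g₂≡ k = ≡.refl

  polynomial : Polynomial≤ (n ∸ toℕ d)
  polynomial k = fromℝ (embed s s²≃5 (π k))

  isZeta : IsZetaPolynomial Q A d polynomial
  isZeta = zeta-intro Q n A d polynomial
    (ZetaFacts.identity facts polynomial A (fromℝ (Parameter.1/[q-1] Q)) (inT polynomial) (geometric (RawRing.1# ℂ-rawRing)) (geometric (fromℝ (Parameter.q Q)))
      (inT-coefficient (n ∸ toℕ d) polynomial) g₁≡ g₂≡
      (λ k → ℝR.refl {embed s s²≃5 (π k)} , ℝR.refl {0ℝ}) A≈
      (fromℝ-cong (Parameter.1/[q-1] Q) (embed s s²≃5 1/[q-1]ₖ) 1/[q-1]≃))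

  unique : ∀ P P′ → IsZetaPolynomial Q A d P → IsZetaPolynomial Q A d P′ → ∀ k → P k ℂ-Ring.≈ P′ k
  unique P P′ zeta zeta′ = ZetaFacts.unique facts P P′ (inT P) (inT P′) (geometric (RawRing.1# ℂ-rawRing)) (geometric (fromℝ (Parameter.q Q)))
    (ZetaOperations.right-side xyt-operations n (fromℝ (Parameter.1/[q-1] Q)) A)
    (inT-coefficient (n ∸ toℕ d) P) (inT-coefficient (n ∸ toℕ d) P′) g₁≡ g₂≡
    (zeta-elim Q n A d P zeta) (zeta-elim Q n A d P′ zeta′)

  zetaPolynomial : HasLeadingIndex A d → 2 ℕ.≤ toℕ d → ZetaPolynomial Q A
  zetaPolynomial leading 2≤d = zeta-polynomial-intro Q n A d leading 2≤d polynomial isZeta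
    (λ P′ zeta′ → unique P′ polynomial zeta′ isZeta)

-- One side is a sequence of rational reciprocals, the other an element of ℚ(√5); both are inverse
-- to q - 1, and inverses are unique.
1/[q-1]-embedded : ∀ s s²≃5 Q → Parameter.q Q -ᵣ 1ℝ ≃ embed s s²≃5 q-1ₖ →
  Parameter.1/[q-1] Q ≃ embed s s²≃5 1/[q-1]ₖ
1/[q-1]-embedded s s²≃5 Q q-1≃ = inverse-unique ℝ-commutativeRing {q -ᵣ 1ℝ} {1/[q-1]} {e 1/[q-1]ₖ}
  (1/ℝ-inverseʳ (q -ᵣ 1ℝ) (#⇒-#0 {q} {1ℝ} q#1))
  (≃-trans ((q -ᵣ 1ℝ) *ᵣ e 1/[q-1]ₖ) (e q-1ₖ *ᵣ e 1/[q-1]ₖ) 1ℝ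
    (*ᵣ-cong (q -ᵣ 1ℝ) (e q-1ₖ) (e 1/[q-1]ₖ) (e 1/[q-1]ₖ) q-1≃ (ℝR.refl {e 1/[q-1]ₖ}))
    (≃-trans (e q-1ₖ *ᵣ e 1/[q-1]ₖ) (e 1ₖ) 1ℝ
      (≃-trans (e q-1ₖ *ᵣ e 1/[q-1]ₖ) (e (q-1ₖ *ₖ 1/[q-1]ₖ)) (e 1ₖ)
        (≃-sym (e (q-1ₖ *ₖ 1/[q-1]ₖ)) (e q-1ₖ *ᵣ e 1/[q-1]ₖ) (embed-* s s²≃5 q-1ₖ 1/[q-1]ₖ))
        (LinearAlgebra.ι-≈ (ℝ-algebra s s²≃5) (q-1ₖ *ₖ 1/[q-1]ₖ) 1ₖ ≡.refl))
      (embed-rational s s²≃5 (+ 1) 0)))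
  where
  open Parameter Q
  e = embed s s²≃5

-- The solution of the triangular system. It obeys π(8-k) = -q^(4-k) π(k), a functional equation
-- with the sign of W^σ = -W; hence the zero in the middle.
πₖ : Fin 9 → K
πₖ 0F = ⟪ -ᶻ 1 , + 0 , 0 ⟫
πₖ 1F = ⟪ + 0 , + 84 , 1 ⟫
πₖ 2F = ⟪ + 420 , + 252 , 1 ⟫
πₖ 3F = ⟪ + 672 , + 336 , 1 ⟫
πₖ 4F = 0ₖ
πₖ 5F = ⟪ -ᶻ 423360 , -ᶻ 197568 , 2 ⟫
πₖ 6F = ⟪ -ᶻ 846720 , -ᶻ 395136 , 2 ⟫
πₖ 7F = ⟪ -ᶻ 451584 , -ᶻ 225792 , 2 ⟫
πₖ 8F = ⟪ + 1580544 , + 677376 , 2 ⟫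

-- The diagonal of the linear system consists of the binomials C(10,8), …, C(10,0).
inverse-binomials : Fin 9 → K
inverse-binomials 0F = ⟪ + 980 , + 0 , 2 ⟫
inverse-binomials 1F = ⟪ + 77175 , + 0 , 3 ⟫
inverse-binomials 2F = ⟪ + 1 , + 0 , 1 ⟫
inverse-binomials 3F = ⟪ + 175 , + 0 , 2 ⟫
inverse-binomials 4F = ⟪ + 1 , + 0 , 1 ⟫
inverse-binomials 5F = ⟪ + 77175 , + 0 , 3 ⟫
inverse-binomials 6F = ⟪ + 980 , + 0 , 2 ⟫
inverse-binomials 7F = ⟪ + 21 , + 0 , 1 ⟫
inverse-binomials 8F = 1ₖ

module _ (s : ℝ) (s²≃5 : s *ᵣ s ≃ 5ℝ) (Q : Parameter)
  (q≃ : Parameter.q Q ≃ embed s s²≃5 qₖ) (q-1≃ : Parameter.q Q -ᵣ 1ℝ ≃ embed s s²≃5 q-1ₖ) where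

  private
    module Z (h : Poly 3) (h≡ : h ≡ kernel 10) (check : zeta? 10 8 h φₖ πₖ ≡ true)
      (triangular : lower-triangular? (zeta-matrix 10 8 h) inverse-binomials ≡ true) =
      Zeta s s²≃5 Q q≃ (1/[q-1]-embedded s s²≃5 Q q-1≃) 10 2F ℕ.≤-refl h h≡ φₖ πₖ check
        inverse-binomials triangular (φ₁₀ s) (φ₁₀-coefficients s s²≃5)

  φ₁₀-zeta : Polynomial≤ 8
  φ₁₀-zeta k = fromℝ (embed s s²≃5 (πₖ k))

  φ₁₀-isZeta : IsZetaPolynomial Q (φ₁₀ s) 2F φ₁₀-zeta
  -- The last two `≡.refl` are computations: that `πₖ` solves the defining equation, and that the
  -- linear system is triangular.
  φ₁₀-isZeta = Z.isZeta (kernel 10) ≡.refl ≡.refl ≡.refl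

  φ₁₀-zeta-unique : ∀ P P′ → IsZetaPolynomial Q (φ₁₀ s) 2F P → IsZetaPolynomial Q (φ₁₀ s) 2F P′ →
    ∀ k → P k ℂ-Ring.≈ P′ k
  φ₁₀-zeta-unique = Z.unique (kernel 10) ≡.refl ≡.refl ≡.refl

  φ₁₀-zetaPolynomial : ZetaPolynomial Q (φ₁₀ s)
  φ₁₀-zetaPolynomial = Z.zetaPolynomial (kernel 10) ≡.refl ≡.refl ≡.refl
    (φ₁₀-leading s s²≃5) ℕ.≤-refl

-- Real and imaginary parts of polynomial expressions

multiply-split : ∀ {n} → Expr n × Expr n → Expr n × Expr n → Expr n × Expr n
multiply-split (a , b) (c , d) = a `* c `- b `* d , a `* d `+ b `* c

power-split : ∀ {n} → Expr n × Expr n → ℕ → Expr n × Expr n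
power-split x zero    = con 1ₖ , con 0ₖ
power-split x (suc k) = multiply-split x (power-split x k)

-- Real and imaginary part, as polynomials in im z and re z (in this order).
split : Expr 1 → Expr 2 × Expr 2
split (con a)  = con a , con 0ₖ
split (var 0F) = var 1F , var 0F
split (e `+ f) = proj₁ (split e) `+ proj₁ (split f) , proj₂ (split e) `+ proj₂ (split f)
split (e `* f) = multiply-split (split e) (split f)
split (`- e)   = `- proj₁ (split e) , `- proj₂ (split e)
split (e `^ k) = power-split (split e) k

module Splitting (s : ℝ) (s²≃5 : s *ᵣ s ≃ 5ℝ) where
  private
    module ℂE = Evaluation (ℂ-algebra s s²≃5)
    module ℝE = Evaluation (ℝ-algebra s s²≃5)
    e = embed s s²≃5

  Splits : ℂ → ℂ → Expr 2 × Expr 2 → Set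
  Splits z w (p , r) = re w ≃ ℝE.⟦ p ⟧ₑ (im z ∷ re z ∷ []) × im w ≃ ℝE.⟦ r ⟧ₑ (im z ∷ re z ∷ [])

  -- `multiply-split` copies the multiplication of `ℂ-rawRing`, so this is merely congruence of that
  -- multiplication.
  splits-* : ∀ z w w′ x x′ → Splits z w x → Splits z w′ x′ → Splits z (w ℂ-Ring.* w′) (multiply-split x x′)
  splits-* z w w′ (p , r) (p′ , r′) (w≃p , w≃r) (w′≃p′ , w′≃r′) =
    ℂ-*-cong w (ℝE.⟦ p ⟧ₑ ρ +i ℝE.⟦ r ⟧ₑ ρ) w′ (ℝE.⟦ p′ ⟧ₑ ρ +i ℝE.⟦ r′ ⟧ₑ ρ) (w≃p , w≃r) (w′≃p′ , w′≃r′)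
    where ρ = im z ∷ re z ∷ []

  splits-^ : ∀ z w x k → Splits z w x → Splits z (w ℂ-Ring.^ k) (power-split x k)
  splits-^ z w x zero    h = ≃-sym (e 1ₖ) 1ℝ (embed-rational s s²≃5 (+ 1) 0) , ≃-sym (e 0ₖ) 0ℝ (embed-0 s s²≃5 0ₖ ≡.refl)
  splits-^ z w x (suc k) h = splits-* z w (w ℂ-Ring.^ k) x (power-split x k) h (splits-^ z w x k h)

  split-correct : ∀ f z → Splits z (ℂE.⟦ f ⟧ₑ (z ∷ [])) (split f)
  split-correct (con a)  z = ℝR.refl {e a} , ≃-sym (e 0ₖ) 0ℝ (embed-0 s s²≃5 0ₖ ≡.refl)
  split-correct (var 0F) z = ℝR.refl {re z} , ℝR.refl {im z}
  split-correct (f `+ g) z =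
    ℂ-+-cong (ℂE.⟦ f ⟧ₑ (z ∷ [])) (ℝE.⟦ proj₁ (split f) ⟧ₑ ρ +i ℝE.⟦ proj₂ (split f) ⟧ₑ ρ)
      (ℂE.⟦ g ⟧ₑ (z ∷ [])) (ℝE.⟦ proj₁ (split g) ⟧ₑ ρ +i ℝE.⟦ proj₂ (split g) ⟧ₑ ρ)
      (split-correct f z) (split-correct g z)
    where ρ = im z ∷ re z ∷ []
  split-correct (f `* g) z =
    splits-* z (ℂE.⟦ f ⟧ₑ (z ∷ [])) (ℂE.⟦ g ⟧ₑ (z ∷ [])) (split f) (split g) (split-correct f z) (split-correct g z)
  split-correct (`- f)   z = let p , r = split-correct f z in
    -ᵣ-cong (re (ℂE.⟦ f ⟧ₑ (z ∷ []))) (ℝE.⟦ proj₁ (split f) ⟧ₑ (im z ∷ re z ∷ [])) p ,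
    -ᵣ-cong (im (ℂE.⟦ f ⟧ₑ (z ∷ []))) (ℝE.⟦ proj₂ (split f) ⟧ₑ (im z ∷ re z ∷ [])) r
  split-correct (f `^ k) z = splits-^ z (ℂE.⟦ f ⟧ₑ (z ∷ [])) (split f) k (split-correct f z)

-- Zeros of the zeta polynomial

-- With U = qz² + 1 and Z = qz, the zeta polynomial is a multiple of (1 - qz²) C(U, Z) for the binary
-- cubic C: the functional equation pairs z with 1/(qz), and U/Z = z + 1/(qz).
cubic cubic-derivative : ∀ {n} → Expr n → Expr n → Expr n
cubic u z = con ⟪ + 16 , + 0 , 0 ⟫ `* u `^ 3 `+ con ⟪ + 4 , -ᶻ 4 , 0 ⟫ `* (u `^ 2 `* z)
  `+ con ⟪ -ᶻ 20 , + 0 , 0 ⟫ `* (u `* z `^ 2) `+ con ⟪ -ᶻ 5 , + 1 , 0 ⟫ `* z `^ 3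
cubic-derivative u z = con ⟪ + 48 , + 0 , 0 ⟫ `* u `^ 2 `+ con ⟪ + 8 , -ᶻ 8 , 0 ⟫ `* (u `* z)
  `+ con ⟪ -ᶻ 20 , + 0 , 0 ⟫ `* z `^ 2

U Z sextic : Expr 1
U = con qₖ `* var 0F `^ 2 `+ con 1ₖ
Z = con qₖ `* var 0F
sextic = cubic U Z

zetaₑ : Expr 1
zetaₑ = sumₑ λ k → con (πₖ k) `* var 0F `^ toℕ k

w₁ : Expr 1
w₁ = con 1ₖ `- con qₖ `* var 0F `^ 2

-- With S = C(U, Z), Im (S · conj (Z ∂S/∂U)) is Im (U conj Z) times the Bezoutian form of C and ∂C/∂U,
-- and Im (U conj Z) = q (q|z|² - 1) Im z. The forms l₁, l₂ and z² diagonalise the Bezoutian.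
l₁ l₂ : Expr 1
l₁ = con ⟪ + 12 , + 0 , 0 ⟫ `* U `^ 2 `+ con ⟪ + 2 , -ᶻ 2 , 0 ⟫ `* (U `* Z) `+ con ⟪ -ᶻ 5 , + 0 , 0 ⟫ `* Z `^ 2
l₂ = con ⟪ + 1084 , + 0 , 0 ⟫ `* (U `* Z) `+ con ⟪ + 325 , -ᶻ 23 , 0 ⟫ `* Z `^ 2

norm² : Expr 2 × Expr 2 → Expr 2
norm² (a , b) = a `* a `+ b `* b

-- The pivots of completing squares. The second is a multiple of 33 - √5, whose norm is 33² - 5 =
-- 1084 = 4 · 271: dividing by it brings 1084 into `l₂`, and clearing denominators multiplies the
-- whole form by 220323 = 3 · 271². The q⁴ in `d₃` comes from Z² = q²z².
d₁ d₂ d₃ : K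
d₁ = ⟪ + 1175056 , + 0 , 0 ⟫
d₂ = ⟪ + 132 , -ᶻ 4 , 0 ⟫
d₃ = ⟪ + (813 ℕ.* 76000) , -ᶻ (813 ℕ.* 10048) , 0 ⟫ *ₖ (qₖ *ₖ qₖ *ₖ (qₖ *ₖ qₖ))

bezoutian : Expr 2
bezoutian = con d₁ `* norm² (split l₁) `+ (con d₂ `* norm² (split l₂)
  `+ con d₃ `* (norm² (split (var 0F)) `* norm² (split (var 0F))))

circle : Expr 2
circle = con qₖ `* norm² (split (var 0F)) `- con 1ₖ

-- |1 - qz²|² |C(U, Z)|² = 256 |P(z)|².
zeta-norm? : Identity (norm² (split w₁) `* norm² (split sextic)) (con ⟪ + 256 , + 0 , 0 ⟫ `* norm² (split zetaₑ))
zeta-norm? = ≡.refl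

bezout-left bezout-right : Expr 2
bezout-left = con ⟪ + 220323 , + 0 , 0 ⟫ `*
  (proj₂ (split sextic) `* proj₁ (split (Z `* cubic-derivative U Z))
   `- proj₁ (split sextic) `* proj₂ (split (Z `* cubic-derivative U Z)))
bezout-right = circle `* (var 0F `* (con qₖ `* bezoutian))

bezout? : Identity bezout-left bezout-right
bezout? = ≡.refl

-- The imaginary part of z is the outermost variable, so restricting to the real line means taking
-- the coefficient at index 0.
real-sextic? : SamePoly 1 (coefficientOf (normalise (proj₁ (split sextic))) 0) (normalise sextic)
real-sextic? = ≡.refl

-- On the real line C(U, Z) C(U, -Z) is a combination of the squares of z^(3-k) (qz² - 1)^k with
-- weights that are positive for √5 ↦ -√5.
qa²-1 : Expr 1
qa²-1 = con qₖ `* (var 0F `* var 0F) `- con 1ₖ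

e₀ e₁ e₂ e₃ : K
e₀ = ⟪ + 1770 , -ᶻ 830 , 0 ⟫ *ₖ (qₖ *ₖ qₖ *ₖ (qₖ *ₖ qₖ) *ₖ (qₖ *ₖ qₖ))
e₁ = ⟪ + 2170 , -ᶻ 970 , 0 ⟫ *ₖ (qₖ *ₖ qₖ *ₖ (qₖ *ₖ qₖ) *ₖ qₖ)
e₂ = ⟪ + 830 , -ᶻ 350 , 0 ⟫ *ₖ (qₖ *ₖ qₖ *ₖ (qₖ *ₖ qₖ))
e₃ = ⟪ + 100 , -ᶻ 40 , 0 ⟫ *ₖ (qₖ *ₖ qₖ *ₖ qₖ)

m₀ m₁ m₂ m₃ : Expr 1
m₀ = var 0F `^ 3
m₁ = var 0F `^ 2 `* qa²-1
m₂ = var 0F `* qa²-1 `^ 2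
m₃ = qa²-1 `* (qa²-1 `* qa²-1)

real-squares : Expr 1
real-squares = con e₃ `* (m₃ `* m₃) `+ (con e₂ `* (m₂ `* m₂) `+ (con e₁ `* (m₁ `* m₁) `+ con e₀ `* (m₀ `* m₀)))

-- C(U, Z) C(U, -Z) is a polynomial in U² and Z². Substituting U² = (qz² - 1)² + 4qz² and Z² = q²z²
-- rewrites it in (qz² - 1)² and z². All weights are positive for -√5 because there every root t of
-- C(t, 1) has t² < 4/q.
real-squares? : Identity (sextic `* cubic U (`- Z)) real-squares
real-squares? = ≡.refl

-- Positivity, and zeros on the circle for q⁻

-- The fixed bound 1 serves because every constant whose positivity is used exceeds 1 at -√5.
Positive : ℝ → Set
Positive x = ∃[ N ] (∀ n → N ℕ.≤ n → 1ℚ ℚ.≤ seq x n)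

positive⇒nonNeg : ∀ x → Positive x → EventuallyNonNeg x
positive⇒nonNeg x (N , h) = N , λ n N≤n → ℚ.≤-trans (ℚ.nonNegative⁻¹ 1ℚ) (h n N≤n)

positive⇒≄0 : ∀ x → Positive x → ¬ (x ≃ 0ℝ)
positive⇒≄0 x (N , h) = #⇒¬≃ x 0ℝ (1ℚ , ℚ.positive⁻¹ 1ℚ , N , λ n N≤n →
  ℚ.≤-trans (h n N≤n) (ℚ.≤-trans (p≤∣p∣ (seq x n))
    (ℚ.≤-reflexive (cong ℚ.∣_∣ (≡.sym (ℚ.+-identityʳ (seq x n)))))))

-- An affine function is monotone, so a lower bound at both ends of an interval holds in between;
-- the sign of the slope tells which end to compare with.
affine-lower : ∀ x y lo hi t → 1ℚ ℚ.≤ x ℚ.+ y ℚ.* lo → 1ℚ ℚ.≤ x ℚ.+ y ℚ.* hi →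
  lo ℚ.≤ t → t ℚ.≤ hi → 1ℚ ℚ.≤ x ℚ.+ y ℚ.* t
affine-lower x y lo hi t at-lo at-hi lo≤t t≤hi with ℚ.≤-total 0ℚ y
... | inj₁ 0≤y = ℚ.≤-trans at-lo (ℚ.+-monoʳ-≤ x (ℚ.*-monoˡ-≤-nonNeg y {{ℚ.nonNegative 0≤y}} lo≤t))
... | inj₂ y≤0 = ℚ.≤-trans at-hi (ℚ.+-monoʳ-≤ x (ℚ.*-monoˡ-≤-nonPos y {{ℚ.nonPositive y≤0}} t≤hi))

Between : ℚ → ℚ → ℝ → Set
Between lo hi s = ∃[ N ] (∀ n → N ℕ.≤ n → lo ℚ.≤ seq s n × seq s n ℚ.≤ hi)

embed-positive : ∀ s s²≃5 lo hi → Between lo hi s → ∀ a b k →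
  1ℚ ℚ.≤ rat a k ℚ.+ rat b k ℚ.* lo → 1ℚ ℚ.≤ rat a k ℚ.+ rat b k ℚ.* hi → Positive (embed s s²≃5 ⟪ a , b , k ⟫)
embed-positive s s²≃5 lo hi (N , h) a b k at-lo at-hi = N , λ n N≤n →
  affine-lower (rat a k) (rat b k) lo hi (seq s n) at-lo at-hi (proj₁ (h n N≤n)) (proj₂ (h n N≤n))

*-zeroˡ : ∀ x y → x ≃ 0ℝ → x *ᵣ y ≃ 0ℝ
*-zeroˡ x y x≃0 = ≃-trans (x *ᵣ y) (0ℝ *ᵣ y) 0ℝ (*ᵣ-cong x 0ℝ y y x≃0 (ℝR.refl {y})) (ℝR.zeroˡ y)

*-zeroʳ : ∀ x y → y ≃ 0ℝ → x *ᵣ y ≃ 0ℝ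
*-zeroʳ x y y≃0 = ≃-trans (x *ᵣ y) (x *ᵣ 0ℝ) 0ℝ (*ᵣ-cong x x y 0ℝ (ℝR.refl {x}) y≃0) (ℝR.zeroʳ x)

+-zero : ∀ x y → x ≃ 0ℝ → y ≃ 0ℝ → x +ᵣ y ≃ 0ℝ
+-zero x y x≃0 y≃0 = ≃-trans (x +ᵣ y) (0ℝ +ᵣ 0ℝ) 0ℝ (+ᵣ-cong x 0ℝ y 0ℝ x≃0 y≃0) (ℝR.+-identityˡ 0ℝ)

neg-zero : ∀ x → x ≃ 0ℝ → -ᵣ x ≃ 0ℝ
neg-zero x x≃0 = ≃-trans (-ᵣ x) (-ᵣ 0ℝ) 0ℝ (-ᵣ-cong x 0ℝ x≃0) (≃-pointwise (-ᵣ 0ℝ) 0ℝ λ _ → ≡.refl)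

cube≃0⇒≃0 : ∀ w → w *ᵣ (w *ᵣ w) ≃ 0ℝ → w ≃ 0ℝ
cube≃0⇒≃0 w h = ≃-stable w 0ℝ λ w≄0 → w≄0 (square≃0⇒≃0 w (*ᵣ-cancel-zero w (w *ᵣ w) h w≄0))

scaled-square≃0 : ∀ c x → Positive c → c *ᵣ (x *ᵣ x) ≃ 0ℝ → x ≃ 0ℝ
scaled-square≃0 c x 0<c h = square≃0⇒≃0 x (*ᵣ-cancel-zero c (x *ᵣ x) h (positive⇒≄0 c 0<c))

nonNeg-scaled : ∀ c x → Positive c → EventuallyNonNeg x → EventuallyNonNeg (c *ᵣ x)
nonNeg-scaled c x 0<c = nonNeg-* c x (positive⇒nonNeg c 0<c)

module _ {c ℓ} (A : KAlgebra c ℓ) where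
  open KAlgebra A
  open Evaluation A

  horner-at-zero : ∀ {n} (p : Poly (suc n)) t ρ → t ≈ 0# → eval p (t ∷ ρ) ≈ eval (coefficientOf p 0) ρ
  horner-at-zero []       t ρ t≈0 = sym (eval-0 ρ)
  horner-at-zero (p ∷ ps) t ρ t≈0 =
    trans (+-congˡ (trans (*-congʳ t≈0) (zeroˡ (eval ps (t ∷ ρ))))) (+-identityʳ (eval p ρ))

  restrict : ∀ {n} (f : Expr (suc n)) (g : Expr n) → SamePoly n (coefficientOf (normalise f) 0) (normalise g) →
    ∀ t ρ → t ≈ 0# → ⟦ f ⟧ₑ (t ∷ ρ) ≈ ⟦ g ⟧ₑ ρ
  restrict f g same t ρ t≈0 = trans (sym (normalise-correct f (t ∷ ρ)))
    (trans (horner-at-zero (normalise f) t ρ t≈0)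
      (trans (eval-≈ (coefficientOf (normalise f) 0) (normalise g) ρ same) (normalise-correct g ρ)))

module Norms (s : ℝ) (s²≃5 : s *ᵣ s ≃ 5ℝ) (ρ : Vec ℝ 2) where

  open Evaluation (ℝ-algebra s s²≃5)

  nonNeg-norm² : ∀ x → EventuallyNonNeg (⟦ norm² x ⟧ₑ ρ)
  nonNeg-norm² (p , r) = nonNeg-+ (⟦ p ⟧ₑ ρ *ᵣ ⟦ p ⟧ₑ ρ) (⟦ r ⟧ₑ ρ *ᵣ ⟦ r ⟧ₑ ρ)
    (nonNeg-square (⟦ p ⟧ₑ ρ)) (nonNeg-square (⟦ r ⟧ₑ ρ))

  norm²≃0 : ∀ x → ⟦ norm² x ⟧ₑ ρ ≃ 0ℝ → ⟦ proj₁ x ⟧ₑ ρ ≃ 0ℝ × ⟦ proj₂ x ⟧ₑ ρ ≃ 0ℝ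
  norm²≃0 (p , r) h =
    square≃0⇒≃0 (⟦ p ⟧ₑ ρ) (nonNeg-sum≃0ˡ (⟦ p ⟧ₑ ρ *ᵣ ⟦ p ⟧ₑ ρ) (⟦ r ⟧ₑ ρ *ᵣ ⟦ r ⟧ₑ ρ)
      (nonNeg-square (⟦ p ⟧ₑ ρ)) (nonNeg-square (⟦ r ⟧ₑ ρ)) h) ,
    square≃0⇒≃0 (⟦ r ⟧ₑ ρ) (nonNeg-sum≃0ʳ (⟦ p ⟧ₑ ρ *ᵣ ⟦ p ⟧ₑ ρ) (⟦ r ⟧ₑ ρ *ᵣ ⟦ r ⟧ₑ ρ)
      (nonNeg-square (⟦ p ⟧ₑ ρ)) (nonNeg-square (⟦ r ⟧ₑ ρ)) h)

module Circle (s : ℝ) (s²≃5 : s *ᵣ s ≃ 5ℝ) (0<q : Positive (embed s s²≃5 qₖ))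
  (0<d₁ : Positive (embed s s²≃5 d₁)) (0<d₂ : Positive (embed s s²≃5 d₂)) (0<d₃ : Positive (embed s s²≃5 d₃))
  (0<e₀ : Positive (embed s s²≃5 e₀)) (0<e₁ : Positive (embed s s²≃5 e₁))
  (0<e₂ : Positive (embed s s²≃5 e₂)) (0<e₃ : Positive (embed s s²≃5 e₃))
  (a b : ℝ) where

  private
    e : K → ℝ
    e = embed s s²≃5

  open Evaluation (ℝ-algebra s s²≃5)

  ρ : Vec ℝ 2
  ρ = b ∷ a ∷ []

  open Norms s s²≃5 ρ

  private
    n₁ n₂ n₃ : ℝ
    n₁ = ⟦ norm² (split l₁) ⟧ₑ ρ
    n₂ = ⟦ norm² (split l₂) ⟧ₑ ρ
    n₃ = ⟦ norm² (split (var 0F)) ⟧ₑ ρ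

  -- All three terms are nonnegative, so the last one vanishes. It is d₃|z|⁴ with d₃ positive, which
  -- leaves only z = 0.
  bezoutian≃0⇒b≃0 : ⟦ bezoutian ⟧ₑ ρ ≃ 0ℝ → b ≃ 0ℝ
  bezoutian≃0⇒b≃0 h = proj₂ (norm²≃0 (var 1F , var 0F) (scaled-square≃0 (e d₃) n₃ 0<d₃
    (nonNeg-sum≃0ʳ (e d₂ *ᵣ n₂) (e d₃ *ᵣ (n₃ *ᵣ n₃))
      (nonNeg-scaled (e d₂) n₂ 0<d₂ (nonNeg-norm² (split l₂)))
      (nonNeg-scaled (e d₃) (n₃ *ᵣ n₃) 0<d₃ (nonNeg-square n₃))
      (nonNeg-sum≃0ʳ (e d₁ *ᵣ n₁) (e d₂ *ᵣ n₂ +ᵣ e d₃ *ᵣ (n₃ *ᵣ n₃))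
        (nonNeg-scaled (e d₁) n₁ 0<d₁ (nonNeg-norm² (split l₁)))
        (nonNeg-+ (e d₂ *ᵣ n₂) (e d₃ *ᵣ (n₃ *ᵣ n₃))
          (nonNeg-scaled (e d₂) n₂ 0<d₂ (nonNeg-norm² (split l₂)))
          (nonNeg-scaled (e d₃) (n₃ *ᵣ n₃) 0<d₃ (nonNeg-square n₃)))
        h))))

  private
    f₀ f₁ f₂ f₃ w : ℝ
    f₀ = ⟦ m₀ ⟧ₑ (a ∷ [])
    f₁ = ⟦ m₁ ⟧ₑ (a ∷ [])
    f₂ = ⟦ m₂ ⟧ₑ (a ∷ [])
    f₃ = ⟦ m₃ ⟧ₑ (a ∷ [])
    w  = ⟦ qa²-1 ⟧ₑ (a ∷ [])

  -- A zero annihilates the weighted sum of squares and with it the summand e₃ (qa² - 1)⁶. Thus even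
  -- a real zero would have to lie on the circle.
  real-root : ⟦ sextic ⟧ₑ (a ∷ []) ≃ 0ℝ → w ≃ 0ℝ
  real-root h = cube≃0⇒≃0 w (scaled-square≃0 (e e₃) f₃ 0<e₃
    (nonNeg-sum≃0ˡ (e e₃ *ᵣ (f₃ *ᵣ f₃)) (e e₂ *ᵣ (f₂ *ᵣ f₂) +ᵣ (e e₁ *ᵣ (f₁ *ᵣ f₁) +ᵣ e e₀ *ᵣ (f₀ *ᵣ f₀)))
      (square e₃ 0<e₃ f₃)
      (nonNeg-+ (e e₂ *ᵣ (f₂ *ᵣ f₂)) (e e₁ *ᵣ (f₁ *ᵣ f₁) +ᵣ e e₀ *ᵣ (f₀ *ᵣ f₀)) (square e₂ 0<e₂ f₂)
        (nonNeg-+ (e e₁ *ᵣ (f₁ *ᵣ f₁)) (e e₀ *ᵣ (f₀ *ᵣ f₀)) (square e₁ 0<e₁ f₁) (square e₀ 0<e₀ f₀)))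
      (≃-trans (⟦ real-squares ⟧ₑ (a ∷ [])) (⟦ sextic `* cubic U (`- Z) ⟧ₑ (a ∷ [])) 0ℝ
        (≃-sym (⟦ sextic `* cubic U (`- Z) ⟧ₑ (a ∷ [])) (⟦ real-squares ⟧ₑ (a ∷ []))
          (by-normalisation (sextic `* cubic U (`- Z)) real-squares (a ∷ []) real-squares?))
        (*-zeroˡ (⟦ sextic ⟧ₑ (a ∷ [])) (⟦ cubic U (`- Z) ⟧ₑ (a ∷ [])) h))))
    where
    square : ∀ k → Positive (e k) → ∀ x → EventuallyNonNeg (e k *ᵣ (x *ᵣ x))
    square k 0<k x = nonNeg-scaled (e k) (x *ᵣ x) 0<k (nonNeg-square x)

  private
    R I W₁ W₂ : ℝ
    R  = ⟦ proj₁ (split sextic) ⟧ₑ ρ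
    I  = ⟦ proj₂ (split sextic) ⟧ₑ ρ
    W₁ = ⟦ proj₁ (split (Z `* cubic-derivative U Z)) ⟧ₑ ρ
    W₂ = ⟦ proj₂ (split (Z `* cubic-derivative U Z)) ⟧ₑ ρ
    β  = ⟦ bezoutian ⟧ₑ ρ

  b≃0⇒real : b ≃ 0ℝ → R ≃ 0ℝ → ⟦ sextic ⟧ₑ (a ∷ []) ≃ 0ℝ
  b≃0⇒real b≃0 R≃0 = ≃-trans (⟦ sextic ⟧ₑ (a ∷ [])) R 0ℝ
    (≃-sym R (⟦ sextic ⟧ₑ (a ∷ []))
      (restrict (ℝ-algebra s s²≃5) (proj₁ (split sextic)) sextic real-sextic? b (a ∷ []) b≃0)) R≃0

  circle-real : Expr 2
  circle-real = (con qₖ `* (var 1F `* var 1F) `- con 1ₖ) `+ var 0F `* (con qₖ `* var 0F)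

  -- Off the circle, the Bezout identity leaves the product of b, q and the Bezoutian equal to zero.
  -- Were b nonzero, the Bezoutian would vanish and force b = 0 after all. So z is real, and
  -- `real-root` puts it back on the circle.
  on-circle : R ≃ 0ℝ → I ≃ 0ℝ → ⟦ circle ⟧ₑ ρ ≃ 0ℝ
  on-circle R≃0 I≃0 = ≃-stable (⟦ circle ⟧ₑ ρ) 0ℝ λ c≄0 →
    let h₁ = ≃-trans (⟦ bezout-right ⟧ₑ ρ) (⟦ bezout-left ⟧ₑ ρ) 0ℝ
               (≃-sym (⟦ bezout-left ⟧ₑ ρ) (⟦ bezout-right ⟧ₑ ρ) (by-normalisation bezout-left bezout-right ρ bezout?))
               (*-zeroʳ (e ⟪ + 220323 , + 0 , 0 ⟫) (I *ᵣ W₁ -ᵣ R *ᵣ W₂)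
                 (+-zero (I *ᵣ W₁) (-ᵣ (R *ᵣ W₂)) (*-zeroˡ I W₁ I≃0) (neg-zero (R *ᵣ W₂) (*-zeroˡ R W₂ R≃0))))
        h₂ = *ᵣ-cancel-zero (⟦ circle ⟧ₑ ρ) (b *ᵣ (e qₖ *ᵣ β)) h₁ c≄0
        b≃0 = ≃-stable b 0ℝ λ b≄0 → b≄0 (bezoutian≃0⇒b≃0
                (*ᵣ-cancel-zero (e qₖ) β (*ᵣ-cancel-zero b (e qₖ *ᵣ β) h₂ b≄0) (positive⇒≄0 (e qₖ) 0<q)))
    in c≄0 (≃-trans (⟦ circle ⟧ₑ ρ) (⟦ circle-real ⟧ₑ ρ) 0ℝ
         (by-normalisation circle circle-real ρ ≡.refl)
         (+-zero w (b *ᵣ (e qₖ *ᵣ b)) (real-root (b≃0⇒real b≃0 R≃0)) (*-zeroˡ b (e qₖ *ᵣ b) b≃0)))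

  private
    qN+1 : Expr 2
    qN+1 = con qₖ `* norm² (split (var 0F)) `+ con 1ₖ

    -- This is |w - 1|² - 1 for w = 1 - qz², that is, (q|z|² + 1)(q|z|² - 1).
    w₁-circle : Expr 2
    w₁-circle = proj₁ (split w₁) `* (proj₁ (split w₁) `- con ⟪ + 2 , + 0 , 0 ⟫)
      `+ proj₂ (split w₁) `* proj₂ (split w₁)

  w₁≃0⇒circle : ⟦ proj₁ (split w₁) ⟧ₑ ρ ≃ 0ℝ → ⟦ proj₂ (split w₁) ⟧ₑ ρ ≃ 0ℝ → ⟦ circle ⟧ₑ ρ ≃ 0ℝ
  w₁≃0⇒circle r≃0 i≃0 = *ᵣ-cancel-zero (⟦ qN+1 ⟧ₑ ρ) (⟦ circle ⟧ₑ ρ)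
    (≃-trans (⟦ qN+1 `* circle ⟧ₑ ρ) (⟦ w₁-circle ⟧ₑ ρ) 0ℝ
      (by-normalisation (qN+1 `* circle) w₁-circle ρ ≡.refl)
      (+-zero (⟦ proj₁ (split w₁) ⟧ₑ ρ *ᵣ ⟦ proj₁ (split w₁) `- con ⟪ + 2 , + 0 , 0 ⟫ ⟧ₑ ρ)
        (⟦ proj₂ (split w₁) ⟧ₑ ρ *ᵣ ⟦ proj₂ (split w₁) ⟧ₑ ρ)
        (*-zeroˡ (⟦ proj₁ (split w₁) ⟧ₑ ρ) (⟦ proj₁ (split w₁) `- con ⟪ + 2 , + 0 , 0 ⟫ ⟧ₑ ρ) r≃0)
        (*-zeroˡ (⟦ proj₂ (split w₁) ⟧ₑ ρ) (⟦ proj₂ (split w₁) ⟧ₑ ρ) i≃0)))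
    λ qN+1≃0 → 1ℝ≄0ℝ (≃-trans 1ℝ (e 1ₖ) 0ℝ (≃-sym (e 1ₖ) 1ℝ (embed-rational s s²≃5 (+ 1) 0))
      (nonNeg-sum≃0ʳ (e qₖ *ᵣ n₃) (e 1ₖ) (nonNeg-scaled (e qₖ) n₃ 0<q (nonNeg-norm² (split (var 0F))))
        (0 , λ n _ → ℚ.≤-trans (ℚ.nonNegative⁻¹ 1ℚ) (ℚ.≤-reflexive (≡.sym
          (≡.trans (cong (1ℚ ℚ.+_) (ℚ.*-zeroˡ (seq s n))) (ℚ.+-identityʳ 1ℚ))))) qN+1≃0))

  -- The norm identity makes a product of two norms vanish without telling which one does. Assuming
  -- z off the circle excludes both.
  zeta-zero-on-circle : ⟦ proj₁ (split zetaₑ) ⟧ₑ ρ ≃ 0ℝ → ⟦ proj₂ (split zetaₑ) ⟧ₑ ρ ≃ 0ℝ → ⟦ circle ⟧ₑ ρ ≃ 0ℝ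
  zeta-zero-on-circle r≃0 i≃0 = ≃-stable (⟦ circle ⟧ₑ ρ) 0ℝ λ c≄0 →
    let sextic≄0 = λ h → c≄0 (on-circle (proj₁ (norm²≃0 (split sextic) h)) (proj₂ (norm²≃0 (split sextic) h)))
        N₁ = ⟦ norm² (split w₁) ⟧ₑ ρ
        N₂ = ⟦ norm² (split sextic) ⟧ₑ ρ
        w₁≃0 = ≃-stable N₁ 0ℝ λ N₁≄0 → sextic≄0 (*ᵣ-cancel-zero N₁ N₂ product N₁≄0)
    in c≄0 (w₁≃0⇒circle (proj₁ (norm²≃0 (split w₁) w₁≃0)) (proj₂ (norm²≃0 (split w₁) w₁≃0)))
    where
    z₁ = ⟦ proj₁ (split zetaₑ) ⟧ₑ ρ
    z₂ = ⟦ proj₂ (split zetaₑ) ⟧ₑ ρ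
    product : ⟦ norm² (split w₁) `* norm² (split sextic) ⟧ₑ ρ ≃ 0ℝ
    product = ≃-trans (⟦ norm² (split w₁) `* norm² (split sextic) ⟧ₑ ρ)
      (⟦ con ⟪ + 256 , + 0 , 0 ⟫ `* norm² (split zetaₑ) ⟧ₑ ρ) 0ℝ
      (by-normalisation (norm² (split w₁) `* norm² (split sextic))
        (con ⟪ + 256 , + 0 , 0 ⟫ `* norm² (split zetaₑ)) ρ zeta-norm?)
      (*-zeroʳ (e ⟪ + 256 , + 0 , 0 ⟫) (z₁ *ᵣ z₁ +ᵣ z₂ *ᵣ z₂)
        (+-zero (z₁ *ᵣ z₁) (z₂ *ᵣ z₂) (*-zeroˡ z₁ z₁ r≃0) (*-zeroˡ z₂ z₂ i≃0)))

-- Shaped like `split` applied to `sumₑ`, so that at `πₖ` it is definitionally `split zetaₑ`.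
sum-split : ∀ {k} → (Fin k → Expr 2 × Expr 2) → Expr 2 × Expr 2
sum-split {zero}  f = con 0ₖ , con 0ₖ
sum-split {suc k} f = proj₁ (f Fin.zero) `+ proj₁ (sum-split (λ i → f (Fin.suc i))) ,
                      proj₂ (f Fin.zero) `+ proj₂ (sum-split (λ i → f (Fin.suc i)))

evaluate-unfold : ∀ m (P : Polynomial≤ m) z → evaluate P z ≡
  RawSemiringOps.sum (RawRing.rawSemiring ℂ-rawRing)
    (λ i → RawRing._*_ ℂ-rawRing (P i) (RawSemiringOps._^_ (RawRing.rawSemiring ℂ-rawRing) z (toℕ i)))
evaluate-unfold m P z = ≡.refl

module EvaluateSplits (s : ℝ) (s²≃5 : s *ᵣ s ≃ 5ℝ) where
  open Splitting s s²≃5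

  splits-sum : ∀ k z (w : Fin k → ℂ) x → (∀ i → Splits z (w i) (x i)) →
    Splits z (RawSemiringOps.sum (RawRing.rawSemiring ℂ-rawRing) w) (sum-split x)
  splits-sum zero    z w x h = ≃-sym (embed s s²≃5 0ₖ) 0ℝ (embed-0 s s²≃5 0ₖ ≡.refl) ,
                               ≃-sym (embed s s²≃5 0ₖ) 0ℝ (embed-0 s s²≃5 0ₖ ≡.refl)
  splits-sum (suc k) z w x h =
    ℂ-+-cong (w Fin.zero) (⟦ proj₁ (x Fin.zero) ⟧ₑ ρ +i ⟦ proj₂ (x Fin.zero) ⟧ₑ ρ)
      (RawSemiringOps.sum (RawRing.rawSemiring ℂ-rawRing) (λ i → w (Fin.suc i)))
      (⟦ proj₁ (sum-split (λ i → x (Fin.suc i))) ⟧ₑ ρ +i ⟦ proj₂ (sum-split (λ i → x (Fin.suc i))) ⟧ₑ ρ)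
      (h Fin.zero) (splits-sum k z (λ i → w (Fin.suc i)) (λ i → x (Fin.suc i)) (λ i → h (Fin.suc i)))
    where
    open Evaluation (ℝ-algebra s s²≃5)
    ρ = im z ∷ re z ∷ []

  evaluate-splits : ∀ m (P : Polynomial≤ m) (π : Fin (suc m) → K) → (∀ k → P k ℂ-Ring.≈ fromℝ (embed s s²≃5 (π k))) →
    ∀ z → Splits z (evaluate P z) (sum-split (λ k → split (con (π k) `* var 0F `^ toℕ k)))
  evaluate-splits m P π P≈ z = subst (λ v → Splits z v (sum-split (λ k → split (con (π k) `* var 0F `^ toℕ k))))
    (≡.sym (evaluate-unfold m P z))
    (splits-sum (suc m) z
      (λ i → RawRing._*_ ℂ-rawRing (P i) (RawSemiringOps._^_ (RawRing.rawSemiring ℂ-rawRing) z (toℕ i)))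
      (λ k → split (con (π k) `* var 0F `^ toℕ k))
      (λ k → splits-* z (P k) (RawSemiringOps._^_ (RawRing.rawSemiring ℂ-rawRing) z (toℕ k))
        (con (π k) , con 0ₖ) (power-split (var 1F , var 0F) (toℕ k))
        (coefficient k) (splits-^ z z (var 1F , var 0F) (toℕ k) (ℝR.refl {re z} , ℝR.refl {im z}))))
    where
    coefficient : ∀ k → Splits z (P k) (con (π k) , con 0ₖ)
    coefficient k = proj₁ (P≈ k) ,
      ≃-trans (im (P k)) 0ℝ (embed s s²≃5 0ₖ) (proj₂ (P≈ k)) (≃-sym (embed s s²≃5 0ₖ) 0ℝ (embed-0 s s²≃5 0ₖ ≡.refl))

-- Absolute values and the circle q|z|² = 1

reciprocal-nonNeg : ∀ p → 0ℚ ℚ.≤ p → 0ℚ ℚ.≤ reciprocal p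
reciprocal-nonNeg p 0≤p with p ℚ.≟ 0ℚ
... | yes _  = ℚ.≤-refl
... | no p≢0 = ℚ.<⇒≤ (ℚ.positive⁻¹ ((ℚ.1/ p) {{ℚ.≢-nonZero p≢0}})
    {{ℚ.1/pos⇒pos p {{ℚ.positive (ℚ.≰⇒> λ p≤0 → p≢0 (ℚ.≤-antisym p≤0 0≤p))}}}})

module _ (Q : Parameter) where
  open Parameter Q

  private
    r : ℝ
    r = 1/√q

  nonNeg-1/√q : EventuallyNonNeg r
  nonNeg-1/√q = 0 , λ n _ → reciprocal-nonNeg (seq (√ q) n) (0≤rootBelow n (seq q n))

  r*r≃ : ∀ m → q *ᵣ m ≃ 1ℝ → m ≃ r *ᵣ r
  r*r≃ m qm≃1 = inverse-unique ℝ-commutativeRing {q} {m} {r *ᵣ r} qm≃1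
    (≃-trans (q *ᵣ (r *ᵣ r)) (r *ᵣ r *ᵣ q) 1ℝ (ℝR.*-comm q (r *ᵣ r)) (1/√q²q≃1 Q))

  r≄0 : ¬ (r ≃ 0ℝ)
  r≄0 r≃0 = 1ℝ≄0ℝ (≃-trans 1ℝ (r *ᵣ r *ᵣ q) 0ℝ (≃-sym (r *ᵣ r *ᵣ q) 1ℝ (1/√q²q≃1 Q))
    (*-zeroˡ (r *ᵣ r) q (*-zeroˡ r r r≃0)))

  abs² : ℂ → ℝ
  abs² z = re z *ᵣ re z +ᵣ im z *ᵣ im z

  nonNeg-abs² : ∀ z → EventuallyNonNeg (abs² z)
  nonNeg-abs² z = nonNeg-+ (re z *ᵣ re z) (im z *ᵣ im z) (nonNeg-square (re z)) (nonNeg-square (im z))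

  -- Both t = |z| and r = 1/√q have square 1/q, so (t + r)(t - r) = 0. The first factor is nonzero
  -- because t and r are nonnegative and r is nonzero.
  on-circle⇒abs : ∀ z → q *ᵣ abs² z ≃ 1ℝ → ∣ z ∣ ≃ 1/√q
  on-circle⇒abs z qm≃1 = difference≃0 (*ᵣ-cancel-zero (t +ᵣ r) (t -ᵣ r)
    (≃-trans ((t +ᵣ r) *ᵣ (t -ᵣ r)) (t *ᵣ t -ᵣ r *ᵣ r) 0ℝ
      (ℝ-Identities.by-normalisation ((var 0F `+ var 1F) `* (var 0F `- var 1F)) (var 0F `* var 0F `- var 1F `* var 1F)
        (t ∷ r ∷ []) ≡.refl)
      (≃-trans (t *ᵣ t -ᵣ r *ᵣ r) (r *ᵣ r -ᵣ r *ᵣ r) 0ℝ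
        (+ᵣ-cong (t *ᵣ t) (r *ᵣ r) (-ᵣ (r *ᵣ r)) (-ᵣ (r *ᵣ r))
          (≃-trans (t *ᵣ t) (abs² z) (r *ᵣ r) (√-squared (abs² z) (nonNeg-abs² z)) (r*r≃ (abs² z) qm≃1))
          (ℝR.refl { -ᵣ (r *ᵣ r)}))
        (ℝR.-‿inverseʳ (r *ᵣ r))))
    λ t+r≃0 → r≄0 (nonNeg-sum≃0ʳ t r (nonNeg-√ (abs² z)) nonNeg-1/√q t+r≃0))
    where
    t : ℝ
    t = √ (abs² z)
    difference≃0 : t -ᵣ r ≃ 0ℝ → t ≃ r
    difference≃0 h = ≃-trans t (t -ᵣ r +ᵣ r) r
      (ℝ-Identities.by-normalisation (var 0F) (var 0F `- var 1F `+ var 1F) (t ∷ r ∷ []) ≡.refl)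
      (≃-trans (t -ᵣ r +ᵣ r) (0ℝ +ᵣ r) r (+ᵣ-cong (t -ᵣ r) 0ℝ r r h (ℝR.refl {r})) (ℝR.+-identityˡ r))

  abs⇒on-circle : ∀ z → ∣ z ∣ ≃ 1/√q → q *ᵣ abs² z ≃ 1ℝ
  abs⇒on-circle z t≃r = ≃-trans (q *ᵣ abs² z) (q *ᵣ (r *ᵣ r)) 1ℝ
    (*ᵣ-cong q q (abs² z) (r *ᵣ r) (ℝR.refl {q})
      (≃-trans (abs² z) (t *ᵣ t) (r *ᵣ r) (≃-sym (t *ᵣ t) (abs² z) (√-squared (abs² z) (nonNeg-abs² z)))
        (*ᵣ-cong t r t r t≃r t≃r)))
    (≃-trans (q *ᵣ (r *ᵣ r)) (r *ᵣ r *ᵣ q) 1ℝ (ℝR.*-comm q (r *ᵣ r)) (1/√q²q≃1 Q))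
    where
    t : ℝ
    t = √ (abs² z)

-- Bisection with rational endpoints

-- Halving shrinks at least as fast as passing from 1/(n+1) to 1/(n+2). Interval widths are thus
-- bounded by `unit`, and `archimedean` provides the modulus of convergence.
half-unit : ∀ n → ½ ℚ.* unit n ℚ.≤ unit (suc n)
half-unit n = ℚ.toℚᵘ-cancel-≤ (ℚᵘ.≤-respˡ-≃ (ℚᵘ.≃-sym (ℚᵘ.≃-trans (ℚ.toℚᵘ-homo-* ½ (unit n))
    (ℚᵘ.*-cong {ℚ.toℚᵘ ½} {ℚ.toℚᵘ ½} ℚᵘ.≃-refl (toℚᵘ-/ 1 n))))
  (ℚᵘ.≤-respʳ-≃ (ℚᵘ.≃-sym (toℚᵘ-/ 1 (suc n)))
    (ℚᵘ.*≤* (subst₂ ℤ._≤_ (≡.sym (ℤ.*-identityˡ (+ suc (suc n)))) (≡.sym (ℤ.*-identityˡ (+ (2 ℕ.* suc n))))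
      (ℤ.+≤+ (ℕ.+-mono-≤ (ℕ.s≤s (ℕ.z≤n {n})) (ℕ.m≤m+n (suc n) 0)))))))

module Bisection (f : ℚ → ℚ) where
  open ℚ-Solver.+-*-Solver using (solve; _:=_; _:+_; _:*_; _:-_; con)

  record Bracket : Set where
    field
      l r : ℚ
      l≤r : l ℚ.≤ r
      f≤0 : f l ℚ.≤ 0ℚ
      0≤f : 0ℚ ℚ.≤ f r

  open Bracket

  width : Bracket → ℚ
  width B = r B ℚ.- l B

  midpoint : Bracket → ℚ
  midpoint B = ½ ℚ.* (l B ℚ.+ r B)

  l≤midpoint : ∀ B → l B ℚ.≤ midpoint B
  l≤midpoint B = subst (ℚ._≤ midpoint B) (solve 1 (λ l → con ½ :* (l :+ l) := l) ≡.refl (l B))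
    (ℚ.*-monoˡ-≤-nonNeg ½ (ℚ.+-monoʳ-≤ (l B) (l≤r B)))

  midpoint≤r : ∀ B → midpoint B ℚ.≤ r B
  midpoint≤r B = subst (midpoint B ℚ.≤_) (solve 1 (λ r → con ½ :* (r :+ r) := r) ≡.refl (r B))
    (ℚ.*-monoˡ-≤-nonNeg ½ (ℚ.+-monoˡ-≤ (r B) (l≤r B)))

  record Refines (B B′ : Bracket) : Set where
    field
      l≤l : l B ℚ.≤ l B′
      r≤r : r B′ ℚ.≤ r B

  open Refines

  halve : ∀ B → ∃[ B′ ] Refines B B′ × width B′ ≡ ½ ℚ.* width B
  halve B with ℚ.≤-total (f (midpoint B)) 0ℚ
  ... | inj₁ fm≤0 = record { l = midpoint B ; r = r B ; l≤r = midpoint≤r B ; f≤0 = fm≤0 ; 0≤f = 0≤f B } ,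
        record { l≤l = l≤midpoint B ; r≤r = ℚ.≤-refl } ,
        solve 2 (λ l r → r :- con ½ :* (l :+ r) := con ½ :* (r :- l)) ≡.refl (l B) (r B)
  ... | inj₂ 0≤fm = record { l = l B ; r = midpoint B ; l≤r = l≤midpoint B ; f≤0 = f≤0 B ; 0≤f = 0≤fm } ,
        record { l≤l = ℚ.≤-refl ; r≤r = midpoint≤r B } ,
        solve 2 (λ l r → con ½ :* (l :+ r) :- l := con ½ :* (r :- l)) ≡.refl (l B) (r B)

  module _ (B : Bracket) (width≤1 : width B ℚ.≤ 1ℚ) where

    bracket : ℕ → Bracket
    bracket zero    = B
    bracket (suc n) = proj₁ (halve (bracket n))

    width≤unit : ∀ n → width (bracket n) ℚ.≤ unit n
    width≤unit zero    = width≤1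
    width≤unit (suc n) = subst (ℚ._≤ unit (suc n)) (≡.sym (proj₂ (proj₂ (halve (bracket n)))))
      (ℚ.≤-trans (ℚ.*-monoˡ-≤-nonNeg ½ (width≤unit n)) (half-unit n))

    refines : ∀ n k → Refines (bracket n) (bracket (k ℕ.+ n))
    refines n zero    = record { l≤l = ℚ.≤-refl ; r≤r = ℚ.≤-refl }
    refines n (suc k) = let step = proj₁ (proj₂ (halve (bracket (k ℕ.+ n)))) ; rest = refines n k in
      record { l≤l = ℚ.≤-trans (l≤l rest) (l≤l step) ; r≤r = ℚ.≤-trans (r≤r step) (r≤r rest) }

    refines-≤ : ∀ n m → n ℕ.≤ m → Refines (bracket n) (bracket m)
    refines-≤ n m n≤m = subst (λ k → Refines (bracket n) (bracket k)) (ℕ.m∸n+n≡m n≤m) (refines n (m ∸ n))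

    close : ∀ N p q → l (bracket N) ℚ.≤ p → p ℚ.≤ r (bracket N) → l (bracket N) ℚ.≤ q → q ℚ.≤ r (bracket N) →
      ∀ ε → unit N ℚ.≤ ε → ℚ.∣ p ℚ.- q ∣ ℚ.≤ ε
    close N p q l≤p p≤r l≤q q≤r ε unit≤ε = ∣∣-≤ (bound p q p≤r l≤q) (bound q p q≤r l≤p)
      where
      bound : ∀ p q → p ℚ.≤ r (bracket N) → l (bracket N) ℚ.≤ q → p ℚ.≤ q ℚ.+ ε
      bound p q p≤r l≤q = ℚ.≤-trans p≤r (subst (ℚ._≤ q ℚ.+ ε)
        (solve 2 (λ l r → l :+ (r :- l) := r) ≡.refl (l (bracket N)) (r (bracket N)))
        (ℚ.+-mono-≤ l≤q (ℚ.≤-trans (width≤unit N) unit≤ε)))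

    lower upper : ℝ
    seq    lower n = l (bracket n)
    cauchy lower ε 0<ε = let N , fine = archimedean ε 0<ε in N , λ m n N≤m N≤n →
      close N (l (bracket m)) (l (bracket n))
        (l≤l (refines-≤ N m N≤m)) (ℚ.≤-trans (l≤r (bracket m)) (r≤r (refines-≤ N m N≤m)))
        (l≤l (refines-≤ N n N≤n)) (ℚ.≤-trans (l≤r (bracket n)) (r≤r (refines-≤ N n N≤n))) ε (fine N ℕ.≤-refl)
    seq    upper n = r (bracket n)
    cauchy upper ε 0<ε = let N , fine = archimedean ε 0<ε in N , λ m n N≤m N≤n →
      close N (r (bracket m)) (r (bracket n))
        (ℚ.≤-trans (l≤l (refines-≤ N m N≤m)) (l≤r (bracket m))) (r≤r (refines-≤ N m N≤m))
        (ℚ.≤-trans (l≤l (refines-≤ N n N≤n)) (l≤r (bracket n))) (r≤r (refines-≤ N n N≤n)) ε (fine N ℕ.≤-refl)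

    lower≃upper : lower ≃ upper
    lower≃upper ε 0<ε = let N , fine = archimedean ε 0<ε in N , λ n N≤n →
      close n (l (bracket n)) (r (bracket n)) ℚ.≤-refl (l≤r (bracket n)) (l≤r (bracket n)) ℚ.≤-refl ε (fine n N≤n)

    -- At every stage f(l) ≤ 0 ≤ f(r). Continuity enters only as congruence: `lower` and `upper` are
    -- equal reals, so f(r) - f(l) is eventually at most ε, which places f(l) between -ε and 0.
    root : (F : ℝ → ℝ) → (∀ x y → x ≃ y → F x ≃ F y) → (∀ x n → seq (F x) n ≡ f (seq x n)) → F lower ≃ 0ℝ
    root F F-cong F-seq ε 0<ε = let N , h = F-cong lower upper lower≃upper ε 0<ε in N , λ n N≤n →
      let u = f (l (bracket n)) ; v = f (r (bracket n)) in
      ∣∣-≤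
        (ℚ.≤-trans (ℚ.≤-reflexive (F-seq lower n)) (ℚ.≤-trans (f≤0 (bracket n))
          (ℚ.≤-trans (ℚ.<⇒≤ 0<ε) (ℚ.≤-reflexive (≡.sym (ℚ.+-identityˡ ε))))))
        (ℚ.≤-trans (0≤f (bracket n)) (ℚ.≤-trans (ℚ.≤-reflexive (solve 2 (λ u v → v := u :+ (v :- u)) ≡.refl u v))
          (subst (λ p → u ℚ.+ (v ℚ.- u) ℚ.≤ p ℚ.+ ε) (≡.sym (F-seq lower n)) (ℚ.+-monoʳ-≤ u
            (ℚ.≤-trans (p≤∣p∣ (v ℚ.- u)) (subst (ℚ._≤ ε)
              (≡.trans (cong₂ (λ p q → ℚ.∣ p ℚ.- q ∣) (F-seq lower n) (F-seq upper n)) (∣-∣-sym u v))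
              (h n N≤n)))))))

-- Rational bounds for √5, and conjugation √5 ↦ -√5

√5-upper : ∀ n → seq √5 n ℚ.≤ + 22361 ℚ./ 10000
√5-upper n = ℚ.≮⇒≥ λ h<r → ℚ.<-irrefl ≡.refl (ℚ.<-≤-trans {+ 5 ℚ./ 1} {(+ 22361 ℚ./ 10000) ℚ.* (+ 22361 ℚ./ 10000)}
  (ℚ.≰⇒> (λ h → ℚ.≤⇒≤ᵇ h))
  (ℚ.≤-trans (*-mono-≤ (ℚ.nonNegative⁻¹ (+ 22361 ℚ./ 10000)) (0≤rootBelow n (+ 5 ℚ./ 1))
    (ℚ.<⇒≤ h<r) (ℚ.<⇒≤ h<r)) (rootBelow-lower n (+ 5 ℚ./ 1))))

-- The n-th term is a multiple of 1/(n+1) below √5, so a sharp lower bound holds only from some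
-- index on. If a term were below 2.236 with step at most 10⁻⁶, term plus step would be at most
-- 2.23602, whose square is still below 5.
√5-lower : ∃[ N ] (∀ n → N ℕ.≤ n → + 2236 ℚ./ 1000 ℚ.≤ seq √5 n)
√5-lower = let N , fine = archimedean δ (ℚ.positive⁻¹ δ) in N , λ n N≤n →
  ℚ.≮⇒≥ λ r<lo → ℚ.<-irrefl ≡.refl (ℚ.<-≤-trans (rootBelow-upper n (+ 5 ℚ./ 1))
    (ℚ.≤-trans (*-mono-≤ (ℚ.+-mono-≤ (0≤rootBelow n (+ 5 ℚ./ 1)) (0≤unit n))
        (ℚ.nonNegative⁻¹ (+ 223602 ℚ./ 100000))
        (bound n r<lo (fine n N≤n)) (bound n r<lo (fine n N≤n)))
      (ℚ.≤ᵇ⇒≤ {(+ 223602 ℚ./ 100000) ℚ.* (+ 223602 ℚ./ 100000)} {+ 5 ℚ./ 1} _)))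
  where
  δ : ℚ
  δ = + 1 ℚ./ 1000000
  bound : ∀ n → seq √5 n ℚ.< + 2236 ℚ./ 1000 → unit n ℚ.≤ δ → seq √5 n ℚ.+ unit n ℚ.≤ + 223602 ℚ./ 100000
  bound n r<lo u≤δ = ℚ.≤-trans (ℚ.+-mono-≤ (ℚ.<⇒≤ r<lo) u≤δ)
    (ℚ.≤ᵇ⇒≤ {(+ 2236 ℚ./ 1000) ℚ.+ δ} {+ 223602 ℚ./ 100000} _)

-√5-between : Between (ℚ.- (+ 22361 ℚ./ 10000)) (ℚ.- (+ 2236 ℚ./ 1000)) (-ᵣ √5)
-√5-between = let N , h = √5-lower in N , λ n N≤n →
  ℚ.neg-antimono-≤ (√5-upper n) , ℚ.neg-antimono-≤ (h n N≤n)

conjugateₑ : ∀ {n} → Expr n → Expr n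
conjugateₑ (con a)  = con (conjugate a)
conjugateₑ (var i)  = var i
conjugateₑ (f `+ g) = conjugateₑ f `+ conjugateₑ g
conjugateₑ (f `* g) = conjugateₑ f `* conjugateₑ g
conjugateₑ (`- f)   = `- conjugateₑ f
conjugateₑ (f `^ k) = conjugateₑ f `^ k

module _ (s : ℝ) (s²≃5 : s *ᵣ s ≃ 5ℝ) (s′²≃5 : (-ᵣ s) *ᵣ (-ᵣ s) ≃ 5ℝ) where
  private
    module E = Evaluation (ℝ-algebra s s²≃5)
    module E′ = Evaluation (ℝ-algebra (-ᵣ s) s′²≃5)

  embed-conjugate : ∀ a → embed (-ᵣ s) s′²≃5 a ≃ embed s s²≃5 (conjugate a)
  embed-conjugate ⟪ a , b , k ⟫ = ≃-pointwise (embed (-ᵣ s) s′²≃5 ⟪ a , b , k ⟫) (embed s s²≃5 (conjugate ⟪ a , b , k ⟫)) λ n →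
    cong (rat a k ℚ.+_) (≡.trans (≡.sym (ℚ.neg-distribʳ-* (rat b k) (seq s n)))
      (≡.trans (ℚ.neg-distribˡ-* (rat b k) (seq s n)) (cong (ℚ._* seq s n) (≡.sym (rat-neg b k)))))

  -- Carries what is known at -√5 over to the conjugate factor at √5, where it can be multiplied
  -- with the sextic.
  ⟦conjugate⟧ : ∀ {n} (f : Expr n) ρ → E′.⟦ f ⟧ₑ ρ ≃ E.⟦ conjugateₑ f ⟧ₑ ρ
  ⟦conjugate⟧ (con a)  ρ = embed-conjugate a
  ⟦conjugate⟧ (var i)  ρ = ℝR.refl {Vec.lookup ρ i}
  ⟦conjugate⟧ (f `+ g) ρ = +ᵣ-cong (E′.⟦ f ⟧ₑ ρ) (E.⟦ conjugateₑ f ⟧ₑ ρ) (E′.⟦ g ⟧ₑ ρ) (E.⟦ conjugateₑ g ⟧ₑ ρ)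
    (⟦conjugate⟧ f ρ) (⟦conjugate⟧ g ρ)
  ⟦conjugate⟧ (f `* g) ρ = *ᵣ-cong (E′.⟦ f ⟧ₑ ρ) (E.⟦ conjugateₑ f ⟧ₑ ρ) (E′.⟦ g ⟧ₑ ρ) (E.⟦ conjugateₑ g ⟧ₑ ρ)
    (⟦conjugate⟧ f ρ) (⟦conjugate⟧ g ρ)
  ⟦conjugate⟧ (`- f)   ρ = -ᵣ-cong (E′.⟦ f ⟧ₑ ρ) (E.⟦ conjugateₑ f ⟧ₑ ρ) (⟦conjugate⟧ f ρ)
  ⟦conjugate⟧ (f `^ k) ρ = E.^-cong {E′.⟦ f ⟧ₑ ρ} {E.⟦ conjugateₑ f ⟧ₑ ρ} k (⟦conjugate⟧ f ρ)

-- The product of the sextic and its conjugate under √5 ↦ -√5 is -256/125 times this polynomial.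
norm-coefficients : List ℤ
norm-coefficients = -ᶻ 125 ∷ + 0 ∷ + 100 ∷ + 1400 ∷ + 2000 ∷ + 4000 ∷ + 960 ∷ + 2560 ∷ -ᶻ 1280
  ∷ + 0 ∷ -ᶻ 4096 ∷ -ᶻ 2048 ∷ -ᶻ 4096 ∷ []

integral : List ℤ → Poly 1
integral = map λ z → ⟪ z , + 0 , 0 ⟫

horner : List ℤ → ℚ → ℚ
horner []       t = 0ℚ
horner (z ∷ zs) t = rat z 0 ℚ.+ t ℚ.* horner zs t

module _ (s : ℝ) (s²≃5 : s *ᵣ s ≃ 5ℝ) where
  open Evaluation (ℝ-algebra s s²≃5)

  horner-seq : ∀ zs t n → seq (eval (integral zs) (t ∷ [])) n ≡ horner zs (seq t n)
  horner-seq []       t n = ≡.refl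
  horner-seq (z ∷ zs) t n = cong₂ (λ p q → p ℚ.+ seq t n ℚ.* q)
    (≡.trans (cong (rat z 0 ℚ.+_) (ℚ.*-zeroˡ (seq s n))) (ℚ.+-identityʳ (rat z 0))) (horner-seq zs t n)

  eval-cong₁ : ∀ (p : Poly 1) t u → t ≃ u → eval p (t ∷ []) ≃ eval p (u ∷ [])
  eval-cong₁ []       t u t≃u = ℝR.refl {0ℝ}
  eval-cong₁ (a ∷ as) t u t≃u = +ᵣ-cong (embed s s²≃5 a) (embed s s²≃5 a)
    (t *ᵣ eval as (t ∷ [])) (u *ᵣ eval as (u ∷ [])) (ℝR.refl {embed s s²≃5 a})
    (*ᵣ-cong t u (eval as (t ∷ [])) (eval as (u ∷ [])) t≃u (eval-cong₁ as t u t≃u))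

private
  module B = Bisection (horner norm-coefficients)

starting-bracket : B.Bracket
starting-bracket = record
  { l = + 1 ℚ./ 4 ; r = ½ ; l≤r = ℚ.≤ᵇ⇒≤ _
  ; f≤0 = ℚ.≤ᵇ⇒≤ {horner norm-coefficients (+ 1 ℚ./ 4)} {0ℚ} _
  ; 0≤f = ℚ.≤ᵇ⇒≤ {0ℚ} {horner norm-coefficients ½} _ }

-- The interval [1/4, 1/2] lies below both 1/√q⁺ ≈ 0.588 and 1/√q⁻ ≈ 0.951, so `τ` is on neither
-- circle.
τ : ℝ
τ = B.lower starting-bracket (ℚ.≤ᵇ⇒≤ {½ ℚ.- (+ 1 ℚ./ 4)} {1ℚ} _)

1/4≤τ : ∀ n → + 1 ℚ./ 4 ℚ.≤ seq τ n
1/4≤τ n = B.Refines.l≤l (B.refines-≤ starting-bracket (ℚ.≤ᵇ⇒≤ _) 0 n ℕ.z≤n)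

τ≤1/2 : ∀ n → seq τ n ℚ.≤ ½
τ≤1/2 n = ℚ.≤-trans (B.Bracket.l≤r (B.bracket starting-bracket (ℚ.≤ᵇ⇒≤ _) n))
  (B.Refines.r≤r (B.refines-≤ starting-bracket (ℚ.≤ᵇ⇒≤ _) 0 n ℕ.z≤n))

norm-root : Evaluation.eval (ℝ-algebra √5 √5-squared) (integral norm-coefficients) (τ ∷ []) ≃ 0ℝ
norm-root = B.root starting-bracket (ℚ.≤ᵇ⇒≤ _)
  (λ t → Evaluation.eval (ℝ-algebra √5 √5-squared) (integral norm-coefficients) (t ∷ []))
  (eval-cong₁ √5 √5-squared (integral norm-coefficients))
  (horner-seq √5 √5-squared norm-coefficients)

imaginary-sextic? : SamePoly 1 (coefficientOf (normalise (proj₂ (split sextic))) 0) (normalise (con 0ₖ))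
imaginary-sextic? = ≡.refl

module _ (s : ℝ) (s²≃5 : s *ᵣ s ≃ 5ℝ) where
  private
    e = embed s s²≃5
    open Evaluation (ℝ-algebra s s²≃5)

  qOf-embedded : qOf s ≃ e qₖ
  qOf-embedded = ℝR.refl {qOf s}

  qOf-1-embedded : qOf s -ᵣ 1ℝ ≃ e q-1ₖ
  qOf-1-embedded = ≃-trans (qOf s -ᵣ 1ℝ) (e (qₖ +ₖ -ₖ 1ₖ)) (e q-1ₖ)
    (≃-trans (qOf s -ᵣ 1ℝ) (e qₖ -ᵣ e 1ₖ) (e (qₖ +ₖ -ₖ 1ₖ))
      (+ᵣ-cong (qOf s) (e qₖ) (-ᵣ 1ℝ) (-ᵣ e 1ₖ) qOf-embedded
        (-ᵣ-cong 1ℝ (e 1ₖ) (≃-sym (e 1ₖ) 1ℝ (embed-rational s s²≃5 (+ 1) 0))))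
      (by-normalisation (con qₖ `- con 1ₖ) (con (qₖ +ₖ -ₖ 1ₖ)) [] ≡.refl))
    (by-normalisation (con (qₖ +ₖ -ₖ 1ₖ)) (con q-1ₖ) [] ≡.refl)

  -- From q ≤ 2 + (2/5)(9/4) ≤ 7/2 and x² ≤ 1/4 follows qx² ≤ 7/8, at distance at least 1/8 from 1.
  qx²≄1 : (∀ n → seq s n ℚ.≤ + 9 ℚ./ 4) → ∀ x → (∀ n → 0ℚ ℚ.≤ seq x n) → (∀ n → seq x n ℚ.≤ ½) →
    ¬ (qOf s *ᵣ (x *ᵣ x) ≃ 1ℝ)
  qx²≄1 s≤9/4 x 0≤x x≤½ = #⇒¬≃ (qOf s *ᵣ (x *ᵣ x)) 1ℝ (+ 1 ℚ./ 8 , ℚ.positive⁻¹ (+ 1 ℚ./ 8) , 0 , λ n _ →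
    ℚ.≤-trans (bound n) (ℚ.≤-trans (p≤∣p∣ (1ℚ ℚ.- seq (qOf s *ᵣ (x *ᵣ x)) n))
      (ℚ.≤-reflexive (∣-∣-sym 1ℚ (seq (qOf s *ᵣ (x *ᵣ x)) n)))))
    where
    q≤ : ∀ n → seq (qOf s) n ℚ.≤ + 7 ℚ./ 2
    q≤ n = ℚ.≤-trans (ℚ.+-monoʳ-≤ (+ 2 ℚ./ 1) (ℚ.*-monoˡ-≤-nonNeg (+ 2 ℚ./ 5) (s≤9/4 n))) (ℚ.≤ᵇ⇒≤ _)
    bound : ∀ n → + 1 ℚ./ 8 ℚ.≤ 1ℚ ℚ.- seq (qOf s *ᵣ (x *ᵣ x)) n
    bound n = ℚ.+-monoʳ-≤ 1ℚ (ℚ.neg-antimono-≤ (ℚ.≤-trans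
      (ℚ.*-monoʳ-≤-nonNeg (seq x n ℚ.* seq x n) {{ℚ.nonNegative (0≤p*q (0≤x n) (0≤x n))}} (q≤ n))
      (ℚ.*-monoˡ-≤-nonNeg (+ 7 ℚ./ 2) (*-mono-≤ (0≤x n) (ℚ.nonNegative⁻¹ ½) (x≤½ n) (x≤½ n)))))

  difference≃0⇒≃ : ∀ x → x -ᵣ e 1ₖ ≃ 0ℝ → x ≃ 1ℝ
  difference≃0⇒≃ x h = ≃-trans x (x -ᵣ e 1ₖ +ᵣ e 1ₖ) 1ℝ
    (by-normalisation (var 0F) (var 0F `- con 1ₖ `+ con 1ₖ) (x ∷ []) ≡.refl)
    (≃-trans (x -ᵣ e 1ₖ +ᵣ e 1ₖ) (0ℝ +ᵣ e 1ₖ) 1ℝ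
      (+ᵣ-cong (x -ᵣ e 1ₖ) 0ℝ (e 1ₖ) (e 1ₖ) h (ℝR.refl {e 1ₖ}))
      (≃-trans (0ℝ +ᵣ e 1ₖ) (e 1ₖ) 1ℝ (ℝR.+-identityˡ (e 1ₖ)) (embed-rational s s²≃5 (+ 1) 0)))

  -- At a real argument both parts of the sextic vanish, hence so does 256|P|² by the norm identity.
  -- Comparing norms spares a separate factorisation of P over ℂ.
  sextic-zero⇒zeta-zero : ∀ (P : Polynomial≤ 8) → (∀ k → P k ℂ-Ring.≈ fromℝ (e (πₖ k))) →
    ∀ t → ⟦ sextic ⟧ₑ (t ∷ []) ≃ 0ℝ → evaluate P (fromℝ t) ℂ-Ring.≈ ℂ-Ring.0#
  sextic-zero⇒zeta-zero P P≈ t h =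
    ≃-trans (re v) z₁ 0ℝ (proj₁ splits) (proj₁ zeta≃0) , ≃-trans (im v) z₂ 0ℝ (proj₂ splits) (proj₂ zeta≃0)
    where
    v = evaluate P (fromℝ t)
    ρ : Vec ℝ 2
    ρ = 0ℝ ∷ t ∷ []
    z₁ z₂ N₁ R I : ℝ
    z₁ = ⟦ proj₁ (split zetaₑ) ⟧ₑ ρ
    z₂ = ⟦ proj₂ (split zetaₑ) ⟧ₑ ρ
    N₁ = ⟦ norm² (split w₁) ⟧ₑ ρ
    R  = ⟦ proj₁ (split sextic) ⟧ₑ ρ
    I  = ⟦ proj₂ (split sextic) ⟧ₑ ρ
    splits : Splitting.Splits s s²≃5 (fromℝ t) v (split zetaₑ)
    splits = EvaluateSplits.evaluate-splits s s²≃5 8 P πₖ P≈ (fromℝ t)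
    R≃0 : R ≃ 0ℝ
    R≃0 = ≃-trans R (⟦ sextic ⟧ₑ (t ∷ [])) 0ℝ
      (restrict (ℝ-algebra s s²≃5) (proj₁ (split sextic)) sextic real-sextic? 0ℝ (t ∷ []) (ℝR.refl {0ℝ})) h
    I≃0 : I ≃ 0ℝ
    I≃0 = ≃-trans I (e 0ₖ) 0ℝ
      (restrict (ℝ-algebra s s²≃5) (proj₂ (split sextic)) (con 0ₖ) imaginary-sextic? 0ℝ (t ∷ []) (ℝR.refl {0ℝ}))
      (embed-0 s s²≃5 0ₖ ≡.refl)
    zeta≃0 : z₁ ≃ 0ℝ × z₂ ≃ 0ℝ
    zeta≃0 = Norms.norm²≃0 s s²≃5 ρ (split zetaₑ) (*ᵣ-cancel-zero (e ⟪ + 256 , + 0 , 0 ⟫) (z₁ *ᵣ z₁ +ᵣ z₂ *ᵣ z₂)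
      (≃-trans (⟦ con ⟪ + 256 , + 0 , 0 ⟫ `* norm² (split zetaₑ) ⟧ₑ ρ) (⟦ norm² (split w₁) `* norm² (split sextic) ⟧ₑ ρ) 0ℝ
        (≃-sym (⟦ norm² (split w₁) `* norm² (split sextic) ⟧ₑ ρ) (⟦ con ⟪ + 256 , + 0 , 0 ⟫ `* norm² (split zetaₑ) ⟧ₑ ρ)
          (by-normalisation (norm² (split w₁) `* norm² (split sextic)) (con ⟪ + 256 , + 0 , 0 ⟫ `* norm² (split zetaₑ)) ρ zeta-norm?))
        (*-zeroʳ N₁ (R *ᵣ R +ᵣ I *ᵣ I) (+-zero (R *ᵣ R) (I *ᵣ I) (*-zeroˡ R R R≃0) (*-zeroˡ I I I≃0))))
      -- 256 = 2⁸ has the inverse 105⁸ / 210⁸.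
      (unit-≄0 s s²≃5 ⟪ + 256 , + 0 , 0 ⟫ ⟪ + (105 ℕ.^ 8) , + 0 , 8 ⟫ ≡.refl))

norm-factorisation? : SamePoly 1 (normalise (con ⟪ + 125 , + 0 , 0 ⟫ `* (sextic `* conjugateₑ sextic)))
  (constant ⟪ -ᶻ 256 , + 0 , 0 ⟫ ⊗ integral norm-coefficients)
norm-factorisation? = ≡.refl

private
  lo hi : ℚ
  lo = ℚ.- (+ 22361 ℚ./ 10000)
  hi = ℚ.- (+ 2236 ℚ./ 1000)

  0<_ : ∀ k → {_ : 1ℚ ℚ.≤ rat (K.rational k) (K.scale k) ℚ.+ rat (K.radical k) (K.scale k) ℚ.* lo} →
    {_ : 1ℚ ℚ.≤ rat (K.rational k) (K.scale k) ℚ.+ rat (K.radical k) (K.scale k) ℚ.* hi} →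
    Positive (embed (-ᵣ √5) -√5-squared k)
  0<_ ⟪ a , b , k ⟫ {at-lo} {at-hi} = embed-positive (-ᵣ √5) -√5-squared lo hi -√5-between a b k at-lo at-hi

module NegativeCircle = Circle (-ᵣ √5) -√5-squared
  ((0< qₖ) {ℚ.≤ᵇ⇒≤ _} {ℚ.≤ᵇ⇒≤ _})
  ((0< d₁) {ℚ.≤ᵇ⇒≤ _} {ℚ.≤ᵇ⇒≤ _}) ((0< d₂) {ℚ.≤ᵇ⇒≤ _} {ℚ.≤ᵇ⇒≤ _}) ((0< d₃) {ℚ.≤ᵇ⇒≤ _} {ℚ.≤ᵇ⇒≤ _})
  ((0< e₀) {ℚ.≤ᵇ⇒≤ _} {ℚ.≤ᵇ⇒≤ _}) ((0< e₁) {ℚ.≤ᵇ⇒≤ _} {ℚ.≤ᵇ⇒≤ _})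
  ((0< e₂) {ℚ.≤ᵇ⇒≤ _} {ℚ.≤ᵇ⇒≤ _}) ((0< e₃) {ℚ.≤ᵇ⇒≤ _} {ℚ.≤ᵇ⇒≤ _})

q⁺≃ : Parameter.q q⁺ ≃ embed √5 √5-squared qₖ
q⁺≃ = qOf-embedded √5 √5-squared

q⁺-1≃ : Parameter.q q⁺ -ᵣ 1ℝ ≃ embed √5 √5-squared q-1ₖ
q⁺-1≃ = qOf-1-embedded √5 √5-squared

q⁻≃ : Parameter.q q⁻ ≃ embed (-ᵣ √5) -√5-squared qₖ
q⁻≃ = qOf-embedded (-ᵣ √5) -√5-squared

q⁻-1≃ : Parameter.q q⁻ -ᵣ 1ℝ ≃ embed (-ᵣ √5) -√5-squared q-1ₖ
q⁻-1≃ = qOf-1-embedded (-ᵣ √5) -√5-squared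

0≤τ : ∀ n → 0ℚ ℚ.≤ seq τ n
0≤τ n = ℚ.≤-trans (ℚ.nonNegative⁻¹ (+ 1 ℚ./ 4)) (1/4≤τ n)

-- At `τ` the conjugate factor is the sextic belonging to q⁻, and `real-root` would give q⁻τ² = 1,
-- which is out of reach for τ ≤ 1/2.
conjugate-sextic≄0 : ¬ (Evaluation.⟦_⟧ₑ (ℝ-algebra √5 √5-squared) (conjugateₑ sextic) (τ ∷ []) ≃ 0ℝ)
conjugate-sextic≄0 h = qx²≄1 (-ᵣ √5) -√5-squared -√5≤9/4 τ 0≤τ τ≤1/2
  (difference≃0⇒≃ (-ᵣ √5) -√5-squared (qOf (-ᵣ √5) *ᵣ (τ *ᵣ τ))
    (NegativeCircle.real-root τ 0ℝ (≃-trans (E′.⟦ sextic ⟧ₑ (τ ∷ [])) (E.⟦ conjugateₑ sextic ⟧ₑ (τ ∷ [])) 0ℝ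
      (⟦conjugate⟧ √5 √5-squared -√5-squared sextic (τ ∷ [])) h)))
  where
  module E = Evaluation (ℝ-algebra √5 √5-squared)
  module E′ = Evaluation (ℝ-algebra (-ᵣ √5) -√5-squared)
  -√5≤9/4 : ∀ n → seq (-ᵣ √5) n ℚ.≤ + 9 ℚ./ 4
  -√5≤9/4 n = ℚ.≤-trans (ℚ.neg-antimono-≤ (0≤rootBelow n (+ 5 ℚ./ 1))) (ℚ.≤ᵇ⇒≤ _)

sextic-at-τ : Evaluation.⟦_⟧ₑ (ℝ-algebra √5 √5-squared) sextic (τ ∷ []) ≃ 0ℝ
sextic-at-τ = *ᵣ-cancel-zero C S
  (≃-trans (C *ᵣ S) (S *ᵣ C) 0ℝ (ℝR.*-comm C S)
    (*ᵣ-cancel-zero (embed √5 √5-squared ⟪ + 125 , + 0 , 0 ⟫) (S *ᵣ C)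
      (≃-trans (⟦ product ⟧ₑ (τ ∷ [])) (eval (normalise product) (τ ∷ [])) 0ℝ
        (≃-sym (eval (normalise product) (τ ∷ [])) (⟦ product ⟧ₑ (τ ∷ [])) (normalise-correct product (τ ∷ [])))
        (≃-trans (eval (normalise product) (τ ∷ [])) (eval (constant c ⊗ ν) (τ ∷ [])) 0ℝ
          (eval-≈ (normalise product) (constant c ⊗ ν) (τ ∷ []) norm-factorisation?)
          (≃-trans (eval (constant c ⊗ ν) (τ ∷ [])) (eval (constant c) (τ ∷ []) *ᵣ eval ν (τ ∷ [])) 0ℝ
            (eval-⊗ (constant c) ν (τ ∷ []))
            (*-zeroʳ (eval (constant c) (τ ∷ [])) (eval ν (τ ∷ [])) norm-root))))
      (unit-≄0 √5 √5-squared ⟪ + 125 , + 0 , 0 ⟫ ⟪ + (42 ℕ.^ 3) , + 0 , 3 ⟫ ≡.refl)))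
  conjugate-sextic≄0
  where
  open Evaluation (ℝ-algebra √5 √5-squared)
  c : K
  c = ⟪ -ᶻ 256 , + 0 , 0 ⟫
  ν : Poly 1
  ν = integral norm-coefficients
  product : Expr 1
  product = con ⟪ + 125 , + 0 , 0 ⟫ `* (sextic `* conjugateₑ sextic)
  S C : ℝ
  S = ⟦ sextic ⟧ₑ (τ ∷ [])
  C = ⟦ conjugateₑ sextic ⟧ₑ (τ ∷ [])

-- The Riemann hypothesis for the two signs

RH-intro : ∀ Q n (A : Form n) d → HasLeadingIndex A d → 2 ℕ.≤ toℕ d → ∀ P → IsZetaPolynomial Q A d P →
  (∀ P′ → IsZetaPolynomial Q A d P′ → ∀ i → P′ i ℂ-Ring.≈ P i) →
  (∀ z → evaluate P z ℂ-Ring.≈ ℂ-Ring.0# → ∣ z ∣ ≃ Parameter.1/√q Q) → SatisfiesRH Q A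
RH-intro Q n A d leading 2≤d P zeta unique rh = (d , leading , 2≤d , P , zeta , unique) , rh

RH-elim : ∀ Q n (A : Form n) → SatisfiesRH Q A → ∃[ d ] HasLeadingIndex A d × 2 ℕ.≤ toℕ d ×
  ∃[ P ] IsZetaPolynomial Q A d P × (∀ z → evaluate P z ℂ-Ring.≈ ℂ-Ring.0# → ∣ z ∣ ≃ Parameter.1/√q Q)
RH-elim Q n A ((d , leading , 2≤d , P , zeta , unique) , rh) = d , leading , 2≤d , P , zeta , rh

leading-index-unique : ∀ n (A : Form n) d d′ → HasLeadingIndex A d → HasLeadingIndex A d′ → d ≡ d′
leading-index-unique n A d d′ leading leading′ = Fin.≤-antisym (minimal d d′ leading leading′) (minimal d′ d leading′ leading)
  where
  minimal : ∀ d d′ → HasLeadingIndex A d → HasLeadingIndex A d′ → toℕ d ℕ.≤ toℕ d′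
  minimal d d′ leading leading′ = ℕ.≮⇒≥ λ d′<d → HasLeadingIndex.nonzero leading′
    (HasLeadingIndex.gap leading d′ (HasLeadingIndex.0<d leading′) d′<d)

φ₁₀-RH-intro : ∀ s s²≃5 Q q≃ q-1≃ →
  (∀ z → evaluate (φ₁₀-zeta s s²≃5 Q q≃ q-1≃) z ℂ-Ring.≈ ℂ-Ring.0# → ∣ z ∣ ≃ Parameter.1/√q Q) → SatisfiesRH Q (φ₁₀ s)
φ₁₀-RH-intro s s²≃5 Q q≃ q-1≃ rh = RH-intro Q 10 (φ₁₀ s) 2F (φ₁₀-leading s s²≃5) ℕ.≤-refl
  (φ₁₀-zeta s s²≃5 Q q≃ q-1≃) (φ₁₀-isZeta s s²≃5 Q q≃ q-1≃)
  (λ P′ zeta′ → φ₁₀-zeta-unique s s²≃5 Q q≃ q-1≃ P′ (φ₁₀-zeta s s²≃5 Q q≃ q-1≃) zeta′ (φ₁₀-isZeta s s²≃5 Q q≃ q-1≃))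
  rh

-- A proof of `SatisfiesRH` brings its own leading index and polynomial. Uniqueness identifies the
-- index with 2 and the coefficients with those of `πₖ`, so that the refutation applies.
φ₁₀-¬RH : ∀ s s²≃5 Q (q≃ : Parameter.q Q ≃ embed s s²≃5 qₖ) (q-1≃ : Parameter.q Q -ᵣ 1ℝ ≃ embed s s²≃5 q-1ₖ) →
  (∀ P → (∀ k → P k ℂ-Ring.≈ fromℝ (embed s s²≃5 (πₖ k))) →
    ¬ (∀ z → evaluate P z ℂ-Ring.≈ ℂ-Ring.0# → ∣ z ∣ ≃ Parameter.1/√q Q)) →
  ¬ SatisfiesRH Q (φ₁₀ s)
φ₁₀-¬RH s s²≃5 Q q≃ q-1≃ refutation rh = refute (RH-elim Q 10 (φ₁₀ s) rh)
  where
  at-2 : ∀ d → d ≡ 2F → ∀ P → IsZetaPolynomial Q (φ₁₀ s) d P →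
    ¬ (∀ z → evaluate P z ℂ-Ring.≈ ℂ-Ring.0# → ∣ z ∣ ≃ Parameter.1/√q Q)
  at-2 .2F ≡.refl P zeta = refutation P
    (φ₁₀-zeta-unique s s²≃5 Q q≃ q-1≃ P (φ₁₀-zeta s s²≃5 Q q≃ q-1≃) zeta (φ₁₀-isZeta s s²≃5 Q q≃ q-1≃))
  refute : ¬ (∃[ d ] HasLeadingIndex (φ₁₀ s) d × 2 ℕ.≤ toℕ d ×
    ∃[ P ] IsZetaPolynomial Q (φ₁₀ s) d P × (∀ z → evaluate P z ℂ-Ring.≈ ℂ-Ring.0# → ∣ z ∣ ≃ Parameter.1/√q Q))
  refute (d , leading , 2≤d , P , zeta , rh) =
    at-2 d (leading-index-unique 10 (φ₁₀ s) d 2F leading (φ₁₀-leading s s²≃5)) P zeta rh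

zeta-zeros⁻ : ∀ P → (∀ k → P k ℂ-Ring.≈ fromℝ (embed (-ᵣ √5) -√5-squared (πₖ k))) →
  ∀ z → evaluate P z ℂ-Ring.≈ ℂ-Ring.0# → ∣ z ∣ ≃ Parameter.1/√q q⁻
zeta-zeros⁻ P P≈ z (re≃0 , im≃0) =
  on-circle⇒abs q⁻ z (difference≃0⇒≃ (-ᵣ √5) -√5-squared (Parameter.q q⁻ *ᵣ abs² q⁻ z)
    (NegativeCircle.zeta-zero-on-circle (re z) (im z)
      (≃-trans (⟦ proj₁ (split zetaₑ) ⟧ₑ (im z ∷ re z ∷ [])) (re (evaluate P z)) 0ℝ
        (≃-sym (re (evaluate P z)) (⟦ proj₁ (split zetaₑ) ⟧ₑ (im z ∷ re z ∷ [])) (proj₁ splits)) re≃0)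
      (≃-trans (⟦ proj₂ (split zetaₑ) ⟧ₑ (im z ∷ re z ∷ [])) (im (evaluate P z)) 0ℝ
        (≃-sym (im (evaluate P z)) (⟦ proj₂ (split zetaₑ) ⟧ₑ (im z ∷ re z ∷ [])) (proj₂ splits)) im≃0)))
  where
  open Evaluation (ℝ-algebra (-ᵣ √5) -√5-squared)
  splits : Splitting.Splits (-ᵣ √5) -√5-squared z (evaluate P z) (split zetaₑ)
  splits = EvaluateSplits.evaluate-splits (-ᵣ √5) -√5-squared 8 P πₖ P≈ z

zeta-zero⁺ : ∀ P → (∀ k → P k ℂ-Ring.≈ fromℝ (embed √5 √5-squared (πₖ k))) →
  ¬ (∀ z → evaluate P z ℂ-Ring.≈ ℂ-Ring.0# → ∣ z ∣ ≃ Parameter.1/√q q⁺)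
zeta-zero⁺ P P≈ rh = qx²≄1 √5 √5-squared √5≤9/4 τ 0≤τ τ≤1/2
  (≃-trans (qOf √5 *ᵣ (τ *ᵣ τ)) (qOf √5 *ᵣ abs² q⁺ (fromℝ τ)) 1ℝ
    (≃-pointwise (qOf √5 *ᵣ (τ *ᵣ τ)) (qOf √5 *ᵣ abs² q⁺ (fromℝ τ)) λ n →
      cong (seq (qOf √5) n ℚ.*_) (≡.sym (ℚ.+-identityʳ (seq τ n ℚ.* seq τ n))))
    (abs⇒on-circle q⁺ (fromℝ τ) (rh (fromℝ τ) (sextic-zero⇒zeta-zero √5 √5-squared P P≈ τ sextic-at-τ))))
  where
  √5≤9/4 : ∀ n → seq √5 n ℚ.≤ + 9 ℚ./ 4
  √5≤9/4 n = ℚ.≤-trans (√5-upper n) (ℚ.≤ᵇ⇒≤ _)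

φ₁₀⁺≡ : φ₁₀ √5 ≡ φ₁₀⁺
φ₁₀⁺≡ = ≡.refl

φ₁₀⁻≡ : φ₁₀ (-ᵣ √5) ≡ φ₁₀⁻
φ₁₀⁻≡ = ≡.refl

φ₁₀-extremal : ∀ s s²≃5 Q (q≃ : Parameter.q Q ≃ embed s s²≃5 qₖ) (q-1≃ : Parameter.q Q -ᵣ 1ℝ ≃ embed s s²≃5 q-1ₖ) →
  IsExtremal Q 2 (φ₁₀ s)
φ₁₀-extremal s s²≃5 Q q≃ q-1≃ = Extremality.φ₁₀-extremal s s²≃5 Q q≃ q-1≃
  -- The last two `≡.refl` compute that the coefficients `φₖ` satisfy W^σ = -W and that `weights`
  -- eliminates the even coefficients from y⁴ on.
  (λ i → normalise (anti-invariance 10 i)) (λ _ → ≡.refl) ≡.refl ≡.refl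

extremal⁺ : IsExtremal q⁺ 2 φ₁₀⁺
extremal⁺ = subst (IsExtremal q⁺ 2) φ₁₀⁺≡ (φ₁₀-extremal √5 √5-squared q⁺ q⁺≃ q⁺-1≃)

zeta⁺ : ZetaPolynomial q⁺ φ₁₀⁺
zeta⁺ = subst (ZetaPolynomial q⁺) φ₁₀⁺≡ (φ₁₀-zetaPolynomial √5 √5-squared q⁺ q⁺≃ q⁺-1≃)

¬RH⁺ : ¬ SatisfiesRH q⁺ φ₁₀⁺
¬RH⁺ = subst (λ A → ¬ SatisfiesRH q⁺ A) φ₁₀⁺≡ (φ₁₀-¬RH √5 √5-squared q⁺ q⁺≃ q⁺-1≃ zeta-zero⁺)

extremal⁻ : IsExtremal q⁻ 2 φ₁₀⁻
extremal⁻ = subst (IsExtremal q⁻ 2) φ₁₀⁻≡ (φ₁₀-extremal (-ᵣ √5) -√5-squared q⁻ q⁻≃ q⁻-1≃)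

RH⁻ : SatisfiesRH q⁻ φ₁₀⁻
RH⁻ = subst (SatisfiesRH q⁻) φ₁₀⁻≡ (φ₁₀-RH-intro (-ᵣ √5) -√5-squared q⁻ q⁻≃ q⁻-1≃
  (zeta-zeros⁻ (φ₁₀-zeta (-ᵣ √5) -√5-squared q⁻ q⁻≃ q⁻-1≃) λ k → ℝR.refl {embed (-ᵣ √5) -√5-squared (πₖ k)} , ℝR.refl {0ℝ}))

theorem5p7 : (IsExtremal q⁺ 2 φ₁₀⁺ × ZetaPolynomial q⁺ φ₁₀⁺ × ¬ SatisfiesRH q⁺ φ₁₀⁺)
    × (IsExtremal q⁻ 2 φ₁₀⁻ × SatisfiesRH q⁻ φ₁₀⁻)
theorem5p7 = (extremal⁺ , zeta⁺ , ¬RH⁺) , (extremal⁻ , RH⁻)
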